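{- Let $ex_2(SC_3^3,n)$ denote the maximum number of edges of an $n$-vertex geometric $3$-hypergraph in the plane that does not contain three strongly crossing edges. Then $ex_2(SC_3^3,n)=\Theta(n^2)$ as $n\to\infty$; that is, there exist absolute constants $c,C>0$ and $n_0$ such that $c\,n^2\le ex_2(SC_3^3,n)\le C\,n^2$ for all $n\ge n_0$.
   Context: A geometric $3$-hypergraph in the plane is a pair $H=(V,E)$, where $V$ is a finite set of points in general position in $\mathbb{R}^2$ (no three on a line) and $E$ is a set of closed triangles, each being the convex hull of some $3$-element subset of $V$ (its vertices). $H$ is $n$-vertex if $|V|=n$. $H$ contains $k$ strongly crossing edges if there are $k$ edges in $E$ that are pairwise vertex disjoint (no two share a vertex) and such that all $k$ closed triangles have a common point. -}

module Defs where

open import Algebra.Bundles using (CommutativeMonoid)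
import Algebra.Properties.CommutativeSemigroup as CommutativeSemigroup
open import Data.Nat.Base as ℕ using (ℕ)
import Data.Nat.Properties as ℕP
import Data.Integer.Base as ℤ
open import Data.Rational.Base
open import Data.Rational.Properties
open import Data.Fin.Base using (Fin)
open import Data.Fin.Subset as Subset using (Subset; _∩_; Empty)
open import Data.List.Base using (List; length)
open import Data.List.Membership.Propositional using (_∈_)
open import Data.List.Relation.Unary.All using (All)
open import Data.List.Relation.Unary.Unique.Propositional using (Unique)
open import Data.Product using (∃; _×_; _,_; proj₁; proj₂)
import Data.Vec.Functional as Vector
open import Relation.Binary.PropositionalEquality
open import Relation.Nullary using (¬_)

open CommutativeSemigroup
  (CommutativeMonoid.commutativeSemigroup +-0-commutativeMonoid)
  using (interchange)

-- The real numbers, as Cauchy sequences of rationals compared up to _≃ℝ_.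

IsCauchy : (ℕ → ℚ) → Set
IsCauchy x = ∀ ε → 0ℚ < ε →
  ∃ λ N → ∀ m n → N ℕ.≤ m → N ℕ.≤ n → ∣ x m - x n ∣ ≤ ε

record ℝ : Set where
  constructor mkℝ
  field
    seq    : ℕ → ℚ
    cauchy : IsCauchy seq

open ℝ public

infix 4 _≃ℝ_ _≤ℝ_ _<ℝ_

_≃ℝ_ : ℝ → ℝ → Set
x ≃ℝ y = ∀ ε → 0ℚ < ε → ∃ λ N → ∀ n → N ℕ.≤ n → ∣ seq x n - seq y n ∣ ≤ ε

_≤ℝ_ : ℝ → ℝ → Set
x ≤ℝ y = ∀ ε → 0ℚ < ε → ∃ λ N → ∀ n → N ℕ.≤ n → seq x n ≤ seq y n + ε

_<ℝ_ : ℝ → ℝ → Set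
x <ℝ y = ∃ λ ε → 0ℚ < ε × ∃ λ N → ∀ n → N ℕ.≤ n → seq x n + ε ≤ seq y n

split : ∀ a b → a ≡ (a - b) + b
split a b = sym (trans (+-assoc a (- b) b)
  (trans (cong (a +_) (+-inverseˡ b)) (+-identityʳ a)))

factor : ∀ a b c → a * b - a * c ≡ a * (b - c)
factor a b c = trans (cong (a * b +_) (neg-distribʳ-* a c))
  (sym (*-distribˡ-+ a b (- c)))

scale : ∀ B .{{_ : Positive B}} ε → 0ℚ < ε →
        ∃ λ δ → 0ℚ < δ × B * δ ≡ ε
scale B ε ε>0 = 1/B * ε , δ>0 , eq
  where
  instance
    nz = pos⇒nonZero B
  1/B = 1/ B
  δ>0 : 0ℚ < 1/B * ε
  δ>0 = positive⁻¹ (1/B * ε)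
    {{pos*pos⇒pos 1/B {{1/pos⇒pos B}} ε {{positive ε>0}}}}
  eq : B * (1/B * ε) ≡ ε
  eq = trans (sym (*-assoc B 1/B ε))
         (trans (cong (_* ε) (*-inverseʳ B)) (*-identityˡ ε))

bounded : ∀ x → IsCauchy x → ∃ λ B → Positive B ×
          ∃ λ N → ∀ n → N ℕ.≤ n → ∣ x n ∣ ≤ B
bounded x cx with cx 1ℚ (positive⁻¹ 1ℚ)
... | N , close = 1ℚ + ∣ x N ∣ ,
      pos+nonNeg⇒pos 1ℚ ∣ x N ∣ {{∣-∣-nonNeg (x N)}} , N , λ n N≤n → begin
  ∣ x n ∣                 ≡⟨ cong ∣_∣ (split (x n) (x N)) ⟩
  ∣ (x n - x N) + x N ∣   ≤⟨ ∣p+q∣≤∣p∣+∣q∣ (x n - x N) (x N) ⟩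
  ∣ x n - x N ∣ + ∣ x N ∣ ≤⟨ +-monoˡ-≤ ∣ x N ∣ (close n N N≤n ℕP.≤-refl) ⟩
  1ℚ + ∣ x N ∣            ∎
  where
  open ≤-Reasoning

*-mono-∣∣ : ∀ p q {B δ} → ∣ p ∣ ≤ B → ∣ q ∣ ≤ δ → .{{NonNegative B}} →
            ∣ p * q ∣ ≤ B * δ
*-mono-∣∣ p q {B} {δ} p≤B q≤δ = begin
  ∣ p * q ∣     ≡⟨ ∣p*q∣≡∣p∣*∣q∣ p q ⟩
  ∣ p ∣ * ∣ q ∣ ≤⟨ *-monoʳ-≤-nonNeg ∣ q ∣ {{∣-∣-nonNeg q}} p≤B ⟩
  B * ∣ q ∣     ≤⟨ *-monoˡ-≤-nonNeg B q≤δ ⟩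
  B * δ         ∎
  where open ≤-Reasoning

abstract
  +-cauchy : ∀ x y → IsCauchy x → IsCauchy y → IsCauchy (λ n → x n + y n)
  +-cauchy x y cx cy ε ε>0 with scale (1ℚ + 1ℚ) ε ε>0
  ... | δ , δ>0 , 2δ≡ε with cx δ δ>0 | cy δ δ>0
  ... | M , p | N , q = M ℕ.+ N , λ m n hm hn → begin
    ∣ (x m + y m) - (x n + y n) ∣
      ≡⟨ cong ∣_∣ (swap (x m) (y m) (x n) (y n)) ⟩
    ∣ (x m - x n) + (y m - y n) ∣
      ≤⟨ ∣p+q∣≤∣p∣+∣q∣ (x m - x n) (y m - y n) ⟩
    ∣ x m - x n ∣ + ∣ y m - y n ∣
      ≤⟨ +-mono-≤ (p m n (ℕP.m+n≤o⇒m≤o M hm) (ℕP.m+n≤o⇒m≤o M hn))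
                  (q m n (ℕP.m+n≤o⇒n≤o M hm) (ℕP.m+n≤o⇒n≤o M hn)) ⟩
    δ + δ
      ≡⟨ double δ ⟩
    (1ℚ + 1ℚ) * δ
      ≡⟨ 2δ≡ε ⟩
    ε ∎
    where
    open ≤-Reasoning
    swap : ∀ a b c d → (a + b) - (c + d) ≡ (a - c) + (b - d)
    swap a b c d = trans (cong ((a + b) +_) (neg-distrib-+ c d))
      (interchange a b (- c) (- d))
    double : ∀ a → a + a ≡ (1ℚ + 1ℚ) * a
    double a = sym (trans (*-distribʳ-+ a 1ℚ 1ℚ)
      (cong₂ _+_ (*-identityˡ a) (*-identityˡ a)))

  *-cauchy : ∀ x y → IsCauchy x → IsCauchy y → IsCauchy (λ n → x n * y n)
  *-cauchy x y cx cy ε ε>0 with bounded x cx | bounded y cy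
  ... | B , B>0 , K , bx | D , D>0 , L , dy
    with scale (B + D) {{pos+pos⇒pos B {{B>0}} D {{D>0}}}} ε ε>0
  ... | δ , δ>0 , eq with cx δ δ>0 | cy δ δ>0
  ... | M , p | N , q = (K ℕ.+ L) ℕ.+ (M ℕ.+ N) , λ m n hm hn → begin
    ∣ x m * y m - x n * y n ∣
      ≡⟨ cong ∣_∣ (swap (x m) (y m) (x n) (y n)) ⟩
    ∣ x m * (y m - y n) + y n * (x m - x n) ∣
      ≤⟨ ∣p+q∣≤∣p∣+∣q∣ (x m * (y m - y n)) (y n * (x m - x n)) ⟩
    ∣ x m * (y m - y n) ∣ + ∣ y n * (x m - x n) ∣
      ≤⟨ +-mono-≤
           (*-mono-∣∣ (x m) (y m - y n) (bx m (≥K hm)) (q m n (≥N hm) (≥N hn))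
              {{pos⇒nonNeg B {{B>0}}}})
           (*-mono-∣∣ (y n) (x m - x n) (dy n (≥L hn)) (p m n (≥M hm) (≥M hn))
              {{pos⇒nonNeg D {{D>0}}}}) ⟩
    B * δ + D * δ
      ≡⟨ sym (*-distribʳ-+ δ B D) ⟩
    (B + D) * δ
      ≡⟨ eq ⟩
    ε ∎
    where
    open ≤-Reasoning
    swap : ∀ a b c d → a * b - c * d ≡ a * (b - d) + d * (a - c)
    swap a b c d = begin-equality
      a * b - c * d
        ≡⟨ cong (_- c * d) (split (a * b) (a * d)) ⟩
      ((a * b - a * d) + a * d) - c * d
        ≡⟨ +-assoc (a * b - a * d) (a * d) (- (c * d)) ⟩
      (a * b - a * d) + (a * d - c * d)
        ≡⟨ cong₂ _+_ (factor a b d)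
             (trans (cong₂ _-_ (*-comm a d) (*-comm c d)) (factor d a c)) ⟩
      a * (b - d) + d * (a - c) ∎
    ≥K : ∀ {n} → (K ℕ.+ L) ℕ.+ (M ℕ.+ N) ℕ.≤ n → K ℕ.≤ n
    ≥K h = ℕP.m+n≤o⇒m≤o K (ℕP.m+n≤o⇒m≤o (K ℕ.+ L) h)
    ≥L : ∀ {n} → (K ℕ.+ L) ℕ.+ (M ℕ.+ N) ℕ.≤ n → L ℕ.≤ n
    ≥L h = ℕP.m+n≤o⇒n≤o K (ℕP.m+n≤o⇒m≤o (K ℕ.+ L) h)
    ≥M : ∀ {n} → (K ℕ.+ L) ℕ.+ (M ℕ.+ N) ℕ.≤ n → M ℕ.≤ n
    ≥M h = ℕP.m+n≤o⇒m≤o M (ℕP.m+n≤o⇒n≤o (K ℕ.+ L) h)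
    ≥N : ∀ {n} → (K ℕ.+ L) ℕ.+ (M ℕ.+ N) ℕ.≤ n → N ℕ.≤ n
    ≥N h = ℕP.m+n≤o⇒n≤o M (ℕP.m+n≤o⇒n≤o (K ℕ.+ L) h)

infixl 6 _+ℝ_
infixl 7 _*ℝ_

_+ℝ_ : ℝ → ℝ → ℝ
x +ℝ y = mkℝ (λ n → seq x n + seq y n) (+-cauchy (seq x) (seq y) (cauchy x) (cauchy y))

_*ℝ_ : ℝ → ℝ → ℝ
x *ℝ y = mkℝ (λ n → seq x n * seq y n) (*-cauchy (seq x) (seq y) (cauchy x) (cauchy y))

fromℚ : ℚ → ℝ
fromℚ q = mkℝ (λ _ → q) λ ε ε>0 →
  0 , λ _ _ _ _ → subst (_≤ ε) (cong ∣_∣ (sym (+-inverseʳ q))) (<⇒≤ ε>0)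

fromℕ : ℕ → ℝ
fromℕ n = fromℚ (ℤ.+ n / 1)

0ℝ 1ℝ : ℝ
0ℝ = fromℚ 0ℚ
1ℝ = fromℚ 1ℚ

∑ : ∀ {n} → (Fin n → ℝ) → ℝ
∑ = Vector.foldr _+ℝ_ 0ℝ

Point : Set
Point = ℝ × ℝ

infix 4 _≈_

_≈_ : Point → Point → Set
(x , y) ≈ (x′ , y′) = x ≃ℝ x′ × y ≃ℝ y′

-- (a , b , c , _) is the line a x + b y = c.
Line : Set
Line = ∃ λ a → ∃ λ b → ℝ × ¬ (a ≃ℝ 0ℝ × b ≃ℝ 0ℝ)

_OnLine_ : Point → Line → Set
(x , y) OnLine (a , b , c , _) = a *ℝ x +ℝ b *ℝ y ≃ℝ c

Collinear : Point → Point → Point → Set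
Collinear p q r = ∃ λ ℓ → p OnLine ℓ × q OnLine ℓ × r OnLine ℓ

GeneralPosition : ∀ {n} → (Fin n → Point) → Set
GeneralPosition v = ∀ i j k → i ≢ j → j ≢ k → i ≢ k →
  ¬ Collinear (v i) (v j) (v k)

-- p is a convex combination of the points v i with i in s.
InHull : ∀ {n} → (Fin n → Point) → Subset n → Point → Set
InHull v s (x , y) = ∃ λ w →
    (∀ i → 0ℝ ≤ℝ w i)
  × (∀ i → i Subset.∉ s → w i ≃ℝ 0ℝ)
  × ∑ w ≃ℝ 1ℝ
  × ∑ (λ i → w i *ℝ proj₁ (v i)) ≃ℝ x
  × ∑ (λ i → w i *ℝ proj₂ (v i)) ≃ℝ y

-- An edge is recorded by its vertex set; the closed triangle it stands for is
-- the hull of that set.  By general position distinct 3-element sets give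
-- distinct triangles, so the number of edges is the length of the list.
record Hypergraph (n : ℕ) : Set where
  field
    vertex   : Fin n → Point
    distinct : ∀ i j → i ≢ j → ¬ (vertex i ≈ vertex j)
    general  : GeneralPosition vertex
    edges    : List (Subset n)
    triples  : All (λ e → Subset.∣ e ∣ ≡ 3) edges
    unique   : Unique edges

  edgeCount : ℕ
  edgeCount = length edges

open Hypergraph public

StronglyCrossing : ∀ {n} → ℕ → Hypergraph n → Set
StronglyCrossing {n} k H = ∃ λ (e : Fin k → Subset n) →
    (∀ s → e s ∈ edges H)
  × (∀ s t → s ≢ t → Empty (e s ∩ e t))
  × ∃ λ p → ∀ s → InHull (vertex H) (e s) p

-- IsEx k n m says that ex₂(SC³ₖ, n) = m.  The extremal number is given by its
-- graph because the definition does not compute the maximum; constructively the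
-- existence of such an m is to be read as ¬ ¬ ∃.
IsEx : ℕ → ℕ → ℕ → Set
IsEx k n m =
    (∃ λ (H : Hypergraph n) → ¬ StronglyCrossing k H × edgeCount H ≡ m)
  × (∀ (H : Hypergraph n) → ¬ StronglyCrossing k H → edgeCount H ℕ.≤ m)

{-# OPTIONS --safe #-}

-- Lower bound: any two triples through a fixed vertex meet, and there are about
-- n²/2 of them.
--
-- Upper bound: after a shear all abscissae differ, so every edge has a left, a
-- middle and a right vertex.  At the cost of O(n²) edges, assume that the outer
-- pair l r of every edge lies in at least seven edges; then any two vertices l r
-- may be completed to an edge while avoiding six given vertices.  Fix a middle
-- vertex m and consider the sides l r passing above it (or below it, by
-- reflection), sorted by the height at which they cross the vertical ray from m.
-- If there are more than O(n) of them, some five consecutive ones have end points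
-- that all occur both before and after these five, and three of the five have,
-- up to reflection, distinct right ends.  Let X be the one of these right ends that
-- is closest to the ray as seen from m, and Y, Z the others.  A side ending in Z
-- lies between an early and a late side ending in X, and must cross one of them to
-- the right of the ray.  Together with a late side ending in Y this yields three
-- sides, two of which cross in a point that lies between m and the third: the
-- triangle of m on the third side, and suitable triangles on the first two, are
-- disjoint and have this point in common.
module Submission where

-- The order on Cauchy reals is undecidable, so comparisons of points are available only under
-- `¬ ¬`. Nothing is lost: every geometric argument ends in `⊥`, and the bound finally reached is an
-- inequality of naturals, which is stable. The obstacle that shapes the combinatorics is
-- disjointness. Three crossing sides yield three disjoint edges only if their left ends differ as
-- well as their right ends. Right ends are made distinct by choosing the sides in a block of five.
-- The two sides that cross have distinct left ends by general position, since two sides with a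
-- common left end meet nowhere else. The left end of the third side is then chosen last, avoiding
-- the two already in use. This is why an end point must occur three times after the block, whereas
-- one occurrence before it is enough. The middle vertices cause no trouble, because heavy outer
-- pairs leave a choice for two of the edges, while the third edge is the one with `m` itself.

-- Ordered-field arithmetic of the Cauchy reals.

module RealArithmetic where

  open import Defs hiding (_≈_)
  open import Data.Nat.Base as ℕ using (ℕ)
  import Data.Nat.Properties as ℕP
  open import Data.Rational.Base
  open import Data.Rational.Properties
  open import Data.Product using (∃; _×_; _,_; proj₁; proj₂)
  open import Data.Sum as Sum using (_⊎_; inj₁; inj₂)
  open import Data.Empty using (⊥; ⊥-elim)
  open import Relation.Nullary using (¬_)
  open import Relation.Nullary.Decidable using (dec⇒maybe)
  open import Relation.Binary.PropositionalEquality
  open import Tactic.RingSolver using (solve-∀)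
  open import Tactic.RingSolver.Core.AlmostCommutativeRing using (AlmostCommutativeRing; fromCommutativeRing)

  ℚ-ring : AlmostCommutativeRing _ _
  ℚ-ring = fromCommutativeRing +-*-commutativeRing (λ x → dec⇒maybe (0ℚ ≟ x))

  infix 4 _≅_
  infix 8 -ℝ_
  infixl 6 _-ℝ_

  -- Records around the relations of ℝ, so that their arguments can be inferred.
  record _≅_ (x y : ℝ) : Set where
    constructor ⟨_⟩
    field ≃-proof : x ≃ℝ y
  open _≅_ public

  record NonNeg (x : ℝ) : Set where
    constructor ⟨_⟩
    field ≤-proof : 0ℝ ≤ℝ x
  open NonNeg public

  record Pos (x : ℝ) : Set where
    constructor ⟨_⟩
    field <-proof : 0ℝ <ℝ x
  open Pos public

  -ℝ_ : ℝ → ℝ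
  -ℝ x = mkℝ (λ n → - seq x n) neg-cauchy
    where
    abstract
      neg-cauchy : IsCauchy (λ n → - seq x n)
      neg-cauchy ε ε>0 with cauchy x ε ε>0
      ... | N , c = N , λ m n hm hn → subst (_≤ ε)
        (trans (sym (∣-p∣≡∣p∣ (seq x m - seq x n)))
               (cong ∣_∣ (neg-distrib-+ (seq x m) (- seq x n)))) (c m n hm hn)

  _-ℝ_ : ℝ → ℝ → ℝ
  x -ℝ y = x +ℝ (-ℝ y)

  eventually₂ : ∀ (A B C : ℕ → Set) → (∀ n → A n → B n → C n) →
        (∃ λ N → ∀ n → N ℕ.≤ n → A n) → (∃ λ N → ∀ n → N ℕ.≤ n → B n) →
        ∃ λ N → ∀ n → N ℕ.≤ n → C n
  eventually₂ A B C f (M , a) (N , b) = M ℕ.+ N , λ n h →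
    f n (a n (ℕP.m+n≤o⇒m≤o M h)) (b n (ℕP.m+n≤o⇒n≤o M h))

  half : ∀ ε → 0ℚ < ε → ∃ λ δ → 0ℚ < δ × δ + δ ≡ ε
  half ε ε>0 with scale (1ℚ + 1ℚ) ε ε>0
  ... | δ , δ>0 , eq = δ , δ>0 , trans (dbl δ) eq
    where
    dbl : ∀ a → a + a ≡ (1ℚ + 1ℚ) * a
    dbl = solve-∀ ℚ-ring

  -- Splitting ε by an eliminator rather than by a with-abstraction keeps the
  -- rational arithmetic in the goal from being normalised.
  halve : (P : ℚ → Set) → (∀ δ → 0ℚ < δ → P (δ + δ)) → ∀ ε → 0ℚ < ε → P ε
  halve P f ε ε>0 = let (δ , δ>0 , eq) = half ε ε>0 in subst P eq (f δ δ>0)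

  scaled : (P : ℚ → Set) → ∀ B → Positive B → (∀ δ → 0ℚ < δ → P (B * δ)) → ∀ ε → 0ℚ < ε → P ε
  scaled P B B>0 f ε ε>0 = let (δ , δ>0 , eq) = scale B {{B>0}} ε ε>0 in subst P eq (f δ δ>0)

  ∣∣≤⇒≤ : ∀ {p ε} → ∣ p ∣ ≤ ε → p ≤ ε
  ∣∣≤⇒≤ {p} h with ≤-total 0ℚ p
  ... | inj₁ 0≤p = subst (_≤ _) (0≤p⇒∣p∣≡p 0≤p) h
  ... | inj₂ p≤0 = ≤-trans p≤0 (≤-trans (0≤∣p∣ p) h)

  ∣-∣-sym : ∀ p q → ∣ p - q ∣ ≡ ∣ q - p ∣
  ∣-∣-sym p q = trans (sym (∣-p∣≡∣p∣ (p - q))) (cong ∣_∣ (eq p q))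
    where
    eq : ∀ p q → - (p - q) ≡ q - p
    eq = solve-∀ ℚ-ring

  ∣-∣≤ : ∀ {p q ε} → p ≤ q + ε → q ≤ p + ε → ∣ p - q ∣ ≤ ε
  ∣-∣≤ {p} {q} {ε} h k with ∣p∣≡p∨∣p∣≡-p (p - q)
  ... | inj₁ e = subst (_≤ ε) (sym e) (subst (p - q ≤_) (eq q ε) (+-monoˡ-≤ (- q) h))
    where
    eq : ∀ q ε → (q + ε) - q ≡ ε
    eq = solve-∀ ℚ-ring
  ... | inj₂ e = subst (_≤ ε) (trans (eq₁ p q) (sym e)) (subst (q - p ≤_) (eq p ε) (+-monoˡ-≤ (- p) k))
    where
    eq : ∀ q ε → (q + ε) - q ≡ ε
    eq = solve-∀ ℚ-ring
    eq₁ : ∀ p q → q - p ≡ - (p - q)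
    eq₁ = solve-∀ ℚ-ring

  ∣-∣≤⇒≤+ : ∀ {p q ε} → ∣ p - q ∣ ≤ ε → p ≤ q + ε
  ∣-∣≤⇒≤+ {p} {q} {ε} h = subst (_≤ q + ε) (eq p q) (+-monoʳ-≤ q (∣∣≤⇒≤ h))
    where
    eq : ∀ p q → q + (p - q) ≡ p
    eq = solve-∀ ℚ-ring

  termwise : ∀ {x y} → (∀ k → seq x k ≡ seq y k) → x ≅ y
  termwise {x} {y} h = ⟨ (λ ε ε>0 → 0 , λ n _ →
    subst (_≤ ε) (sym (trans (cong (λ z → ∣ z - seq y n ∣) (h n)) (cong ∣_∣ (+-inverseʳ (seq y n))))) (<⇒≤ ε>0)) ⟩

  ≅-refl : ∀ {x} → x ≅ x
  ≅-refl = termwise (λ _ → refl)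

  ≅-sym : ∀ {x y} → x ≅ y → y ≅ x
  ≅-sym {x} {y} ⟨ h ⟩ = ⟨ (λ ε ε>0 → proj₁ (h ε ε>0) , λ n hn →
    subst (_≤ ε) (∣-∣-sym (seq x n) (seq y n)) (proj₂ (h ε ε>0) n hn)) ⟩

  ∣-∣-triangle : ∀ a b c δ → ∣ a - b ∣ ≤ δ → ∣ b - c ∣ ≤ δ → ∣ a - c ∣ ≤ δ + δ
  ∣-∣-triangle a b c δ p q = begin
    ∣ a - c ∣             ≡⟨ cong ∣_∣ (eq a b c) ⟩
    ∣ (a - b) + (b - c) ∣ ≤⟨ ∣p+q∣≤∣p∣+∣q∣ (a - b) (b - c) ⟩
    ∣ a - b ∣ + ∣ b - c ∣ ≤⟨ +-mono-≤ p q ⟩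
    δ + δ                 ∎
    where
    open ≤-Reasoning
    eq : ∀ a b c → a - c ≡ (a - b) + (b - c)
    eq = solve-∀ ℚ-ring

  ≅-trans : ∀ {x y z} → x ≅ y → y ≅ z → x ≅ z
  ≅-trans {x} {y} {z} ⟨ h ⟩ ⟨ k ⟩ = ⟨ go ⟩
    where
    go : x ≃ℝ z
    go = halve (λ ε → ∃ λ N → ∀ n → N ℕ.≤ n → ∣ seq x n - seq z n ∣ ≤ ε) λ δ δ>0 →
      eventually₂ (λ n → ∣ seq x n - seq y n ∣ ≤ δ) (λ n → ∣ seq y n - seq z n ∣ ≤ δ)
        (λ n → ∣ seq x n - seq z n ∣ ≤ δ + δ)
        (λ n → ∣-∣-triangle (seq x n) (seq y n) (seq z n) δ) (h δ δ>0) (k δ δ>0)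

  ∣-∣-+ : ∀ a b c d δ → ∣ a - b ∣ ≤ δ → ∣ c - d ∣ ≤ δ → ∣ (a + c) - (b + d) ∣ ≤ δ + δ
  ∣-∣-+ a b c d δ p q = begin
    ∣ (a + c) - (b + d) ∣ ≡⟨ cong ∣_∣ (eq a b c d) ⟩
    ∣ (a - b) + (c - d) ∣ ≤⟨ ∣p+q∣≤∣p∣+∣q∣ (a - b) (c - d) ⟩
    ∣ a - b ∣ + ∣ c - d ∣ ≤⟨ +-mono-≤ p q ⟩
    δ + δ                 ∎
    where
    open ≤-Reasoning
    eq : ∀ a b c d → (a + c) - (b + d) ≡ (a - b) + (c - d)
    eq = solve-∀ ℚ-ring

  +-cong : ∀ {x x′ y y′} → x ≅ x′ → y ≅ y′ → x +ℝ y ≅ x′ +ℝ y′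
  +-cong {x} {x′} {y} {y′} ⟨ h ⟩ ⟨ k ⟩ = ⟨ go ⟩
    where
    go : x +ℝ y ≃ℝ x′ +ℝ y′
    go = halve (λ ε → ∃ λ N → ∀ n → N ℕ.≤ n → ∣ (seq x n + seq y n) - (seq x′ n + seq y′ n) ∣ ≤ ε) λ δ δ>0 →
      eventually₂ (λ n → ∣ seq x n - seq x′ n ∣ ≤ δ) (λ n → ∣ seq y n - seq y′ n ∣ ≤ δ)
        (λ n → ∣ (seq x n + seq y n) - (seq x′ n + seq y′ n) ∣ ≤ δ + δ)
        (λ n → ∣-∣-+ (seq x n) (seq x′ n) (seq y n) (seq y′ n) δ) (h δ δ>0) (k δ δ>0)

  ∣-∣-neg : ∀ a b δ → ∣ a - b ∣ ≤ δ → ∣ (- a) - (- b) ∣ ≤ δ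
  ∣-∣-neg a b δ p = begin
    ∣ (- a) - (- b) ∣ ≡⟨ cong ∣_∣ (eq a b) ⟩
    ∣ b - a ∣         ≡⟨ ∣-∣-sym b a ⟩
    ∣ a - b ∣         ≤⟨ p ⟩
    δ                 ∎
    where
    open ≤-Reasoning
    eq : ∀ a b → (- a) - (- b) ≡ b - a
    eq = solve-∀ ℚ-ring

  neg-cong : ∀ {x y} → x ≅ y → -ℝ x ≅ -ℝ y
  neg-cong {x} {y} ⟨ h ⟩ = ⟨ (λ ε ε>0 → proj₁ (h ε ε>0) , λ n hn →
    ∣-∣-neg (seq x n) (seq y n) ε (proj₂ (h ε ε>0) n hn)) ⟩

  ∣*∣≤ : ∀ a b B δ → 0ℚ ≤ B → ∣ a ∣ ≤ B → ∣ b - 0ℚ ∣ ≤ δ → ∣ a * b - 0ℚ ∣ ≤ B * δ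
  ∣*∣≤ a b B δ B≥0 p q = begin
    ∣ a * b - 0ℚ ∣   ≡⟨ cong ∣_∣ (eq a b) ⟩
    ∣ a * (b - 0ℚ) ∣ ≤⟨ *-mono-∣∣ a (b - 0ℚ) p q {{nonNegative B≥0}} ⟩
    B * δ            ∎
    where
    open ≤-Reasoning
    eq : ∀ a b → a * b - 0ℚ ≡ a * (b - 0ℚ)
    eq = solve-∀ ℚ-ring

  *-null : ∀ x {y} → y ≅ 0ℝ → x *ℝ y ≅ 0ℝ
  *-null x {y} ⟨ h ⟩ = ⟨ go ⟩
    where
    go : x *ℝ y ≃ℝ 0ℝ
    go = let (B , B>0 , bd) = bounded (seq x) (cauchy x) in
      scaled (λ ε → ∃ λ N → ∀ n → N ℕ.≤ n → ∣ seq x n * seq y n - 0ℚ ∣ ≤ ε) B B>0 λ δ δ>0 →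
      eventually₂ (λ n → ∣ seq x n ∣ ≤ B) (λ n → ∣ seq y n - 0ℚ ∣ ≤ δ)
        (λ n → ∣ seq x n * seq y n - 0ℚ ∣ ≤ B * δ)
        (λ n → ∣*∣≤ (seq x n) (seq y n) B δ (<⇒≤ (positive⁻¹ B {{B>0}}))) bd (h δ δ>0)

  0≤-resp : ∀ a b δ → 0ℚ ≤ a + δ → ∣ a - b ∣ ≤ δ → 0ℚ ≤ b + (δ + δ)
  0≤-resp a b δ p q = begin
    0ℚ          ≤⟨ p ⟩
    a + δ       ≤⟨ +-monoˡ-≤ δ (∣-∣≤⇒≤+ {a} {b} {δ} q) ⟩
    (b + δ) + δ ≡⟨ +-assoc b δ δ ⟩
    b + (δ + δ) ∎
    where open ≤-Reasoning

  NonNeg-resp : ∀ {x y} → x ≅ y → NonNeg x → NonNeg y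
  NonNeg-resp {x} {y} ⟨ h ⟩ ⟨ k ⟩ = ⟨ go ⟩
    where
    go : 0ℝ ≤ℝ y
    go = halve (λ ε → ∃ λ N → ∀ n → N ℕ.≤ n → 0ℚ ≤ seq y n + ε) λ δ δ>0 →
      eventually₂ (λ n → 0ℚ ≤ seq x n + δ) (λ n → ∣ seq x n - seq y n ∣ ≤ δ)
        (λ n → 0ℚ ≤ seq y n + (δ + δ))
        (λ n → 0≤-resp (seq x n) (seq y n) δ) (k δ δ>0) (h δ δ>0)

  0+≤-resp : ∀ a b δ → 0ℚ + (δ + δ) ≤ a → ∣ a - b ∣ ≤ δ → 0ℚ + δ ≤ b
  0+≤-resp a b δ p q = begin
    0ℚ + δ             ≡⟨ eq₁ δ ⟩
    (0ℚ + (δ + δ)) - δ ≤⟨ +-monoˡ-≤ (- δ) p ⟩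
    a - δ              ≤⟨ +-monoˡ-≤ (- δ) (∣-∣≤⇒≤+ {a} {b} {δ} q) ⟩
    (b + δ) - δ        ≡⟨ eq b δ ⟩
    b                  ∎
    where
    open ≤-Reasoning
    eq : ∀ y δ → (y + δ) - δ ≡ y
    eq = solve-∀ ℚ-ring
    eq₁ : ∀ δ → 0ℚ + δ ≡ (0ℚ + (δ + δ)) - δ
    eq₁ = solve-∀ ℚ-ring

  Pos-resp : ∀ {x y} → x ≅ y → Pos x → Pos y
  Pos-resp {x} {y} ⟨ h ⟩ ⟨ ε , ε>0 , k ⟩ = ⟨ go ⟩
    where
    go : 0ℝ <ℝ y
    go = let (δ , δ>0 , eq) = half ε ε>0 in δ , δ>0 ,
      eventually₂ (λ n → 0ℚ + ε ≤ seq x n) (λ n → ∣ seq x n - seq y n ∣ ≤ δ)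
        (λ n → 0ℚ + δ ≤ seq y n)
        (λ n p → 0+≤-resp (seq x n) (seq y n) δ (subst (λ z → 0ℚ + z ≤ seq x n) (sym eq) p)) k (h δ δ>0)

  0≤+-+ : ∀ a b δ → 0ℚ ≤ a + δ → 0ℚ ≤ b + δ → 0ℚ ≤ (a + b) + (δ + δ)
  0≤+-+ a b δ p q = begin
    0ℚ                ≤⟨ +-mono-≤ p q ⟩
    (a + δ) + (b + δ) ≡⟨ eq a b δ ⟩
    (a + b) + (δ + δ) ∎
    where
    open ≤-Reasoning
    eq : ∀ a b δ → (a + δ) + (b + δ) ≡ (a + b) + (δ + δ)
    eq = solve-∀ ℚ-ring

  NonNeg-+ : ∀ {x y} → NonNeg x → NonNeg y → NonNeg (x +ℝ y)
  NonNeg-+ {x} {y} ⟨ h ⟩ ⟨ k ⟩ = ⟨ go ⟩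
    where
    go : 0ℝ ≤ℝ x +ℝ y
    go = halve (λ ε → ∃ λ N → ∀ n → N ℕ.≤ n → 0ℚ ≤ (seq x n + seq y n) + ε) λ δ δ>0 →
      eventually₂ (λ n → 0ℚ ≤ seq x n + δ) (λ n → 0ℚ ≤ seq y n + δ)
        (λ n → 0ℚ ≤ (seq x n + seq y n) + (δ + δ))
        (λ n → 0≤+-+ (seq x n) (seq y n) δ) (h δ δ>0) (k δ δ>0)

  Pos⇒NonNeg : ∀ {x} → Pos x → NonNeg x
  Pos⇒NonNeg {x} ⟨ ε , ε>0 , N , k ⟩ = ⟨ (λ η η>0 → N , λ n hn →
    ≤-trans (≤-trans (<⇒≤ ε>0) (subst (_≤ seq x n) (+-identityˡ ε) (k n hn)))
      (subst (_≤ seq x n + η) (+-identityʳ (seq x n)) (+-monoʳ-≤ (seq x n) (<⇒≤ η>0)))) ⟩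

  0+≤-+ : ∀ a b δ → 0ℚ + (δ + δ) ≤ a → 0ℚ ≤ b + δ → 0ℚ + δ ≤ a + b
  0+≤-+ a b δ p q = begin
    0ℚ + δ                    ≡⟨ eq₁ δ ⟩
    ((0ℚ + (δ + δ)) + 0ℚ) - δ ≤⟨ +-monoˡ-≤ (- δ) (+-mono-≤ p q) ⟩
    (a + (b + δ)) - δ         ≡⟨ eq a b δ ⟩
    a + b                     ∎
    where
    open ≤-Reasoning
    eq : ∀ x y δ → x + (y + δ) - δ ≡ x + y
    eq = solve-∀ ℚ-ring
    eq₁ : ∀ δ → 0ℚ + δ ≡ ((0ℚ + (δ + δ)) + 0ℚ) - δ
    eq₁ = solve-∀ ℚ-ring

  Pos-+ : ∀ {x y} → Pos x → NonNeg y → Pos (x +ℝ y)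
  Pos-+ {x} {y} ⟨ ε , ε>0 , k ⟩ ⟨ h ⟩ = ⟨ go ⟩
    where
    go : 0ℝ <ℝ x +ℝ y
    go = let (δ , δ>0 , eq) = half ε ε>0 in δ , δ>0 ,
      eventually₂ (λ n → 0ℚ + ε ≤ seq x n) (λ n → 0ℚ ≤ seq y n + δ)
        (λ n → 0ℚ + δ ≤ seq x n + seq y n)
        (λ n p → 0+≤-+ (seq x n) (seq y n) δ (subst (λ z → 0ℚ + z ≤ seq x n) (sym eq) p)) k (h δ δ>0)

  0≤* : ∀ {p q} → 0ℚ ≤ p → 0ℚ ≤ q → 0ℚ ≤ p * q
  0≤* {p} {q} hp hq = subst (_≤ p * q) (*-zeroˡ q) (*-monoʳ-≤-nonNeg q {{nonNegative hq}} hp)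

  0≤- : ∀ p q → p ≤ q → 0ℚ ≤ q - p
  0≤- p q h = subst (_≤ q - p) (+-inverseʳ p) (+-monoˡ-≤ (- p) h)

  -- With `p` between `- δ` and 0, the product can fall below 0 by at most `D * δ`. The claim is a
  -- sum of three nonnegative products, `(- p) * (D - q)`, `(p + δ) * D` and `B * δ`.
  0≤*-approx-neg : ∀ p q B D δ → ∣ p ∣ ≤ B → ∣ q ∣ ≤ D → 0ℚ ≤ δ → 0ℚ ≤ p + δ → p ≤ 0ℚ →
                   0ℚ ≤ p * q + (B + D) * δ
  0≤*-approx-neg p q B D δ pB qD δ≥0 p≥ p≤0 = begin
    0ℚ                                          ≤⟨ +-mono-≤ (+-mono-≤
        (0≤* { - p} {D - q} (neg-antimono-≤ p≤0) (0≤- q D (∣∣≤⇒≤ qD)))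
        (0≤* {p + δ} {D} p≥ (≤-trans (0≤∣p∣ q) qD)))
        (0≤* {B} {δ} (≤-trans (0≤∣p∣ p) pB) δ≥0) ⟩
    ((- p) * (D - q) + (p + δ) * D) + B * δ     ≡⟨ eq p q B D δ ⟩
    p * q + (B + D) * δ                         ∎
    where
    open ≤-Reasoning
    eq : ∀ p q B D δ → ((- p) * (D - q) + (p + δ) * D) + B * δ ≡ p * q + (B + D) * δ
    eq = solve-∀ ℚ-ring

  0≤*-approx : ∀ p q B D δ → 0ℚ ≤ δ → ∣ p ∣ ≤ B × 0ℚ ≤ p + δ → ∣ q ∣ ≤ D × 0ℚ ≤ q + δ →
               0ℚ ≤ p * q + (B + D) * δ
  0≤*-approx p q B D δ δ≥0 (pB , p≥) (qD , q≥) with ≤-total 0ℚ p | ≤-total 0ℚ q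
  ... | inj₂ p≤0 | _ = 0≤*-approx-neg p q B D δ pB qD δ≥0 p≥ p≤0
  ... | inj₁ _ | inj₂ q≤0 = begin
    0ℚ                  ≤⟨ 0≤*-approx-neg q p D B δ qD pB δ≥0 q≥ q≤0 ⟩
    q * p + (D + B) * δ ≡⟨ eq p q B D δ ⟩
    p * q + (B + D) * δ ∎
    where
    open ≤-Reasoning
    eq : ∀ p q B D δ → q * p + (D + B) * δ ≡ p * q + (B + D) * δ
    eq = solve-∀ ℚ-ring
  ... | inj₁ 0≤p | inj₁ 0≤q = +-mono-≤ (0≤* {p} {q} 0≤p 0≤q)
          (0≤* {B + D} {δ} (+-mono-≤ (≤-trans (0≤∣p∣ p) pB) (≤-trans (0≤∣p∣ q) qD)) δ≥0)

  NonNeg-* : ∀ {x y} → NonNeg x → NonNeg y → NonNeg (x *ℝ y)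
  NonNeg-* {x} {y} ⟨ h ⟩ ⟨ k ⟩ = ⟨ go ⟩
    where
    go : 0ℝ ≤ℝ x *ℝ y
    go = let (B , B>0 , bx) = bounded (seq x) (cauchy x)
             (D , D>0 , by) = bounded (seq y) (cauchy y) in
      scaled (λ ε → ∃ λ N → ∀ n → N ℕ.≤ n → 0ℚ ≤ seq x n * seq y n + ε)
        (B + D) (pos+pos⇒pos B {{B>0}} D {{D>0}}) λ δ δ>0 →
      eventually₂ (λ n → ∣ seq x n ∣ ≤ B × 0ℚ ≤ seq x n + δ)
        (λ n → ∣ seq y n ∣ ≤ D × 0ℚ ≤ seq y n + δ) (λ n → 0ℚ ≤ seq x n * seq y n + (B + D) * δ)
        (λ n → 0≤*-approx (seq x n) (seq y n) B D δ (<⇒≤ δ>0))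
        (eventually₂ (λ n → ∣ seq x n ∣ ≤ B) (λ n → 0ℚ ≤ seq x n + δ) _ (λ _ → _,_) bx (h δ δ>0))
        (eventually₂ (λ n → ∣ seq y n ∣ ≤ D) (λ n → 0ℚ ≤ seq y n + δ) _ (λ _ → _,_) by (k δ δ>0))

  0+≤-* : ∀ ε η a b → 0ℚ < ε → 0ℚ < η → 0ℚ + ε ≤ a → 0ℚ + η ≤ b → 0ℚ + ε * η ≤ a * b
  0+≤-* ε η a b ε>0 η>0 p q = begin
    0ℚ + ε * η ≡⟨ +-identityˡ (ε * η) ⟩
    ε * η      ≤⟨ *-monoˡ-≤-nonNeg ε {{nonNegative (<⇒≤ ε>0)}} η≤b ⟩
    ε * b      ≤⟨ *-monoʳ-≤-nonNeg b {{nonNegative (≤-trans (<⇒≤ η>0) η≤b)}} ε≤a ⟩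
    a * b      ∎
    where
    open ≤-Reasoning
    ε≤a : ε ≤ a
    ε≤a = subst (_≤ a) (+-identityˡ ε) p
    η≤b : η ≤ b
    η≤b = subst (_≤ b) (+-identityˡ η) q

  Pos-* : ∀ {x y} → Pos x → Pos y → Pos (x *ℝ y)
  Pos-* {x} {y} ⟨ ε , ε>0 , h ⟩ ⟨ η , η>0 , k ⟩ = ⟨ ε * η , εη>0 ,
      eventually₂ (λ n → 0ℚ + ε ≤ seq x n) (λ n → 0ℚ + η ≤ seq y n) (λ n → 0ℚ + ε * η ≤ seq x n * seq y n)
        (λ n → 0+≤-* ε η (seq x n) (seq y n) ε>0 η>0) h k ⟩
    where
    εη>0 : 0ℚ < ε * η
    εη>0 = positive⁻¹ (ε * η) {{pos*pos⇒pos ε {{positive ε>0}} η {{positive η>0}}}}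

  0≤neg : ∀ a b η → a ≤ η + η → ∣ b - a ∣ ≤ η → 0ℚ ≤ - b + ((η + η) + (η + η))
  0≤neg a b η p q = begin
    0ℚ                              ≤⟨ +-mono-≤ (0≤- a (η + η) p) 0≤η ⟩
    ((η + η) - a) + η               ≡⟨ eq a η ⟩
    - (a + η) + ((η + η) + (η + η)) ≤⟨ +-monoˡ-≤ ((η + η) + (η + η)) (neg-antimono-≤ (∣-∣≤⇒≤+ {b} {a} {η} q)) ⟩
    - b + ((η + η) + (η + η))       ∎
    where
    open ≤-Reasoning
    0≤η : 0ℚ ≤ η
    0≤η = ≤-trans (0≤∣p∣ (b - a)) q
    eq : ∀ a η → ((η + η) - a) + η ≡ (- (a + η)) + ((η + η) + (η + η))
    eq = solve-∀ ℚ-ring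

  0+≤ : ∀ a b η → η + η ≤ a → ∣ a - b ∣ ≤ η → 0ℚ + η ≤ b
  0+≤ a b η p q = 0+≤-resp a b η (subst (_≤ a) (sym (+-identityˡ (η + η))) p) q

  -- One rational comparison settles each tolerance: at an index where the sequence has settled to
  -- within `η`, a term of at least `η + η` would make `x` positive; otherwise all later terms are
  -- at most three times `η`.
  ¬Pos⇒NonNeg : ∀ {x} → ¬ Pos x → NonNeg (-ℝ x)
  ¬Pos⇒NonNeg {x} ¬pos = ⟨ go ⟩
    where
    Small : ℚ → Set
    Small η = ∃ λ N → ∀ n → N ℕ.≤ n → 0ℚ ≤ - seq x n + ((η + η) + (η + η))
    small : ∀ η → 0ℚ < η → Small η
    small η η>0 = let (N , c) = cauchy x η η>0 in Sum.[_,_]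
      {C = λ _ → Small η}
      (λ h → (N , λ n hn → 0≤neg (seq x N) (seq x n) η h (c n N hn ℕP.≤-refl)))
      (λ h → ⊥-elim (¬pos ⟨ (η , η>0 , N , (λ n hn → 0+≤ (seq x N) (seq x n) η h (c N n ℕP.≤-refl hn))) ⟩))
      (≤-total (seq x N) (η + η))
    go : 0ℝ ≤ℝ -ℝ x
    go = halve (λ ε → ∃ λ N → ∀ n → N ℕ.≤ n → 0ℚ ≤ - seq x n + ε) λ δ δ>0 →
      halve (λ ε → ∃ λ N → ∀ n → N ℕ.≤ n → 0ℚ ≤ - seq x n + (ε + ε)) small δ δ>0

  0+≤∧0≤neg⇒⊥ : ∀ a δ → 0ℚ < δ → 0ℚ + (δ + δ) ≤ a → 0ℚ ≤ - a + δ → ⊥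
  0+≤∧0≤neg⇒⊥ a δ δ>0 p q = <-irrefl refl (begin-strict
    0ℚ                      <⟨ δ>0 ⟩
    δ                       ≡⟨ eq₁ δ ⟩
    ((0ℚ + (δ + δ)) + 0ℚ) - δ ≤⟨ +-monoˡ-≤ (- δ) (+-mono-≤ p q) ⟩
    (a + (- a + δ)) - δ     ≡⟨ eq a δ ⟩
    0ℚ                      ∎)
    where
    open ≤-Reasoning
    eq : ∀ a δ → (a + (- a + δ)) - δ ≡ 0ℚ
    eq = solve-∀ ℚ-ring
    eq₁ : ∀ δ → δ ≡ ((0ℚ + (δ + δ)) + 0ℚ) - δ
    eq₁ = solve-∀ ℚ-ring

  Pos⇒¬NonNeg- : ∀ {x} → Pos x → ¬ NonNeg (-ℝ x)
  Pos⇒¬NonNeg- {x} ⟨ ε , ε>0 , h ⟩ ⟨ k ⟩ =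
    let (δ , δ>0 , eq) = half ε ε>0
        (N , c) = eventually₂ (λ n → 0ℚ + ε ≤ seq x n) (λ n → 0ℚ ≤ - seq x n + δ) (λ _ → ⊥)
          (λ n p → 0+≤∧0≤neg⇒⊥ (seq x n) δ δ>0 (subst (λ z → 0ℚ + z ≤ seq x n) (sym eq) p)) h (k δ δ>0)
    in c N ℕP.≤-refl

  ∣-0∣≤ : ∀ a ε → 0ℚ ≤ a + ε → 0ℚ ≤ - a + ε → ∣ a - 0ℚ ∣ ≤ ε
  ∣-0∣≤ a ε p q = ∣-∣≤ {a} {0ℚ} {ε} (begin
    a             ≡⟨ sym (+-identityʳ a) ⟩
    a + 0ℚ        ≤⟨ +-monoʳ-≤ a q ⟩
    a + (- a + ε) ≡⟨ eq a ε ⟩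
    0ℚ + ε        ∎) p
    where
    open ≤-Reasoning
    eq : ∀ a ε → a + (- a + ε) ≡ 0ℚ + ε
    eq = solve-∀ ℚ-ring

  NonNeg-antisym : ∀ {x} → NonNeg x → NonNeg (-ℝ x) → x ≅ 0ℝ
  NonNeg-antisym {x} ⟨ h ⟩ ⟨ k ⟩ = ⟨ (λ ε ε>0 → eventually₂ (λ n → 0ℚ ≤ seq x n + ε) (λ n → 0ℚ ≤ - seq x n + ε)
    (λ n → ∣ seq x n - 0ℚ ∣ ≤ ε) (λ n → ∣-0∣≤ (seq x n) ε) (h ε ε>0) (k ε ε>0)) ⟩

  1/-antimono : ∀ a b .{{_ : Positive a}} .{{_ : Positive b}} (r s : ℚ) → 0ℚ < r → 0ℚ < s →
                a * r ≡ 1ℚ → b * s ≡ 1ℚ → a ≤ b → s ≤ r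
  1/-antimono a b r s r>0 s>0 ar bs a≤b = begin
    s           ≡⟨ sym (trans (cong (_* s) ar) (*-identityˡ s)) ⟩
    (a * r) * s ≡⟨ rot a r s ⟩
    a * (r * s) ≤⟨ *-monoʳ-≤-nonNeg (r * s) {{nonNegative (0≤* {r} {s} (<⇒≤ r>0) (<⇒≤ s>0))}} a≤b ⟩
    b * (r * s) ≡⟨ rot′ b r s ⟩
    (b * s) * r ≡⟨ trans (cong (_* r) bs) (*-identityˡ r) ⟩
    r           ∎
    where
    open ≤-Reasoning
    rot : ∀ a r s → (a * r) * s ≡ a * (r * s)
    rot = solve-∀ ℚ-ring
    rot′ : ∀ b r s → b * (r * s) ≡ (b * s) * r
    rot′ = solve-∀ ℚ-ring

  -- This is 1/a - 1/b = (b - a)/(ab), with both reciprocals bounded by `ρ`.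
  ∣1/-1/∣≤ : ∀ a b r s ρ δ → a * r ≡ 1ℚ → b * s ≡ 1ℚ → 0ℚ ≤ ρ → ∣ r ∣ ≤ ρ → ∣ s ∣ ≤ ρ → ∣ b - a ∣ ≤ δ →
             ∣ r - s ∣ ≤ (ρ * ρ) * δ
  ∣1/-1/∣≤ a b r s ρ δ ar bs ρ≥0 rρ sρ h = begin
    ∣ r - s ∣                         ≡⟨ cong ∣_∣ (sym (cong₂ _-_
        (trans (cong (r *_) bs) (*-identityʳ r)) (trans (cong (s *_) ar) (*-identityʳ s)))) ⟩
    ∣ r * (b * s) - s * (a * r) ∣     ≡⟨ cong ∣_∣ (eq r s a b) ⟩
    ∣ (r * s) * (b - a) ∣             ≤⟨ *-mono-∣∣ (r * s) (b - a) (*-mono-∣∣ r s rρ sρ {{nonNegative ρ≥0}}) h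
                                          {{nonNegative (0≤* {ρ} {ρ} ρ≥0 ρ≥0)}} ⟩
    (ρ * ρ) * δ                       ∎
    where
    open ≤-Reasoning
    eq : ∀ r s a b → r * (b * s) - s * (a * r) ≡ (r * s) * (b - a)
    eq = solve-∀ ℚ-ring

  reciprocal : ∀ a → 0ℚ < a → ∃ λ r → 0ℚ < r × a * r ≡ 1ℚ
  reciprocal a a>0 = (1/ a) {{nz}} , positive⁻¹ _ {{1/pos⇒pos a {{positive a>0}}}} , *-inverseʳ a {{nz}}
    where nz = pos⇒nonZero a {{positive a>0}}

  ∣-∣-null : ∀ a b η → a ≡ b → 0ℚ < η → ∣ a - b ∣ ≤ η
  ∣-∣-null a .a η refl η>0 = subst (_≤ η) (cong ∣_∣ (sym (+-inverseʳ a))) (<⇒≤ η>0)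

  -- Truncating the sequence from below at `ε` makes every term invertible, with reciprocals bounded
  -- by 1/ε; from `N` on the truncation changes nothing.
  inverse : ∀ x → Pos x → ∃ λ w → Pos w × x *ℝ w ≅ 1ℝ
  inverse x ⟨ ε , ε>0 , N , h ⟩ = w , pos-w , inv
    where
    c : ℕ → ℚ
    c n = seq x n ⊔ ε
    ε≤c : ∀ n → ε ≤ c n
    ε≤c n = p≤q⊔p (seq x n) ε
    c>0 : ∀ n → 0ℚ < c n
    c>0 n = <-≤-trans ε>0 (ε≤c n)
    r : ℕ → ℚ
    r n = proj₁ (reciprocal (c n) (c>0 n))
    r>0 : ∀ n → 0ℚ < r n
    r>0 n = proj₁ (proj₂ (reciprocal (c n) (c>0 n)))
    r-inv : ∀ n → c n * r n ≡ 1ℚ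
    r-inv n = proj₂ (proj₂ (reciprocal (c n) (c>0 n)))
    ρ : ℚ
    ρ = proj₁ (reciprocal ε ε>0)
    ρ>0 : 0ℚ < ρ
    ρ>0 = proj₁ (proj₂ (reciprocal ε ε>0))
    ∣r∣≤ρ : ∀ n → ∣ r n ∣ ≤ ρ
    ∣r∣≤ρ n = subst (_≤ ρ) (sym (0≤p⇒∣p∣≡p (<⇒≤ (r>0 n))))
      (1/-antimono ε (c n) {{positive ε>0}} {{positive (c>0 n)}} ρ (r n) ρ>0 (r>0 n)
        (proj₂ (proj₂ (reciprocal ε ε>0))) (r-inv n) (ε≤c n))
    c≡ : ∀ n → N ℕ.≤ n → c n ≡ seq x n
    c≡ n hn = p≥q⇒p⊔q≡p (subst (_≤ seq x n) (+-identityˡ ε) (h n hn))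
    abstract
      r-cauchy : IsCauchy r
      r-cauchy = scaled (λ η → ∃ λ M → ∀ m n → M ℕ.≤ m → M ℕ.≤ n → ∣ r m - r n ∣ ≤ η)
        (ρ * ρ) (positive (subst (_< ρ * ρ) (*-zeroˡ ρ) (*-monoˡ-<-pos ρ {{positive ρ>0}} ρ>0))) λ δ δ>0 →
        let (M , cx) = cauchy x δ δ>0 in N ℕ.+ M , λ m n hm hn →
          ∣1/-1/∣≤ (c m) (c n) (r m) (r n) ρ δ (r-inv m) (r-inv n) (<⇒≤ ρ>0) (∣r∣≤ρ m) (∣r∣≤ρ n)
            (subst₂ (λ a b → ∣ a - b ∣ ≤ δ) (sym (c≡ n (ℕP.m+n≤o⇒m≤o N hn))) (sym (c≡ m (ℕP.m+n≤o⇒m≤o N hm)))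
              (cx n m (ℕP.m+n≤o⇒n≤o N hn) (ℕP.m+n≤o⇒n≤o N hm)))
    w : ℝ
    w = mkℝ r r-cauchy
    inv : x *ℝ w ≅ 1ℝ
    inv = ⟨ (λ η η>0 → N , λ n hn → ∣-∣-null (seq x n * r n) 1ℚ η
      (trans (cong (_* r n) (sym (c≡ n hn))) (r-inv n)) η>0) ⟩
    pos-w : Pos w
    -- An upper bound `B` of the terms of `x` gives the lower bound 1/B for the reciprocals.
    pos-w = let (B , B>0 , M , bd) = bounded (seq x) (cauchy x)
                (β , β>0 , β-inv) = reciprocal B (positive⁻¹ B {{B>0}}) in
      ⟨ (β , β>0 , N ℕ.+ M , (λ n hn → subst (_≤ r n) (sym (+-identityˡ β))
        (1/-antimono (c n) B {{positive (c>0 n)}} {{B>0}} (r n) β (r>0 n) β>0 (r-inv n) β-inv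
          (subst (_≤ B) (sym (c≡ n (ℕP.m+n≤o⇒m≤o N hn))) (∣∣≤⇒≤ {seq x n} (bd n (ℕP.m+n≤o⇒n≤o N hn))))))) ⟩

  ≅0⇒≅ : ∀ {x y} → x -ℝ y ≅ 0ℝ → x ≅ y
  ≅0⇒≅ {x} {y} h = ≅-trans (≅-trans (termwise (λ k → eq (seq x k) (seq y k))) (+-cong h (≅-refl {y})))
    (termwise (λ k → +-identityˡ (seq y k)))
    where
    eq : ∀ a b → a ≡ (a - b) + b
    eq = solve-∀ ℚ-ring

  ≅⇒≅0 : ∀ {x y} → x ≅ y → x -ℝ y ≅ 0ℝ
  ≅⇒≅0 {x} {y} h = ≅-trans (+-cong h (≅-refl { -ℝ y})) (termwise (λ k → +-inverseʳ (seq y k)))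

  -- Equations are derived from hypotheses e ≅ 0 by exhibiting a combination of them.
  modulo : ∀ c {e a b} → e ≅ 0ℝ → a ≅ b +ℝ c *ℝ e → a ≅ b
  modulo c {e} {a} {b} e≅0 h = ≅-trans h (≅-trans (+-cong (≅-refl {b}) (*-null c e≅0))
    (termwise (λ k → +-identityʳ (seq b k))))

  *-cong : ∀ {x x′ y y′} → x ≅ x′ → y ≅ y′ → x *ℝ y ≅ x′ *ℝ y′
  *-cong {x} {x′} {y} {y′} h k = modulo x (≅⇒≅0 k) (modulo y′ (≅⇒≅0 h)
    (termwise (λ n → eq (seq x n) (seq x′ n) (seq y n) (seq y′ n))))
    where
    eq : ∀ a a′ b b′ → a * b ≡ (a′ * b′ + a * (b - b′)) + b′ * (a - a′)
    eq = solve-∀ ℚ-ring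

  null-cancel : ∀ {x y} → Pos x → x *ℝ y ≅ 0ℝ → y ≅ 0ℝ
  null-cancel {x} {y} x>0 h = let (w , _ , inv) = inverse x x>0 in
    modulo w h (modulo (-ℝ y) (≅⇒≅0 inv) (termwise (λ n → eq (seq x n) (seq y n) (seq w n))))
    where
    eq : ∀ x y w → y ≡ ((0ℚ + w * (x * y)) + (- y) * (x * w - 1ℚ))
    eq = solve-∀ ℚ-ring

  NonNeg-cancel : ∀ {x y} → Pos x → NonNeg (x *ℝ y) → NonNeg y
  NonNeg-cancel {x} {y} x>0 h = let (w , w>0 , inv) = inverse x x>0 in
    NonNeg-resp (≅-sym (modulo (-ℝ y) (≅⇒≅0 inv) (termwise (λ n → eq (seq x n) (seq y n) (seq w n)))))
      (NonNeg-* (Pos⇒NonNeg w>0) h)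
    where
    eq : ∀ x y w → y ≡ w * (x * y) + (- y) * (x * w - 1ℚ)
    eq = solve-∀ ℚ-ring

  ≅0⇒NonNeg : ∀ {x} → x ≅ 0ℝ → NonNeg x
  ≅0⇒NonNeg h = NonNeg-resp (≅-sym h) ⟨ (λ ε ε>0 → 0 , λ _ _ → subst (0ℚ ≤_) (sym (+-identityˡ ε)) (<⇒≤ ε>0)) ⟩

  neg-null : ∀ {x} → x ≅ 0ℝ → -ℝ x ≅ 0ℝ
  neg-null h = ≅-trans (neg-cong h) (termwise (λ _ → refl))

  neg-involutive : ∀ {x} → -ℝ (-ℝ x) ≅ x
  neg-involutive {x} = termwise (λ k → eq (seq x k))
    where
    eq : ∀ a → - (- a) ≡ a
    eq = solve-∀ ℚ-ring

  fromℚ-pos : ∀ q → 0ℚ < q → Pos (fromℚ q)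
  fromℚ-pos q q>0 = ⟨ (q , q>0 , 0 , λ _ _ → ≤-reflexive (+-identityˡ q)) ⟩

  -- The sign distinctions made later all go back to this one.
  Pos-or-NonNeg : ∀ x → ¬ ¬ (Pos x ⊎ NonNeg (-ℝ x))
  Pos-or-NonNeg x k = k (inj₂ (¬Pos⇒NonNeg (λ x>0 → k (inj₁ x>0))))

  NonNeg-total : ∀ x → ¬ ¬ (NonNeg x ⊎ NonNeg (-ℝ x))
  NonNeg-total x k = Pos-or-NonNeg x λ { (inj₁ x>0) → k (inj₁ (Pos⇒NonNeg x>0)) ; (inj₂ h) → k (inj₂ h) }

  Pos-total : ∀ x → ¬ (x ≅ 0ℝ) → ¬ ¬ (Pos x ⊎ Pos (-ℝ x))
  Pos-total x x≇0 k = Pos-or-NonNeg x λ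
    { (inj₁ x>0) → k (inj₁ x>0)
    ; (inj₂ h)   → x≇0 (NonNeg-antisym (NonNeg-resp neg-involutive (¬Pos⇒NonNeg (λ -x>0 → k (inj₂ -x>0)))) h) }

  Pos⇒≇0 : ∀ {x} → Pos x → ¬ (x ≅ 0ℝ)
  Pos⇒≇0 x>0 x≅0 = Pos⇒¬NonNeg- x>0 (≅0⇒NonNeg (neg-null x≅0))

-- Convex combinations, affine images and hulls.

module Hulls where

  open import Defs hiding (_≈_; split)
  open RealArithmetic
  open import Data.Nat.Base using (suc; zero)
  open import Data.Rational.Base using (0ℚ; 1ℚ; _+_; _*_; _-_; -_)
  open import Data.Rational.Properties using (+-identityˡ; positive⁻¹)
  open import Data.Fin.Base using (Fin; zero; suc)
  open import Data.Fin.Subset as Subset using (Subset)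
  open import Data.Product using (∃; _×_; _,_; proj₁; proj₂)
  open import Data.Sum using (inj₁; inj₂)
  open import Data.Empty using (⊥-elim)
  open import Relation.Nullary using (¬_)
  open import Relation.Binary.PropositionalEquality
  open import Tactic.RingSolver using (solve-∀)

  ∑-linear : ∀ {n} α β γ (h f g k : Fin n → ℝ) → (∀ i → h i ≅ (α *ℝ f i +ℝ β *ℝ g i) +ℝ γ *ℝ k i) →
             ∑ h ≅ (α *ℝ ∑ f +ℝ β *ℝ ∑ g) +ℝ γ *ℝ ∑ k
  ∑-linear {zero} α β γ h f g k eq = termwise (λ n → lem (seq α n) (seq β n) (seq γ n))
    where
    lem : ∀ a b c → 0ℚ ≡ (a * 0ℚ + b * 0ℚ) + c * 0ℚ
    lem = solve-∀ ℚ-ring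
  ∑-linear {suc n} α β γ h f g k eq = ≅-trans
    (+-cong (eq zero) (∑-linear α β γ (λ i → h (suc i)) (λ i → f (suc i)) (λ i → g (suc i)) (λ i → k (suc i)) (λ i → eq (suc i))))
    (termwise (λ m → lem (seq α m) (seq β m) (seq γ m) (seq (f zero) m) (seq (g zero) m) (seq (k zero) m)
       (seq (∑ (λ i → f (suc i))) m) (seq (∑ (λ i → g (suc i))) m) (seq (∑ (λ i → k (suc i))) m)))
    where
    lem : ∀ a b c x y z X Y Z → ((a * x + b * y) + c * z) + ((a * X + b * Y) + c * Z)
          ≡ (a * (x + X) + b * (y + Y)) + c * (z + Z)
    lem = solve-∀ ℚ-ring

  ∑-null : ∀ {n} (f : Fin n → ℝ) → (∀ i → f i ≅ 0ℝ) → ∑ f ≅ 0ℝ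
  ∑-null {zero}  f h = ≅-refl
  ∑-null {suc n} f h = ≅-trans (+-cong (h zero) (∑-null (λ i → f (suc i)) (λ i → h (suc i)))) (termwise {0ℝ +ℝ 0ℝ} {0ℝ} (λ _ → refl))

  indicator : ∀ {n} → Fin n → Fin n → ℝ
  indicator zero    zero    = 1ℝ
  indicator zero    (suc _) = 0ℝ
  indicator (suc i) zero    = 0ℝ
  indicator (suc i) (suc j) = indicator i j

  indicator-≥0 : ∀ {n} (i j : Fin n) → NonNeg (indicator i j)
  indicator-≥0 zero    zero    = Pos⇒NonNeg (fromℚ-pos 1ℚ (positive⁻¹ 1ℚ))
  indicator-≥0 zero    (suc _) = ≅0⇒NonNeg ≅-refl
  indicator-≥0 (suc i) zero    = ≅0⇒NonNeg ≅-refl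
  indicator-≥0 (suc i) (suc j) = indicator-≥0 i j

  indicator-≢ : ∀ {n} (i j : Fin n) → i ≢ j → indicator i j ≅ 0ℝ
  indicator-≢ zero    zero    i≢j = ⊥-elim (i≢j refl)
  indicator-≢ zero    (suc _) i≢j = ≅-refl
  indicator-≢ (suc i) zero    i≢j = ≅-refl
  indicator-≢ (suc i) (suc j) i≢j = indicator-≢ i j (λ i≡j → i≢j (cong suc i≡j))

  ∑-indicator : ∀ {n} (i : Fin n) (f : Fin n → ℝ) → ∑ (λ j → indicator i j *ℝ f j) ≅ f i
  ∑-indicator zero f = ≅-trans (+-cong (termwise {1ℝ *ℝ f zero} {f zero} (λ k → lem (seq (f zero) k)))
      (∑-null (λ i → 0ℝ *ℝ f (suc i)) (λ i → termwise {0ℝ *ℝ f (suc i)} {0ℝ} (λ k → lem₀ (seq (f (suc i)) k)))))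
      (termwise (λ k → lem₁ (seq (f zero) k)))
    where
    lem : ∀ x → 1ℚ * x ≡ x
    lem = solve-∀ ℚ-ring
    lem₀ : ∀ x → 0ℚ * x ≡ 0ℚ
    lem₀ = solve-∀ ℚ-ring
    lem₁ : ∀ x → x + 0ℚ ≡ x
    lem₁ = solve-∀ ℚ-ring
  ∑-indicator (suc i) f = ≅-trans (+-cong (termwise {0ℝ *ℝ f zero} {0ℝ} (λ k → lem₀ (seq (f zero) k))) (∑-indicator i (λ j → f (suc j))))
      (termwise (λ k → +-identityˡ (seq (f (suc i)) k)))
    where
    lem₀ : ∀ x → 0ℚ * x ≡ 0ℚ
    lem₀ = solve-∀ ℚ-ring

  ∑-cong : ∀ {n} (f g : Fin n → ℝ) → (∀ i → f i ≅ g i) → ∑ f ≅ ∑ g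
  ∑-cong {zero}  f g h = ≅-refl
  ∑-cong {suc n} f g h = +-cong (h zero) (∑-cong (λ i → f (suc i)) (λ i → g (suc i)) (λ i → h (suc i)))

  record Hull {n} (v : Fin n → Point) (s : Subset n) (P : Point) : Set where
    field
      weight  : Fin n → ℝ
      ≥0      : ∀ i → NonNeg (weight i)
      support : ∀ i → i Subset.∉ s → weight i ≅ 0ℝ
      total   : ∑ weight ≅ 1ℝ
      x-coord : ∑ (λ i → weight i *ℝ proj₁ (v i)) ≅ proj₁ P
      y-coord : ∑ (λ i → weight i *ℝ proj₂ (v i)) ≅ proj₂ P

  Hull⇒InHull : ∀ {n} {v : Fin n → Point} {s P} → Hull v s P → InHull v s P
  Hull⇒InHull H = weight , (λ i → ≤-proof (≥0 i)) , (λ i i∉s → ≃-proof (support i i∉s)) ,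
    ≃-proof total , ≃-proof x-coord , ≃-proof y-coord
    where open Hull H

  module _ {n} (v : Fin n → Point) (s : Subset n) where
    open Hull

    hull-vertex : ∀ i → i Subset.∈ s → Hull v s (v i)
    hull-vertex i i∈s = record
      { weight  = indicator i
      ; ≥0      = indicator-≥0 i
      ; support = λ j j∉s → indicator-≢ i j (λ { refl → j∉s i∈s })
      ; total   = ≅-trans (∑-cong (indicator i) (λ j → indicator i j *ℝ 1ℝ) (λ j → termwise (λ k → lem (seq (indicator i j) k))))
                          (∑-indicator i (λ _ → 1ℝ))
      ; x-coord = ∑-indicator i (λ j → proj₁ (v j))
      ; y-coord = ∑-indicator i (λ j → proj₂ (v j))
      }
      where
      lem : ∀ x → x ≡ x * 1ℚ
      lem = solve-∀ ℚ-ring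

    hull-resp : ∀ {P Q} → proj₁ P ≅ proj₁ Q → proj₂ P ≅ proj₂ Q → Hull v s P → Hull v s Q
    hull-resp x≅ y≅ H = record
      { weight = weight H ; ≥0 = ≥0 H ; support = support H ; total = total H
      ; x-coord = ≅-trans (x-coord H) x≅ ; y-coord = ≅-trans (y-coord H) y≅ }

    -- The weight functions are combined with the same coefficients. Three points are taken so that
    -- barycentric coordinates in a triangle can be used directly.
    hull-convex : ∀ {P Q R α β γ} → Hull v s P → Hull v s Q → Hull v s R →
      NonNeg α → NonNeg β → NonNeg γ → (α +ℝ β) +ℝ γ ≅ 1ℝ →
      Hull v s ((α *ℝ proj₁ P +ℝ β *ℝ proj₁ Q) +ℝ γ *ℝ proj₁ R , (α *ℝ proj₂ P +ℝ β *ℝ proj₂ Q) +ℝ γ *ℝ proj₂ R)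
    hull-convex {P} {Q} {R} {α} {β} {γ} H H′ H″ α≥0 β≥0 γ≥0 αβγ = record
      { weight  = u
      ; ≥0      = λ i → NonNeg-+ (NonNeg-+ (NonNeg-* α≥0 (≥0 H i)) (NonNeg-* β≥0 (≥0 H′ i))) (NonNeg-* γ≥0 (≥0 H″ i))
      ; support = λ i i∉s → ≅-trans (+-cong (+-cong (*-null α (support H i i∉s)) (*-null β (support H′ i i∉s)))
                                            (*-null γ (support H″ i i∉s))) (termwise (λ _ → refl))
      ; total   = ≅-trans (∑-linear α β γ u (weight H) (weight H′) (weight H″) (λ _ → ≅-refl))
                    (≅-trans (combine (total H) (total H′) (total H″))
                    (≅-trans (termwise (λ k → lem (seq α k) (seq β k) (seq γ k))) αβγ))
      ; x-coord = ≅-trans (moment (λ i → proj₁ (v i))) (combine (x-coord H) (x-coord H′) (x-coord H″))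
      ; y-coord = ≅-trans (moment (λ i → proj₂ (v i))) (combine (y-coord H) (y-coord H′) (y-coord H″))
      }
      where
      u : Fin n → ℝ
      u i = (α *ℝ weight H i +ℝ β *ℝ weight H′ i) +ℝ γ *ℝ weight H″ i
      combine : ∀ {a b c a′ b′ c′} → a ≅ a′ → b ≅ b′ → c ≅ c′ →
             (α *ℝ a +ℝ β *ℝ b) +ℝ γ *ℝ c ≅ (α *ℝ a′ +ℝ β *ℝ b′) +ℝ γ *ℝ c′
      combine a b c = +-cong (+-cong (*-cong ≅-refl a) (*-cong ≅-refl b)) (*-cong ≅-refl c)
      lem : ∀ a b c → (a * 1ℚ + b * 1ℚ) + c * 1ℚ ≡ (a + b) + c
      lem = solve-∀ ℚ-ring
      dist : ∀ a b c x y z t → ((a * x + b * y) + c * z) * t ≡ (a * (x * t) + b * (y * t)) + c * (z * t)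
      dist = solve-∀ ℚ-ring
      moment : ∀ (f : Fin n → ℝ) → ∑ (λ i → u i *ℝ f i) ≅
               (α *ℝ ∑ (λ i → weight H i *ℝ f i) +ℝ β *ℝ ∑ (λ i → weight H′ i *ℝ f i)) +ℝ γ *ℝ ∑ (λ i → weight H″ i *ℝ f i)
      moment f = ∑-linear α β γ (λ i → u i *ℝ f i) (λ i → weight H i *ℝ f i) (λ i → weight H′ i *ℝ f i) (λ i → weight H″ i *ℝ f i)
        (λ i → termwise (λ k → dist (seq α k) (seq β k) (seq γ k) (seq (weight H i) k) (seq (weight H′ i) k) (seq (weight H″ i) k) (seq (f i) k)))

  moment-affine : ∀ {n} (w x y X : Fin n → ℝ) (a b c p q : ℝ) → ∑ w ≅ 1ℝ → (∀ i → X i ≅ (a *ℝ x i +ℝ b *ℝ y i) +ℝ c) →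
    ∑ (λ i → w i *ℝ x i) ≅ p → ∑ (λ i → w i *ℝ y i) ≅ q → ∑ (λ i → w i *ℝ X i) ≅ (a *ℝ p +ℝ b *ℝ q) +ℝ c
  moment-affine w x y X a b c p q w1 hX hp hq = ≅-trans
    (∑-linear a b c (λ i → w i *ℝ X i) (λ i → w i *ℝ x i) (λ i → w i *ℝ y i) w
      (λ i → ≅-trans (*-cong ≅-refl (hX i)) (termwise (λ k → dist (seq a k) (seq b k) (seq c k) (seq (w i) k) (seq (x i) k) (seq (y i) k)))))
    (≅-trans (+-cong (+-cong (*-cong ≅-refl hp) (*-cong ≅-refl hq)) (*-cong ≅-refl w1))
      (termwise (λ k → lem (seq a k) (seq b k) (seq c k) (seq p k) (seq q k))))
    where
    dist : ∀ a b c w x y → w * ((a * x + b * y) + c) ≡ (a * (w * x) + b * (w * y)) + c * w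
    dist = solve-∀ ℚ-ring
    lem : ∀ a b c p q → (a * p + b * q) + c * 1ℚ ≡ (a * p + b * q) + c
    lem = solve-∀ ℚ-ring

  -- The weights stay the same; the constant terms `c` and `f` come through because the weights sum
  -- to 1.
  hull-affine : ∀ {n} (u v : Fin n → Point) (s : Subset n) (a b c d e f : ℝ) →
    (∀ i → proj₁ (v i) ≅ (a *ℝ proj₁ (u i) +ℝ b *ℝ proj₂ (u i)) +ℝ c) →
    (∀ i → proj₂ (v i) ≅ (d *ℝ proj₁ (u i) +ℝ e *ℝ proj₂ (u i)) +ℝ f) →
    ∀ {P} → Hull u s P →
    Hull v s ((a *ℝ proj₁ P +ℝ b *ℝ proj₂ P) +ℝ c , (d *ℝ proj₁ P +ℝ e *ℝ proj₂ P) +ℝ f)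
  hull-affine u v s a b c d e f hx hy {P} H = record
    { weight = weight ; ≥0 = ≥0 ; support = support ; total = total
    ; x-coord = moment-affine weight (λ i → proj₁ (u i)) (λ i → proj₂ (u i)) (λ i → proj₁ (v i)) a b c (proj₁ P) (proj₂ P) total hx x-coord y-coord
    ; y-coord = moment-affine weight (λ i → proj₁ (u i)) (λ i → proj₂ (u i)) (λ i → proj₂ (v i)) d e f (proj₁ P) (proj₂ P) total hy x-coord y-coord }
    where open Hull H

  -- An affine function with values `A` ≤ 0 ≤ `B` at the ends of a segment has a zero on it, at the
  -- weights B/(B - A) and -A/(B - A). If `B -ℝ A` is not positive, then `A` vanishes and the first
  -- end itself is a zero.
  interpolate : ∀ {A B} → NonNeg (-ℝ A) → NonNeg B →
    ¬ ¬ (∃ λ s → ∃ λ t → NonNeg s × NonNeg t × s +ℝ t ≅ 1ℝ × s *ℝ A +ℝ t *ℝ B ≅ 0ℝ)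
  interpolate {A} {B} A≤0 B≥0 k = Pos-or-NonNeg (B -ℝ A) λ
    { (inj₁ h) → let (w , w>0 , inv) = inverse (B -ℝ A) h in
        k (B *ℝ w , (-ℝ A) *ℝ w , NonNeg-* B≥0 (Pos⇒NonNeg w>0) , NonNeg-* A≤0 (Pos⇒NonNeg w>0) ,
          ≅-trans (termwise (λ n → e₁ (seq A n) (seq B n) (seq w n))) inv ,
          termwise (λ n → e₂ (seq A n) (seq B n) (seq w n)))
    ; (inj₂ h) → let A≅0 = NonNeg-antisym
                       (NonNeg-resp (termwise (λ n → e₃ (seq A n) (seq B n))) (NonNeg-+ B≥0 h)) A≤0 in
        k (1ℝ , 0ℝ , Pos⇒NonNeg (fromℚ-pos 1ℚ (positive⁻¹ 1ℚ)) , ≅0⇒NonNeg ≅-refl , termwise (λ _ → refl) ,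
          ≅-trans (+-cong (*-null 1ℝ A≅0) (termwise {0ℝ *ℝ B} {0ℝ} (λ n → e₄ (seq B n)))) (termwise (λ _ → refl))) }
    where
    e₁ : ∀ A B w → B * w + (- A) * w ≡ (B - A) * w
    e₁ = solve-∀ ℚ-ring
    e₂ : ∀ A B w → (B * w) * A + ((- A) * w) * B ≡ 0ℚ
    e₂ = solve-∀ ℚ-ring
    e₃ : ∀ A B → B + (- (B - A)) ≡ A
    e₃ = solve-∀ ℚ-ring
    e₄ : ∀ B → 0ℚ * B ≡ 0ℚ
    e₄ = solve-∀ ℚ-ring

-- Segments from the upward ray into the right half plane, and their crossings.

module HalfPlane where

  open import Defs hiding (_≈_; split)
  open RealArithmetic
  open Hulls
  open import Data.Rational.Base using (0ℚ; 1ℚ; _+_; _*_; _-_; -_)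
  open import Data.Product using (∃; _×_; _,_; proj₁; proj₂)
  open import Data.Sum using (_⊎_; inj₁; inj₂)
  open import Data.Empty using (⊥)
  open import Relation.Nullary using (¬_)
  open import Relation.Binary.PropositionalEquality
  open import Tactic.RingSolver using (solve-∀)

  -- The segment from the point (0 , h) of the upward ray to the point (x , y)
  -- of the right half plane.
  record Half : Set where
    field
      x y h : ℝ
      x>0   : Pos x
      h>0   : Pos h
  open Half

  tip foot : Half → Point
  tip a = x a , y a
  foot a = 0ℝ , h a

  -- line a P ≥ 0 iff P is not below the line of a, and
  -- sweep a P ≥ 0 iff P is not clockwise of the tip of a, as seen from the origin.
  line sweep : Half → Point → ℝ
  line a (X , Y) = (x a *ℝ Y -ℝ X *ℝ (y a -ℝ h a)) -ℝ h a *ℝ x a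
  sweep a (X , Y) = x a *ℝ Y -ℝ y a *ℝ X

  comb : ℝ → ℝ → Point → Point → Point
  comb s t (X , Y) (X′ , Y′) = s *ℝ X +ℝ t *ℝ X′ , s *ℝ Y +ℝ t *ℝ Y′

  -- The closed wedge between the upward ray and the ray from the origin through the tip of `a`. It
  -- does not depend on the height of `a`, and `InCone b (tip a)` says that the tip of `a` is at
  -- least as close in angle to the upward ray as that of `b`.
  record InCone (a : Half) (P : Point) : Set where
    constructor cone
    field
      right : NonNeg (proj₁ P)
      swept : NonNeg (sweep a P)
  open InCone

  -- Within the wedge, the line of `a` cuts out exactly the segment from foot to tip, and the points
  -- not above it form the closed triangle of origin, foot and tip.
  OnHalf UnderHalf : Half → Point → Set
  OnHalf a P = InCone a P × line a P ≅ 0ℝ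
  UnderHalf a P = InCone a P × NonNeg (-ℝ line a P)

  NonNeg-comb : ∀ {s t A B} → NonNeg s → NonNeg t → NonNeg A → NonNeg B → NonNeg (s *ℝ A +ℝ t *ℝ B)
  NonNeg-comb s t A B = NonNeg-+ (NonNeg-* s A) (NonNeg-* t B)

  null-comb : ∀ s t {A B} → A ≅ 0ℝ → B ≅ 0ℝ → s *ℝ A +ℝ t *ℝ B ≅ 0ℝ
  null-comb s t A B = ≅-trans (+-cong (*-null s A) (*-null t B)) (termwise (λ _ → refl))

  sweep-comb : ∀ a s t P Q → sweep a (comb s t P Q) ≅ s *ℝ sweep a P +ℝ t *ℝ sweep a Q
  sweep-comb a s t P Q = termwise (λ k → lem (seq (x a) k) (seq (y a) k) (seq s k) (seq t k)
    (seq (proj₁ P) k) (seq (proj₂ P) k) (seq (proj₁ Q) k) (seq (proj₂ Q) k))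
    where
    lem : ∀ x y s t X Y X′ Y′ → x * (s * Y + t * Y′) - y * (s * X + t * X′) ≡ s * (x * Y - y * X) + t * (x * Y′ - y * X′)
    lem = solve-∀ ℚ-ring

  line-comb : ∀ a s t P Q → s +ℝ t ≅ 1ℝ → line a (comb s t P Q) ≅ s *ℝ line a P +ℝ t *ℝ line a Q
  line-comb a s t P Q st = modulo (h a *ℝ x a) (≅⇒≅0 st) (termwise (λ k → lem (seq (x a) k) (seq (y a) k) (seq (h a) k) (seq s k) (seq t k)
    (seq (proj₁ P) k) (seq (proj₂ P) k) (seq (proj₁ Q) k) (seq (proj₂ Q) k)))
    where
    lem : ∀ x y h s t X Y X′ Y′ → (x * (s * Y + t * Y′) - (s * X + t * X′) * (y - h)) - h * x
       ≡ (s * ((x * Y - X * (y - h)) - h * x) + t * ((x * Y′ - X′ * (y - h)) - h * x)) + (h * x) * ((s + t) - 1ℚ)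
    lem = solve-∀ ℚ-ring

  cone-comb : ∀ {a s t P Q} → NonNeg s → NonNeg t → InCone a P → InCone a Q → InCone a (comb s t P Q)
  cone-comb {a} {s} {t} {P} {Q} s≥0 t≥0 (cone r w) (cone r′ w′) = cone (NonNeg-comb s≥0 t≥0 r r′)
    (NonNeg-resp (≅-sym (sweep-comb a s t P Q)) (NonNeg-comb s≥0 t≥0 w w′))

  on-comb : ∀ {a s t P Q} → NonNeg s → NonNeg t → s +ℝ t ≅ 1ℝ → OnHalf a P → OnHalf a Q → OnHalf a (comb s t P Q)
  on-comb {a} {s} {t} {P} {Q} s≥0 t≥0 st (c , l) (c′ , l′) = cone-comb s≥0 t≥0 c c′ ,
    ≅-trans (line-comb a s t P Q st) (null-comb s t l l′)

  foot-cone : ∀ a b → InCone b (foot a)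
  foot-cone a b = cone (≅0⇒NonNeg ≅-refl)
    (NonNeg-resp (termwise (λ k → lem (seq (x b) k) (seq (h a) k) (seq (y b) k))) (NonNeg-* (Pos⇒NonNeg (x>0 b)) (Pos⇒NonNeg (h>0 a))))
    where
    lem : ∀ x h y → x * h ≡ x * h - y * 0ℚ
    lem = solve-∀ ℚ-ring

  line-foot : ∀ a b → line b (foot a) ≅ x b *ℝ (h a -ℝ h b)
  line-foot a b = termwise (λ k → lem (seq (x b) k) (seq (y b) k) (seq (h b) k) (seq (h a) k))
    where
    lem : ∀ x y h k → (x * k - 0ℚ * (y - h)) - h * x ≡ x * (k - h)
    lem = solve-∀ ℚ-ring

  foot-above : ∀ a b → NonNeg (h a -ℝ h b) → NonNeg (line b (foot a))
  foot-above a b ha≥hb = NonNeg-resp (≅-sym (line-foot a b)) (NonNeg-* (Pos⇒NonNeg (x>0 b)) ha≥hb)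

  foot-below : ∀ a b → NonNeg (h b -ℝ h a) → NonNeg (-ℝ line b (foot a))
  foot-below a b hb≥ha = NonNeg-resp (≅-trans (termwise (λ k → lem (seq (x b) k) (seq (h b) k) (seq (h a) k)))
      (neg-cong (≅-sym (line-foot a b))))
    (NonNeg-* (Pos⇒NonNeg (x>0 b)) hb≥ha)
    where
    lem : ∀ x h k → x * (h - k) ≡ - (x * (k - h))
    lem = solve-∀ ℚ-ring

  foot-on : ∀ a → OnHalf a (foot a)
  foot-on a = foot-cone a a , ≅-trans (line-foot a a) (*-null (x a) (≅⇒≅0 ≅-refl))

  tip-on : ∀ a → OnHalf a (tip a)
  tip-on a = cone (Pos⇒NonNeg (x>0 a)) (≅0⇒NonNeg (termwise (λ k → lem (seq (x a) k) (seq (y a) k)))) ,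
    termwise (λ k → lem₁ (seq (x a) k) (seq (y a) k) (seq (h a) k))
    where
    lem : ∀ x y → x * y - y * x ≡ 0ℚ
    lem = solve-∀ ℚ-ring
    lem₁ : ∀ x y h → (x * y - x * (y - h)) - h * x ≡ 0ℚ
    lem₁ = solve-∀ ℚ-ring

  -- The function `line b` changes sign along the segment of `a`, so it has a zero there. The wedge
  -- condition places this zero on the segment of `b` rather than beyond its tip. Any wedge contains
  -- the foot of `a`, so one that contains the tip contains the zero too.
  meet : ∀ a b → InCone b (tip a) →
    (NonNeg (h b -ℝ h a) × NonNeg (line b (tip a))) ⊎ (NonNeg (h a -ℝ h b) × NonNeg (-ℝ line b (tip a))) →
    ¬ ¬ (∃ λ P → OnHalf a P × OnHalf b P × (∀ c → InCone c (tip a) → InCone c P))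
  meet a b c order k = alternatives order
    where
    finish : ∀ s t → NonNeg s → NonNeg t → s +ℝ t ≅ 1ℝ → s *ℝ line b (foot a) +ℝ t *ℝ line b (tip a) ≅ 0ℝ → ⊥
    finish s t s≥0 t≥0 st zero-line = k (comb s t (foot a) (tip a) , on-comb s≥0 t≥0 st (foot-on a) (tip-on a) ,
      (cone-comb s≥0 t≥0 (foot-cone a b) c , ≅-trans (line-comb b s t (foot a) (tip a) st) zero-line) ,
      λ d d∋tip → cone-comb s≥0 t≥0 (foot-cone a d) d∋tip)
    neg-comb : ∀ s t A B → s *ℝ (-ℝ A) +ℝ t *ℝ (-ℝ B) ≅ -ℝ (s *ℝ A +ℝ t *ℝ B)
    neg-comb s t A B = termwise (λ k → lem (seq s k) (seq t k) (seq A k) (seq B k))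
      where
      lem : ∀ s t A B → s * (- A) + t * (- B) ≡ - (s * A + t * B)
      lem = solve-∀ ℚ-ring
    alternatives : _ → ⊥
    alternatives (inj₁ (hb≥ha , above)) = interpolate (foot-below a b hb≥ha) above
      λ { (s , t , s≥0 , t≥0 , st , z) → finish s t s≥0 t≥0 st z }
    -- Here `line b` falls from foot to tip, and `interpolate` is applied to its negative.
    alternatives (inj₂ (ha≥hb , below)) =
      interpolate (NonNeg-resp (≅-sym neg-involutive) (foot-above a b ha≥hb)) below
      λ { (s , t , s≥0 , t≥0 , st , z) → finish s t s≥0 t≥0 st
          (≅-trans (≅-sym neg-involutive) (neg-null (≅-trans (≅-sym (neg-comb s t _ _)) z))) }

  -- If P lies above b, follow the segment from the foot of a to P: it starts
  -- below b and stays below c, so its crossing with b lies under c.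
  meet-third : ∀ a b c P → OnHalf a P → OnHalf c P → InCone b P →
    NonNeg (h c -ℝ h a) → NonNeg (h b -ℝ h a) →
    ¬ ¬ (∃ λ Q → (OnHalf a Q × OnHalf c Q × UnderHalf b Q) ⊎ (OnHalf a Q × OnHalf b Q × UnderHalf c Q))
  meet-third a b c P aP cP bP hc≥ha hb≥ha k = NonNeg-total (line b P) λ
    { (inj₁ above) → interpolate (foot-below a b hb≥ha) above λ { (s , t , s≥0 , t≥0 , st , z) →
        k (comb s t (foot a) P , inj₂
          ( on-comb s≥0 t≥0 st (foot-on a) aP
          , (cone-comb s≥0 t≥0 (foot-cone a b) bP , ≅-trans (line-comb b s t (foot a) P st) z)
          , (cone-comb s≥0 t≥0 (foot-cone a c) (proj₁ cP) ,
             NonNeg-resp (≅-trans (termwise (λ k → lem (seq s k) (seq t k) (seq (line c (foot a)) k) (seq (line c P) k)))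
                 (neg-cong (≅-sym (line-comb c s t (foot a) P st))))
               (NonNeg-comb s≥0 t≥0 (foot-below a c hc≥ha) (≅0⇒NonNeg (neg-null (proj₂ cP))))))) }
    ; (inj₂ below) → k (P , inj₁ (aP , cP , (bP , below))) }
    where
    lem : ∀ s t A B → s * (- A) + t * (- B) ≡ - (s * A + t * B)
    lem = solve-∀ ℚ-ring

  -- For tips in the right half plane `sweep` compares the slopes y/x; the identity is transitivity
  -- of that comparison with denominators cleared.
  cone-trans : ∀ a b c → InCone a (tip b) → InCone b (tip c) → InCone a (tip c)
  cone-trans a b c ab bc = cone (right bc) (NonNeg-cancel (x>0 b)
    (NonNeg-resp (termwise (λ k → lem (seq (x a) k) (seq (y a) k) (seq (x b) k) (seq (y b) k) (seq (x c) k) (seq (y c) k)))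
      (NonNeg-+ (NonNeg-* (Pos⇒NonNeg (x>0 a)) (swept bc)) (NonNeg-* (Pos⇒NonNeg (x>0 c)) (swept ab)))))
    where
    lem : ∀ x y x′ y′ x″ y″ → x * (x′ * y″ - y′ * x″) + x″ * (x * y′ - y * x′) ≡ x′ * (x * y″ - y * x″)
    lem = solve-∀ ℚ-ring

  cone-total : ∀ a b → ¬ ¬ (InCone a (tip b) ⊎ InCone b (tip a))
  cone-total a b k = NonNeg-total (sweep a (tip b)) λ
    { (inj₁ h) → k (inj₁ (cone (Pos⇒NonNeg (x>0 b)) h))
    ; (inj₂ h) → k (inj₂ (cone (Pos⇒NonNeg (x>0 a)) (NonNeg-resp (termwise (λ k → lem (seq (x a) k) (seq (y a) k) (seq (x b) k) (seq (y b) k))) h))) }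
    where
    lem : ∀ x y x′ y′ → - (x * y′ - y * x′) ≡ x′ * y - y′ * x
    lem = solve-∀ ℚ-ring

-- Sorting, counting in fibres, and good blocks in a sorted list.

module Combinatorics where

  open import Data.Nat.Base
  open import Data.Nat.Properties
  open import Data.Fin.Base using (Fin; zero; suc)
  open import Data.Fin.Properties as FinP using ()
  open import Data.List.Base using (List; []; _∷_; _++_; length; filter; take; drop)
  open import Data.List.Properties using (filter-++; length-++; filter-accept; length-take; length-drop; take++drop≡id; ++-assoc)
  open import Data.List.Membership.Propositional using (_∈_; find; lose)
  open import Data.List.Membership.Propositional.Properties using (∈-filter⁻; ∈-++⁺ˡ; ∈-++⁺ʳ)
  open import Data.List.Relation.Unary.Any using (Any; here; there; any?)
  open import Data.List.Relation.Unary.All as All using (All; []; _∷_)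
  open import Data.List.Relation.Unary.AllPairs as AllPairs using (AllPairs; []; _∷_)
  import Data.List.Relation.Unary.AllPairs.Properties as AllPairs
  open import Data.List.Relation.Binary.Permutation.Propositional using (_↭_; refl; prep; swap; trans; ↭-sym; ↭-refl; ↭-trans)
  open import Data.List.Relation.Binary.Permutation.Propositional.Properties using (All-resp-↭)
  open import Data.Product using (∃; _×_; _,_; proj₁; proj₂)
  open import Data.Sum using (_⊎_; inj₁; inj₂)
  open import Data.Empty using (⊥-elim)
  open import Relation.Nullary using (¬_; Dec; yes; no)
  open import Relation.Nullary.Decidable using (_⊎-dec_; ¬?)
  open import Relation.Binary.PropositionalEquality hiding (trans)
  import Relation.Binary.PropositionalEquality as ≡
  open import Data.Nat.Tactic.RingSolver using (solve-∀)

  module _ {A : Set} (R : A → A → Set) (R-trans : ∀ {a b c} → R a b → R b c → R a c)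
           (R-total : ∀ a b → ¬ ¬ (R a b ⊎ R b a)) where

    insertion : ∀ a xs → AllPairs R xs → ¬ ¬ (∃ λ ys → ys ↭ a ∷ xs × AllPairs R ys)
    insertion a [] [] k = k (a ∷ [] , ↭-refl , ([] ∷ []))
    insertion a (x ∷ xs) (x≤ ∷ sorted) k = R-total a x λ
      { (inj₁ a≤x) → k (a ∷ x ∷ xs , ↭-refl , ((a≤x ∷ All.map (R-trans a≤x) x≤) ∷ x≤ ∷ sorted))
      ; (inj₂ x≤a) → insertion a xs sorted λ
          { (ys , ys↭ , ys-sorted) → k (x ∷ ys , ↭-trans (prep x ys↭) (swap x a ↭-refl) ,
              All-resp-↭ (↭-sym ys↭) (x≤a ∷ x≤) ∷ ys-sorted) } }

    -- Insertion sort under `¬ ¬`, since `R` is total only in that sense.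
    sorting : ∀ xs → ¬ ¬ (∃ λ ys → ys ↭ xs × AllPairs R ys)
    sorting [] k = k ([] , ↭-refl , [])
    sorting (x ∷ xs) k = sorting xs λ { (ys , ys↭ , sorted) → insertion x ys sorted λ
      { (zs , zs↭ , zs-sorted) → k (zs , ↭-trans zs↭ (prep x ys↭) , zs-sorted) } }

  sum : ∀ {n} → (Fin n → ℕ) → ℕ
  sum {zero}  f = 0
  sum {suc n} f = f zero + sum (λ i → f (suc i))

  sum-+ : ∀ {n} (f g : Fin n → ℕ) → sum (λ i → f i + g i) ≡ sum f + sum g
  sum-+ {zero}  f g = ≡.refl
  sum-+ {suc n} f g = ≡.trans (cong (f zero + g zero +_) (sum-+ (λ i → f (suc i)) (λ i → g (suc i))))
    (lem (f zero) (g zero) (sum (λ i → f (suc i))) (sum (λ i → g (suc i))))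
    where
    lem : ∀ a b c d → a + b + (c + d) ≡ (a + c) + (b + d)
    lem = solve-∀

  sum-mono : ∀ {n} (f g : Fin n → ℕ) → (∀ i → f i ≤ g i) → sum f ≤ sum g
  sum-mono {zero}  f g h = z≤n
  sum-mono {suc n} f g h = +-mono-≤ (h zero) (sum-mono (λ i → f (suc i)) (λ i → g (suc i)) (λ i → h (suc i)))

  sum-mono-< : ∀ {n} (f g : Fin n → ℕ) → (∀ i → f i ≤ g i) → ∀ j → f j < g j → sum f < sum g
  sum-mono-< {suc n} f g h zero    h< = +-mono-<-≤ h< (sum-mono (λ i → f (suc i)) (λ i → g (suc i)) (λ i → h (suc i)))
  sum-mono-< {suc n} f g h (suc j) h< = +-mono-≤-< (h zero) (sum-mono-< (λ i → f (suc i)) (λ i → g (suc i)) (λ i → h (suc i)) j h<)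

  sum-const : ∀ n k → sum {n} (λ _ → k) ≡ n * k
  sum-const zero    k = ≡.refl
  sum-const (suc n) k = cong (k +_) (sum-const n k)

  sum-≤ : ∀ {n} (f : Fin n → ℕ) k → (∀ i → f i ≤ k) → sum f ≤ n * k
  sum-≤ {n} f k h = ≤-trans (sum-mono f (λ _ → k) h) (≤-reflexive (sum-const n k))

  length-partition : ∀ {A : Set} {P : A → Set} (P? : ∀ a → Dec (P a)) ys →
                     length (filter (λ a → ¬? (P? a)) ys) + length (filter P? ys) ≡ length ys
  length-partition P? [] = ≡.refl
  length-partition P? (y ∷ ys) with P? y
  ... | yes _ = ≡.trans (+-suc _ _) (cong suc (length-partition P? ys))
  ... | no  _ = cong suc (length-partition P? ys)

  module _ {A : Set} {n : ℕ} (f : A → Fin n) where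

    fibre : Fin n → List A → List A
    fibre j = filter (λ a → f a FinP.≟ j)

    count : Fin n → List A → ℕ
    count j xs = length (fibre j xs)

    count-++ : ∀ j xs ys → count j (xs ++ ys) ≡ count j xs + count j ys
    count-++ j xs ys = ≡.trans (cong length (filter-++ (λ a → f a FinP.≟ j) xs ys)) (length-++ (fibre j xs))

    count-self : ∀ {a xs} → a ∈ xs → 1 ≤ count (f a) xs
    count-self {a} {x ∷ xs} (here ≡.refl) = subst (λ l → 1 ≤ length l) (sym (filter-accept (λ b → f b FinP.≟ f a) {a} {xs} ≡.refl)) (s≤s z≤n)
    count-self {a} {x ∷ xs} (there a∈) = ≤-trans (count-self a∈)
      (≤-trans (m≤n+m (count (f a) xs) (count (f a) (x ∷ []))) (≤-reflexive (sym (count-++ (f a) (x ∷ []) xs))))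

    length≤sum-count : ∀ xs → length xs ≤ sum (λ j → count j xs)
    length≤sum-count [] = z≤n
    length≤sum-count (x ∷ xs) = ≤-trans (s≤s (length≤sum-count xs)) (sum-mono-< (λ j → count j xs) (λ j → count j (x ∷ xs))
      (λ j → ≤-trans (m≤n+m (count j xs) (count j (x ∷ []))) (≤-reflexive (sym (count-++ j (x ∷ []) xs))))
      (f x) (≤-trans (+-monoˡ-≤ (count (f x) xs) (count-self {x} {x ∷ []} (here ≡.refl))) (≤-reflexive (sym (count-++ (f x) (x ∷ []) xs)))))

    length≤fibres : ∀ xs k → (∀ j → count j xs ≤ k) → length xs ≤ n * k
    length≤fibres xs k h = ≤-trans (length≤sum-count xs) (sum-≤ (λ j → count j xs) k h)

    count-filter : ∀ {P : A → Set} (P? : ∀ a → Dec (P a)) j ys → count j (filter P? ys) ≤ count j ys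
    count-filter P? j [] = z≤n
    count-filter P? j (y ∷ ys) with P? y
    ... | no  _ = ≤-trans (count-filter P? j ys) (≤-trans (m≤n+m (count j ys) (count j (y ∷ []))) (≤-reflexive (sym (count-++ j (y ∷ []) ys))))
    ... | yes _ = ≤-trans (≤-reflexive (count-++ j (y ∷ []) (filter P? ys)))
      (≤-trans (+-monoʳ-≤ (count j (y ∷ [])) (count-filter P? j ys)) (≤-reflexive (sym (count-++ j (y ∷ []) ys))))

    heavy? : ∀ k xs a → Dec (k < count (f a) xs)
    heavy? k xs a = k <? count (f a) xs

    length-heavy : ∀ k xs → length xs ≤ n * k + length (filter (heavy? k xs) xs)
    length-heavy k xs = ≤-trans (≤-reflexive (sym (length-partition (heavy? k xs) xs)))
      (+-monoˡ-≤ (length (filter (heavy? k xs) xs)) (length≤fibres light k light-fibre))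
      where
      light : List A
      light = filter (λ a → ¬? (heavy? k xs a)) xs
      light-fibre : ∀ j → count j light ≤ k
      light-fibre j with fibre j light in eq
      ... | [] = z≤n
      -- A nonempty fibre has a member `a` with value `j`, and `a` being light bounds the count of
      -- `j` in all of `xs`.
      ... | a ∷ as with ∈-filter⁻ (λ b → f b FinP.≟ j) {a} {light} (subst (a ∈_) (sym eq) (here ≡.refl))
      ... | a∈ , ≡.refl = ≤-trans (≤-reflexive (cong length (sym eq))) (≤-trans (count-filter (λ b → ¬? (heavy? k xs b)) j xs)
            (≮⇒≥ (proj₂ (∈-filter⁻ (λ b → ¬? (heavy? k xs b)) {a} {xs} a∈))))

    -- Counts capped at `c`: the total is bounded by `n * c` however long the list, yet it grows
    -- strictly whenever a value still short of `c` gains a member.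
    potential : ℕ → List A → ℕ
    potential c xs = sum (λ j → c ⊓ count j xs)

    potential≤ : ∀ c xs → potential c xs ≤ n * c
    potential≤ c xs = sum-≤ (λ j → c ⊓ count j xs) c (λ j → m⊓n≤m c (count j xs))

    module _ (c : ℕ) (xs ys zs : List A) (zs≡ : ∀ j → count j zs ≡ count j xs + count j ys) where

      private
        mono : ∀ j → c ⊓ count j xs ≤ c ⊓ count j zs
        mono j = ⊓-monoʳ-≤ c (≤-trans (m≤m+n (count j xs) (count j ys)) (≤-reflexive (sym (zs≡ j))))

      potential-mono : potential c xs ≤ potential c zs
      potential-mono = sum-mono (λ j → c ⊓ count j xs) (λ j → c ⊓ count j zs) mono

      potential-mono-< : ∀ {a} → a ∈ ys → count (f a) xs < c → potential c xs < potential c zs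
      potential-mono-< {a} a∈ few = sum-mono-< (λ j → c ⊓ count j xs) (λ j → c ⊓ count j zs) mono (f a)
        (≤-trans (s≤s (m⊓n≤n c (count (f a) xs))) (⊓-glb few
          (≤-trans (≤-reflexive (+-comm 1 (count (f a) xs)))
          (≤-trans (+-monoʳ-≤ (count (f a) xs) (count-self a∈)) (≤-reflexive (sym (zs≡ (f a))))))))

    occurrence : ∀ j xs → 1 ≤ count j xs → ∃ λ a → a ∈ xs × f a ≡ j
    occurrence j xs h with fibre j xs in eq
    ... | a ∷ _ = a , ∈-filter⁻ (λ b → f b FinP.≟ j) {a} {xs} (subst (a ∈_) (sym eq) (here ≡.refl))

    three-occurrences : ∀ {P : A → A → Set} j xs → AllPairs P xs → 3 ≤ count j xs →
      ∃ λ a → ∃ λ b → ∃ λ c → (a ∈ xs × f a ≡ j) × (b ∈ xs × f b ≡ j) × (c ∈ xs × f c ≡ j) × P a b × P a c × P b c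
    three-occurrences {P} j xs pairs h with fibre j xs in eq
    three-occurrences {P} j xs pairs (s≤s ()) | _ ∷ []
    three-occurrences {P} j xs pairs (s≤s (s≤s ())) | _ ∷ _ ∷ []
    ... | a ∷ b ∷ c ∷ as with subst (AllPairs P) eq (AllPairs.filter⁺ (λ b → f b FinP.≟ j) pairs)
    ... | (pab ∷ pac ∷ _) ∷ (pbc ∷ _) ∷ _ = a , b , c , in-fibre (here ≡.refl) , in-fibre (there (here ≡.refl)) ,
          in-fibre (there (there (here ≡.refl))) , pab , pac , pbc
      where
      in-fibre : ∀ {d} → d ∈ a ∷ b ∷ c ∷ as → d ∈ xs × f d ≡ j
      in-fibre {d} d∈ = ∈-filter⁻ (λ b → f b FinP.≟ j) {d} {xs} (subst (d ∈_) (sym eq) d∈)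

  AllPairs-cross : ∀ {A : Set} {R : A → A → Set} xs {ys} → AllPairs R (xs ++ ys) → ∀ {a b} → a ∈ xs → b ∈ ys → R a b
  AllPairs-cross (x ∷ xs) (Rx ∷ Rs) (here ≡.refl) b∈ = All.lookup Rx (∈-++⁺ʳ xs b∈)
  AllPairs-cross (x ∷ xs) (Rx ∷ Rs) (there a∈)    b∈ = AllPairs-cross xs Rs a∈ b∈

  AllPairs-++ʳ : ∀ {A : Set} {R : A → A → Set} xs {ys} → AllPairs R (xs ++ ys) → AllPairs R ys
  AllPairs-++ʳ []       Rs        = Rs
  AllPairs-++ʳ (x ∷ xs) (_ ∷ Rs) = AllPairs-++ʳ xs Rs

  AllPairs-++ˡ : ∀ {A : Set} {R : A → A → Set} xs {ys} → AllPairs R (xs ++ ys) → AllPairs R xs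
  AllPairs-++ˡ []       Rs        = []
  AllPairs-++ˡ (x ∷ xs) (Rx ∷ Rs) = All.tabulate (λ b∈ → All.lookup Rx (∈-++⁺ˡ b∈)) ∷ AllPairs-++ˡ xs Rs

  -- `f` is the end whose three values are to differ and `g` the opposite end. The values `p` and
  -- `q` stand for the opposite ends of two sides already found to cross, so `late` supplies a third
  -- side disjoint from both.
  record Columns {A B C : Set} (R : A → A → Set) (f : A → B) (g : A → C) (xs : List A) : Set where
    field
      middle  : Fin 3 → A
      middle∈ : ∀ i → middle i ∈ xs
      distinct-middle : ∀ i j → i ≢ j → f (middle i) ≢ f (middle j)
      early   : ∀ i → ∃ λ a → a ∈ xs × f a ≡ f (middle i) × ∀ j → R a (middle j)
      late    : ∀ i p q → ∃ λ a → a ∈ xs × f a ≡ f (middle i) × g a ≢ p × g a ≢ q × ∀ j → R (middle j) a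

  data Three {A B : Set} (f : A → B) (xs : List A) : Set where
    three : ∀ {a b c} → a ∈ xs → b ∈ xs → c ∈ xs → f a ≢ f b → f a ≢ f c → f b ≢ f c → Three f xs

  module _ {A : Set} {n : ℕ} (l r : A → Fin n) where

    Differ : A → A → Set
    Differ a b = ¬ (l a ≡ l b × r a ≡ r b)

    -- Members with equal `r` must differ in `l`, as no two members agree in both.
    three-same : ∀ {P : A → Set} (P? : ∀ a → Dec (P a)) xs → AllPairs Differ xs → (∀ a b → P a → P b → r a ≡ r b) →
                 3 ≤ length (filter P? xs) → Three l xs
    three-same {P} P? xs pairs same h with filter P? xs in eq
    three-same {P} P? xs pairs same (s≤s ()) | _ ∷ []
    three-same {P} P? xs pairs same (s≤s (s≤s ())) | _ ∷ _ ∷ []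
    ... | a ∷ b ∷ c ∷ as with subst (AllPairs Differ) eq (AllPairs.filter⁺ P? pairs)
    ... | (dab ∷ dac ∷ _) ∷ (dbc ∷ _) ∷ _ =
      three (proj₁ (member (here ≡.refl))) (proj₁ (member (there (here ≡.refl)))) (proj₁ (member (there (there (here ≡.refl)))))
        (λ e → dab (e , same _ _ (proj₂ (member (here ≡.refl))) (proj₂ (member (there (here ≡.refl))))))
        (λ e → dac (e , same _ _ (proj₂ (member (here ≡.refl))) (proj₂ (member (there (there (here ≡.refl)))))))
        (λ e → dbc (e , same _ _ (proj₂ (member (there (here ≡.refl)))) (proj₂ (member (there (there (here ≡.refl)))))))
      where
      member : ∀ {d} → d ∈ a ∷ b ∷ c ∷ as → d ∈ xs × P d
      member {d} d∈ = ∈-filter⁻ P? {d} {xs} (subst (d ∈_) (sym eq) d∈)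

    length-rest : ∀ {P : A → Set} (P? : ∀ a → Dec (P a)) k xs → k + 2 ≤ length xs → length (filter P? xs) ≤ 2 →
                  k ≤ length (filter (λ a → ¬? (P? a)) xs)
    length-rest P? k xs h few = +-cancelʳ-≤ 2 k (length (filter (λ a → ¬? (P? a)) xs))
      (≤-trans h (≤-trans (≤-reflexive (sym (length-partition P? xs))) (+-monoʳ-≤ (length (filter (λ a → ¬? (P? a)) xs)) few)))

    -- If no value of `r` occurs three times, dropping the value of the first member removes at most
    -- two of the five, and dropping that of the next survivor at most two more; what is left has a
    -- third value. This is where 5 = 2 + 2 + 1 comes from.
    three-distinct : ∀ xs → AllPairs Differ xs → length xs ≡ 5 → Three r xs ⊎ Three l xs
    three-distinct xs@(a ∷ _) pairs len with 3 ≤? length (filter (λ b → r b FinP.≟ r a) xs)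
    ... | yes many = inj₂ (three-same (λ b → r b FinP.≟ r a) xs pairs (λ b c e e′ → ≡.trans e (sym e′)) many)
    ... | no few with filter (λ b → ¬? (r b FinP.≟ r a)) xs in eq
                    | length-rest (λ b → r b FinP.≟ r a) 3 xs (≤-reflexive (sym len)) (≤-pred (≰⇒> few))
    ... | ys@(b ∷ bs) | len-ys with 3 ≤? length (filter (λ c → r c FinP.≟ r b) ys)
    ... | yes many = inj₂ (widen (three-same (λ c → r c FinP.≟ r b) ys
              (subst (AllPairs Differ) eq (AllPairs.filter⁺ (λ b → ¬? (r b FinP.≟ r a)) pairs)) (λ c d e e′ → ≡.trans e (sym e′)) many))
      where
      widen : Three l ys → Three l xs
      widen (three p q s d e f) = three (sub p) (sub q) (sub s) d e f
        where
        sub : ∀ {c} → c ∈ ys → c ∈ xs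
        sub {c} c∈ = proj₁ (∈-filter⁻ (λ b → ¬? (r b FinP.≟ r a)) {c} {xs} (subst (c ∈_) (sym eq) c∈))
    ... | no few′ with filter (λ c → ¬? (r c FinP.≟ r b)) ys in eq′
                     | length-rest (λ c → r c FinP.≟ r b) 1 ys len-ys (≤-pred (≰⇒> few′))
    ... | c ∷ _ | _ = inj₁ (three (here ≡.refl) (proj₁ b∈) (proj₁ (member (proj₁ c∈)))
            (≢-sym (proj₂ b∈)) (≢-sym (proj₂ (member (proj₁ c∈)))) (≢-sym (proj₂ c∈)))
      where
      member : ∀ {c} → c ∈ ys → c ∈ xs × r c ≢ r a
      member {c} c∈ = ∈-filter⁻ (λ b → ¬? (r b FinP.≟ r a)) {c} {xs} (subst (c ∈_) (sym eq) c∈)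
      b∈ : b ∈ xs × r b ≢ r a
      b∈ = member (here ≡.refl)
      c∈ : c ∈ ys × r c ≢ r b
      c∈ = ∈-filter⁻ (λ c → ¬? (r c FinP.≟ r b)) {c} {ys} (subst (c ∈_) (sym eq′) (here ≡.refl))

    -- One earlier occurrence gives `early`; three later ones give `late`, where two may be ruled
    -- out. Both ends are tested because it is not known yet which of them will take three values on
    -- the block.
    Scarce : List A → List A → A → Set
    Scarce pre post a = (count l (l a) pre < 1 ⊎ count r (r a) pre < 1) ⊎ (count l (l a) post < 3 ⊎ count r (r a) post < 3)

    scarce? : ∀ pre post a → Dec (Scarce pre post a)
    scarce? pre post a = ((count l (l a) pre <? 1) ⊎-dec (count r (r a) pre <? 1)) ⊎-dec
                         ((count l (l a) post <? 3) ⊎-dec (count r (r a) post <? 3))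

    Split : List A → Set
    Split xs = ∃ λ pre → ∃ λ block → ∃ λ post → xs ≡ pre ++ (block ++ post) × length block ≡ 5 ×
               ¬ Any (Scarce pre post) block

    -- Passing a block with a scarce member raises the potential of the prefix
    -- or lowers that of the suffix, which can happen only boundedly often.
    scan : ∀ k pre rest → k * 5 ≤ length rest → Split (pre ++ rest) ⊎
           (k + (potential l 1 pre + potential r 1 pre) ≤ (n * 1 + n * 1) + (potential l 3 rest + potential r 3 rest))
    scan zero pre rest _ = inj₂ (≤-trans (+-mono-≤ (potential≤ l 1 pre) (potential≤ r 1 pre)) (m≤m+n _ _))
    scan (suc k) pre rest h with any? (scarce? pre (drop 5 rest)) (take 5 rest)
    ... | no ¬scarce = inj₁ (pre , take 5 rest , drop 5 rest , cong (pre ++_) (sym (take++drop≡id 5 rest)) ,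
            ≡.trans (length-take 5 rest) (m≤n⇒m⊓n≡m (≤-trans (m≤m+n 5 (k * 5)) h)) , ¬scarce)
    ... | yes scarce with scan k (pre ++ take 5 rest) (drop 5 rest)
            (≤-trans (≤-reflexive (sym (m+n∸m≡n 5 (k * 5)))) (≤-trans (∸-monoˡ-≤ 5 h) (≤-reflexive (sym (length-drop 5 rest)))))
    ... | inj₁ s = inj₁ (subst Split (≡.trans (++-assoc pre (take 5 rest) (drop 5 rest)) (cong (pre ++_) (take++drop≡id 5 rest))) s)
    ... | inj₂ ih = inj₂ (arith k (n * 1 + n * 1) ih (strict (find scarce)))
      where
      block = take 5 rest
      post = drop 5 rest
      pre+ : ∀ (f : A → Fin n) j → count f j (pre ++ block) ≡ count f j pre + count f j block
      pre+ f j = count-++ f j pre block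
      post+ : ∀ (f : A → Fin n) j → count f j rest ≡ count f j post + count f j block
      post+ f j = ≡.trans (cong (count f j) (sym (take++drop≡id 5 rest))) (≡.trans (count-++ f j block post) (+-comm (count f j block) (count f j post)))
      pl≤ : potential l 1 pre ≤ potential l 1 (pre ++ block)
      pl≤ = potential-mono l 1 pre block (pre ++ block) (pre+ l)
      pr≤ : potential r 1 pre ≤ potential r 1 (pre ++ block)
      pr≤ = potential-mono r 1 pre block (pre ++ block) (pre+ r)
      sl≤ : potential l 3 post ≤ potential l 3 rest
      sl≤ = potential-mono l 3 post block rest (post+ l)
      sr≤ : potential r 3 post ≤ potential r 3 rest
      sr≤ = potential-mono r 3 post block rest (post+ r)
      strict : (∃ λ a → a ∈ block × Scarce pre post a) →
        (potential l 1 pre + potential r 1 pre) + (potential l 3 post + potential r 3 post) <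
        (potential l 1 (pre ++ block) + potential r 1 (pre ++ block)) + (potential l 3 rest + potential r 3 rest)
      strict (a , a∈ , inj₁ (inj₁ few)) = +-mono-<-≤ (+-mono-<-≤ (potential-mono-< l 1 pre block (pre ++ block) (pre+ l) a∈ few) pr≤) (+-mono-≤ sl≤ sr≤)
      strict (a , a∈ , inj₁ (inj₂ few)) = +-mono-<-≤ (+-mono-≤-< pl≤ (potential-mono-< r 1 pre block (pre ++ block) (pre+ r) a∈ few)) (+-mono-≤ sl≤ sr≤)
      strict (a , a∈ , inj₂ (inj₁ few)) = +-mono-≤-< (+-mono-≤ pl≤ pr≤) (+-mono-<-≤ (potential-mono-< l 3 post block rest (post+ l) a∈ few) sr≤)
      strict (a , a∈ , inj₂ (inj₂ few)) = +-mono-≤-< (+-mono-≤ pl≤ pr≤) (+-mono-≤-< sl≤ (potential-mono-< r 3 post block rest (post+ r) a∈ few))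
      arith : ∀ k N {p p′ s s′} → k + p′ ≤ N + s → p + s < p′ + s′ → suc k + p ≤ N + s′
      arith k N {p} {p′} {s} {s′} ih< st = +-cancelʳ-≤ s (suc k + p) (N + s′) (begin
        suc k + p + s       ≡⟨ lem k p s ⟩
        k + suc (p + s)     ≤⟨ +-monoʳ-≤ k st ⟩
        k + (p′ + s′)       ≡⟨ +-assoc k p′ s′ ⟨
        k + p′ + s′         ≤⟨ +-monoˡ-≤ s′ ih< ⟩
        N + s + s′          ≡⟨ lem₁ N s s′ ⟩
        N + s′ + s          ∎)
        where
        open ≤-Reasoning
        lem : ∀ k p s → suc k + p + s ≡ k + suc (p + s)
        lem = solve-∀
        lem₁ : ∀ a b c → a + b + c ≡ a + c + b
        lem₁ = solve-∀

    -- The capped counts total at most n + n before the block and 3n + 3n after it. Each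
    -- unsuccessful block uses up at least one of these 8n units, so `8 * n + 1` blocks cannot all
    -- fail.
    split : ∀ xs → (8 * n + 1) * 5 ≤ length xs → Split xs
    split xs h with scan (8 * n + 1) [] xs h
    ... | inj₁ s = s
    ... | inj₂ bound = ⊥-elim (<⇒≱ (subst (_< 8 * n + 1) (lem n) (≤-reflexive (+-comm 1 (8 * n))))
            (≤-trans (m≤m+n _ _) (≤-trans bound (+-monoʳ-≤ (n * 1 + n * 1) (+-mono-≤ (potential≤ l 3 xs) (potential≤ r 3 xs))))))
      where
      lem : ∀ n → 8 * n ≡ (n * 1 + n * 1) + (n * 3 + n * 3)
      lem = solve-∀

  module _ {A : Set} {n : ℕ} (R : A → A → Set) (f g : A → Fin n) (pre block post : List A)
           (sorted : AllPairs R (pre ++ (block ++ post))) (pairs : AllPairs (Differ f g) (pre ++ (block ++ post)))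
           (early≥ : ∀ {a} → a ∈ block → 1 ≤ count f (f a) pre) (late≥ : ∀ {a} → a ∈ block → 3 ≤ count f (f a) post) where

    columns : Three f block → Columns R f g (pre ++ (block ++ post))
    columns (three {a} {b} {c} a∈ b∈ c∈ ab ac bc) = record
      { middle = middle
      ; middle∈ = λ i → ∈-++⁺ʳ pre (∈-++⁺ˡ (middle∈ i))
      ; distinct-middle = distinct-middle
      ; early = early
      ; late = late
      }
      where
      middle : Fin 3 → A
      middle zero             = a
      middle (suc zero)       = b
      middle (suc (suc zero)) = c
      middle∈ : ∀ i → middle i ∈ block
      middle∈ zero             = a∈
      middle∈ (suc zero)       = b∈
      middle∈ (suc (suc zero)) = c∈
      distinct-middle : ∀ i j → i ≢ j → f (middle i) ≢ f (middle j)
      distinct-middle zero             zero             i≢j = ⊥-elim (i≢j ≡.refl)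
      distinct-middle zero             (suc zero)       i≢j = ab
      distinct-middle zero             (suc (suc zero)) i≢j = ac
      distinct-middle (suc zero)       zero             i≢j = ≢-sym ab
      distinct-middle (suc zero)       (suc zero)       i≢j = ⊥-elim (i≢j ≡.refl)
      distinct-middle (suc zero)       (suc (suc zero)) i≢j = bc
      distinct-middle (suc (suc zero)) zero             i≢j = ≢-sym ac
      distinct-middle (suc (suc zero)) (suc zero)       i≢j = ≢-sym bc
      distinct-middle (suc (suc zero)) (suc (suc zero)) i≢j = ⊥-elim (i≢j ≡.refl)
      early : ∀ i → ∃ λ d → d ∈ pre ++ (block ++ post) × f d ≡ f (middle i) × ∀ j → R d (middle j)
      early i with occurrence f (f (middle i)) pre (early≥ (middle∈ i))
      ... | d , d∈ , e = d , ∈-++⁺ˡ d∈ , e , λ j → AllPairs-cross pre sorted d∈ (∈-++⁺ˡ (middle∈ j))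
      late : ∀ i p q → ∃ λ d → d ∈ pre ++ (block ++ post) × f d ≡ f (middle i) × g d ≢ p × g d ≢ q × ∀ j → R (middle j) d
      late i p q with three-occurrences f (f (middle i)) post (AllPairs-++ʳ block (AllPairs-++ʳ pre pairs)) (late≥ (middle∈ i))
      ... | d₁ , d₂ , d₃ , (m₁ , e₁) , (m₂ , e₂) , (m₃ , e₃) , d₁₂ , d₁₃ , d₂₃ = choose
        where
        found : ∀ {d} → d ∈ post → f d ≡ f (middle i) → g d ≢ p → g d ≢ q →
                ∃ λ d → d ∈ pre ++ (block ++ post) × f d ≡ f (middle i) × g d ≢ p × g d ≢ q × ∀ j → R (middle j) d
        found {d} d∈ e np nq = d , ∈-++⁺ʳ pre (∈-++⁺ʳ block d∈) , e , np , nq ,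
          λ j → AllPairs-cross block (AllPairs-++ʳ pre sorted) (middle∈ j) d∈
        g₁₂ : g d₁ ≢ g d₂
        g₁₂ e = d₁₂ (≡.trans e₁ (sym e₂) , e)
        g₁₃ : g d₁ ≢ g d₃
        g₁₃ e = d₁₃ (≡.trans e₁ (sym e₃) , e)
        g₂₃ : g d₂ ≢ g d₃
        g₂₃ e = d₂₃ (≡.trans e₂ (sym e₃) , e)
        choose : ∃ λ d → d ∈ pre ++ (block ++ post) × f d ≡ f (middle i) × g d ≢ p × g d ≢ q × ∀ j → R (middle j) d
        -- The three candidates share `f`, so their `g` values differ. If the first two are both
        -- excluded, they account for `p` and `q`, and the third is free.
        choose with g d₁ FinP.≟ p | g d₁ FinP.≟ q | g d₂ FinP.≟ p | g d₂ FinP.≟ q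
        ... | no a  | no b  | _     | _     = found m₁ e₁ a b
        ... | _     | _     | no a  | no b  = found m₂ e₂ a b
        ... | yes a | _     | yes b | _     = ⊥-elim (g₁₂ (≡.trans a (sym b)))
        ... | _     | yes a | _     | yes b = ⊥-elim (g₁₂ (≡.trans a (sym b)))
        ... | yes a | _     | _     | yes b = found m₃ e₃ (λ c → g₁₃ (≡.trans a (sym c))) (λ c → g₂₃ (≡.trans b (sym c)))
        ... | _     | yes a | yes b | _     = found m₃ e₃ (λ c → g₂₃ (≡.trans b (sym c))) (λ c → g₁₃ (≡.trans a (sym c)))

  -- The roles of `f` and `g` go to whichever end takes three values on the block; the second
  -- alternative is the mirror image of the first.
  columns-exist : ∀ {A : Set} {n} (R : A → A → Set) (l r : A → Fin n) xs → AllPairs R xs → AllPairs (Differ l r) xs →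
    (8 * n + 1) * 5 ≤ length xs → Columns R r l xs ⊎ Columns R l r xs
  columns-exist R l r xs sorted pairs h with split l r xs h
  ... | pre , block , post , ≡.refl , len , ¬scarce with three-distinct l r block (AllPairs-++ˡ block (AllPairs-++ʳ pre pairs)) len
  ... | inj₁ t = inj₁ (columns R r l pre block post sorted (AllPairs.map (λ d (e , e′) → d (e′ , e)) pairs)
          (λ a∈ → ≮⇒≥ (λ few → ¬scarce (lose a∈ (inj₁ (inj₂ few))))) (λ a∈ → ≮⇒≥ (λ few → ¬scarce (lose a∈ (inj₂ (inj₂ few))))) t)
  ... | inj₂ t = inj₂ (columns R l r pre block post sorted pairs
          (λ a∈ → ≮⇒≥ (λ few → ¬scarce (lose a∈ (inj₁ (inj₁ few))))) (λ a∈ → ≮⇒≥ (λ few → ¬scarce (lose a∈ (inj₂ (inj₁ few))))) t)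

-- Sides above a vertex at the origin, and three disjoint edges through one point.

module Links where

  open import Defs hiding (_≈_; split)
  open RealArithmetic
  open Hulls
  open HalfPlane
  open import Data.Nat.Base as ℕ using (ℕ)
  import Data.Nat.Properties as ℕP
  open import Data.Rational.Base using (0ℚ; 1ℚ; _+_; _*_; _-_; -_)
  open import Data.Rational.Properties using (+-comm; *-comm)
  open import Data.Fin.Base using (Fin)
  open import Data.Fin.Properties using (_≟_)
  open import Data.Fin.Subset as Subset using (Subset)
  import Data.Fin.Subset.Properties as SubsetP
  open import Data.List.Base using (List; []; _∷_; length)
  open import Data.List.Membership.Propositional using (_∈_; _∉_)
  open import Data.List.Relation.Unary.Any using (here; there)
  open import Data.Product using (∃; _×_; _,_; proj₁; proj₂)
  open import Data.Sum using (_⊎_; inj₁; inj₂)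
  open import Data.Empty using (⊥)
  open import Relation.Nullary using (¬_; yes; no)
  open import Relation.Binary.PropositionalEquality
  open import Tactic.RingSolver using (solve-∀)

  Spans : ∀ {n} → Subset n → Fin n → Fin n → Fin n → Set
  Spans e i j k = (i Subset.∈ e × j Subset.∈ e × k Subset.∈ e) × (∀ v → v Subset.∈ e → v ≡ i ⊎ v ≡ j ⊎ v ≡ k)

  NoThreeOnALine : ∀ {n} → (Fin n → Point) → Set
  NoThreeOnALine v = ∀ i j k → i ≢ j → j ≢ k → i ≢ k → ∀ a b c → ¬ (a ≅ 0ℝ × b ≅ 0ℝ) →
    a *ℝ proj₁ (v i) +ℝ b *ℝ proj₂ (v i) ≅ c → a *ℝ proj₁ (v j) +ℝ b *ℝ proj₂ (v j) ≅ c →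
    a *ℝ proj₁ (v k) +ℝ b *ℝ proj₂ (v k) ≅ c → ⊥

  NoThreeCrossing : ∀ {n} → (Fin n → Point) → List (Subset n) → Set
  NoThreeCrossing v E = ∀ {a b c} → a ∈ E → b ∈ E → c ∈ E →
    Subset.Empty (a Subset.∩ b) → Subset.Empty (a Subset.∩ c) → Subset.Empty (b Subset.∩ c) →
    ∀ P → Hull v a P → Hull v b P → Hull v c P → ⊥

  -- Extending two sides to disjoint edges has to avoid six vertices at the second step.
  Heavy : ∀ {n} → List (Subset n) → Fin n → Fin n → Set
  Heavy {n} E l r = ∀ (avoid : List (Fin n)) → length avoid ℕ.≤ 6 →
    ∃ λ w → w ∉ avoid × ∃ λ e → e ∈ E × Spans e l w r

  spans-disjoint : ∀ {n} {e f : Subset n} {i j k i′ j′ k′} → Spans e i j k → Spans f i′ j′ k′ →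
    i ∉ i′ ∷ j′ ∷ k′ ∷ [] → j ∉ i′ ∷ j′ ∷ k′ ∷ [] → k ∉ i′ ∷ j′ ∷ k′ ∷ [] → Subset.Empty (e Subset.∩ f)
  spans-disjoint {e = e} {f} (_ , cov) (_ , cov′) i∉ j∉ k∉ (v , v∈) with SubsetP.x∈p∩q⁻ e f v∈
  ... | v∈e , v∈f with cov v v∈e | listed
    where
    listed : v ∈ _ ∷ _ ∷ _ ∷ []
    listed with cov′ v v∈f
    ... | inj₁ refl        = here refl
    ... | inj₂ (inj₁ refl) = there (here refl)
    ... | inj₂ (inj₂ refl) = there (there (here refl))
  ... | inj₁ refl        | l = i∉ l
  ... | inj₂ (inj₁ refl) | l = j∉ l
  ... | inj₂ (inj₂ refl) | l = k∉ l

  ∉₃ : ∀ {n} {i a b c : Fin n} → i ≢ a → i ≢ b → i ≢ c → i ∉ a ∷ b ∷ c ∷ []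
  ∉₃ a b c (here i≡a)                 = a i≡a
  ∉₃ a b c (there (here i≡b))         = b i≡b
  ∉₃ a b c (there (there (here i≡c))) = c i≡c

  -- The link of a vertex m, placed at the origin: its edges {l , m , r} whose
  -- side lr crosses the upward ray, at the given height.
  module LinkOf {n} (v : Fin n → Point) (E : List (Subset n)) (m : Fin n)
           (xm : proj₁ (v m) ≅ 0ℝ) (ym : proj₂ (v m) ≅ 0ℝ)
           (generic : NoThreeOnALine v) (free : NoThreeCrossing v E) where

    private
      x y : Fin n → ℝ
      x i = proj₁ (v i)
      y i = proj₂ (v i)

    -- `height-eq` is the formula for the intercept of the line through `l` and `r` on the vertical
    -- axis, with the denominator cleared.
    record Link (l r : Fin n) : Set where
      field
        l<0       : Pos (-ℝ x l)
        r>0       : Pos (x r)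
        height    : ℝ
        height>0  : Pos height
        height-eq : height *ℝ (x r -ℝ x l) ≅ x r *ℝ y l -ℝ x l *ℝ y r
        edge      : Subset n
        edge∈     : edge ∈ E
        spans     : Spans edge l m r
        heavy     : Heavy E l r
    open Link

    half-of : ∀ {l r} → Link l r → Half
    half-of {l} {r} L = record { x = x r ; y = y r ; h = height L ; x>0 = r>0 L ; h>0 = height>0 L }

    -- The foot divides the side with weights proportional to `x r` at `l` and `-ℝ x l` at `r`; the
    -- third point only pads the combination with weight 0.
    foot-hull : ∀ {l r} (L : Link l r) {s} → l Subset.∈ s → r Subset.∈ s → Hull v s (foot (half-of L))
    foot-hull {l} {r} L {s} l∈s r∈s = let (w , w>0 , inv) = inverse (x r -ℝ x l) (width>0) in
      hull-resp v s
        (termwise (λ k → e₁ (seq (x l) k) (seq (x r) k) (seq w k)))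
        (modulo (-ℝ w) (≅⇒≅0 (height-eq L)) (modulo (height L) (≅⇒≅0 inv)
          (termwise (λ k → e₂ (seq (x l) k) (seq (x r) k) (seq w k) (seq (y l) k) (seq (y r) k) (seq (height L) k)))))
        (hull-convex v s (hull-vertex v s l l∈s) (hull-vertex v s r r∈s) (hull-vertex v s r r∈s)
          (NonNeg-* (Pos⇒NonNeg (r>0 L)) (Pos⇒NonNeg w>0)) (NonNeg-* (Pos⇒NonNeg (l<0 L)) (Pos⇒NonNeg w>0)) (≅0⇒NonNeg ≅-refl)
          (≅-trans (termwise (λ k → e₃ (seq (x l) k) (seq (x r) k) (seq w k))) inv))
      where
      width>0 : Pos (x r -ℝ x l)
      width>0 = Pos-+ (r>0 L) (Pos⇒NonNeg (l<0 L))
      e₁ : ∀ a b w → ((b * w) * a + (- a * w) * b) + 0ℚ * b ≡ 0ℚ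
      e₁ = solve-∀ ℚ-ring
      e₂ : ∀ a b w p q h → ((b * w) * p + (- a * w) * q) + 0ℚ * q
           ≡ (h + (- w) * (h * (b - a) - (b * p - a * q))) + h * ((b - a) * w - 1ℚ)
      e₂ = solve-∀ ℚ-ring
      e₃ : ∀ a b w → (b * w + (- a) * w) + 0ℚ ≡ (b - a) * w
      e₃ = solve-∀ ℚ-ring

    module _ {l r} (L : Link l r) {P : Point} {s : Subset n} (l∈s : l Subset.∈ s) (r∈s : r Subset.∈ s) where
      private
        w z X Y X′ Y′ H : ℝ
        w = proj₁ (inverse (x r) (r>0 L))
        z = proj₁ (inverse (height L) (height>0 L))
        X = proj₁ P
        Y = proj₂ P
        X′ = x r
        Y′ = y r
        H = height L
        w≥0 : NonNeg w
        w≥0 = Pos⇒NonNeg (proj₁ (proj₂ (inverse (x r) (r>0 L))))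
        z≥0 : NonNeg z
        z≥0 = Pos⇒NonNeg (proj₁ (proj₂ (inverse (height L) (height>0 L))))
        w-inv : x r *ℝ w ≅ 1ℝ
        w-inv = proj₂ (proj₂ (inverse (x r) (r>0 L)))
        z-inv : height L *ℝ z ≅ 1ℝ
        z-inv = proj₂ (proj₂ (inverse (height L) (height>0 L)))
        -- P = α 0 + β (foot) + γ (tip)
        α β γ : ℝ
        α = (-ℝ line (half-of L) P) *ℝ (w *ℝ z)
        β = sweep (half-of L) P *ℝ (w *ℝ z)
        γ = X *ℝ w
        lemX : ∀ β X′ X w → (0ℚ + β * 0ℚ) + (X * w) * X′ ≡ X + X * (X′ * w - 1ℚ)
        lemX = solve-∀ ℚ-ring
        lemY : ∀ X Y X′ Y′ w z H → (0ℚ + ((X′ * Y - Y′ * X) * (w * z)) * H) + (X * w) * Y′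
          ≡ (Y + Y * (X′ * w - 1ℚ)) + ((X′ * Y - Y′ * X) * w) * (H * z - 1ℚ)
        lemY = solve-∀ ℚ-ring
        lem1 : ∀ X Y X′ Y′ w z H → ((- ((X′ * Y - X * (Y′ - H)) - H * X′)) * (w * z) + (X′ * Y - Y′ * X) * (w * z)) + X * w
          ≡ (1ℚ + 1ℚ * (X′ * w - 1ℚ)) + (X′ * w - X * w) * (H * z - 1ℚ)
        lem1 = solve-∀ ℚ-ring

        total-weight : (α +ℝ β) +ℝ γ ≅ 1ℝ
        total-weight = modulo 1ℝ (≅⇒≅0 w-inv) (modulo (X′ *ℝ w -ℝ X *ℝ w) (≅⇒≅0 z-inv)
          (termwise (λ k → lem1 (seq X k) (seq Y k) (seq X′ k) (seq Y′ k) (seq w k) (seq z k) (seq H k))))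

        -- The point `(A , B)` carries the weight `α`. It may be the origin, or any point of the
        -- hull when `α` vanishes; the second case serves edges that do not contain `m`.
        at-origin : ∀ {A B} → α *ℝ A ≅ 0ℝ → α *ℝ B ≅ 0ℝ → NonNeg α → NonNeg β → NonNeg γ → Hull v s (A , B) → Hull v s P
        at-origin {A} {B} αA≅0 αB≅0 α≥0 β≥0 γ≥0 hull = hull-resp v s
          (≅-trans (+-cong (+-cong αA≅0 ≅-refl) ≅-refl)
            (modulo X (≅⇒≅0 w-inv) (termwise (λ k → lemX (seq β k) (seq X′ k) (seq X k) (seq w k)))))
          (≅-trans (+-cong (+-cong αB≅0 ≅-refl) ≅-refl)
            (modulo Y (≅⇒≅0 w-inv) (modulo (sweep (half-of L) P *ℝ w) (≅⇒≅0 z-inv)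
              (termwise (λ k → lemY (seq X k) (seq Y k) (seq X′ k) (seq Y′ k) (seq w k) (seq z k) (seq H k))))))
          (hull-convex v s hull (foot-hull L l∈s r∈s) (hull-vertex v s r r∈s) α≥0 β≥0 γ≥0 total-weight)

      -- The three conditions in `UnderHalf` are the signs of the barycentric coordinates: below the
      -- line for `α`, swept for `β`, right for `γ`.
      under-hull : m Subset.∈ s → UnderHalf (half-of L) P → Hull v s P
      under-hull m∈s (c , below) = at-origin (*-null α xm) (*-null α ym) (NonNeg-* below (NonNeg-* w≥0 z≥0))
        (NonNeg-* (InCone.swept c) (NonNeg-* w≥0 z≥0)) (NonNeg-* (InCone.right c) w≥0) (hull-vertex v s m m∈s)

      on-hull : OnHalf (half-of L) P → Hull v s P
      on-hull (c , on) = at-origin (null (x r)) (null (y r)) (≅0⇒NonNeg α≅0)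
        (NonNeg-* (InCone.swept c) (NonNeg-* w≥0 z≥0)) (NonNeg-* (InCone.right c) w≥0) (hull-vertex v s r r∈s)
        where
        comm : ∀ a b → a *ℝ b ≅ b *ℝ a
        comm a b = termwise (λ k → *-comm (seq a k) (seq b k))
        α≅0 : α ≅ 0ℝ
        α≅0 = ≅-trans (comm (-ℝ line (half-of L) P) (w *ℝ z)) (*-null (w *ℝ z) (neg-null on))
        null : ∀ a → α *ℝ a ≅ 0ℝ
        null a = ≅-trans (comm α a) (*-null a α≅0)

    -- Both sides would contain `l` and `P`, and `P` is strictly to the right of `l`. So they lie on
    -- one line, which then contains `l`, `r` and `r′`.
    same-left : ∀ {l r r′} (L : Link l r) (L′ : Link l r′) → r ≢ r′ → ∀ P →
                OnHalf (half-of L) P → OnHalf (half-of L′) P → ⊥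
    same-left {l} {r} {r′} L L′ r≢r′ P (c , on) (_ , on′) = generic l r r′ l≢r r≢r′ l≢r′
      a (x r) (height L *ℝ x r) (λ (_ , h) → Pos⇒≇0 (r>0 L) h) at-l at-r at-r′
      where
      a X Y : ℝ
      a = -ℝ (y r -ℝ height L)
      X = proj₁ P
      Y = proj₂ P
      l≢ : ∀ {i} → Pos (x i) → l ≢ i
      l≢ i>0 refl = Pos⇒¬NonNeg- i>0 (Pos⇒NonNeg (l<0 L))
      l≢r : l ≢ r
      l≢r = l≢ (r>0 L)
      l≢r′ : l ≢ r′
      l≢r′ = l≢ (r>0 L′)
      at-l-null : ∀ {r} (L : Link l r) → line (half-of L) (v l) ≅ 0ℝ
      at-l-null {r} L = modulo (-ℝ 1ℝ) (≅⇒≅0 (height-eq L))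
        (termwise (λ k → lem (seq (x l) k) (seq (x r) k) (seq (y l) k) (seq (y r) k) (seq (height L) k)))
        where
        lem : ∀ a b p q h → (b * p - a * (q - h)) - h * b ≡ 0ℚ + (- 1ℚ) * (h * (b - a) - (b * p - a * q))
        lem = solve-∀ ℚ-ring
      shape : ∀ P → line (half-of L) P ≅ 0ℝ → a *ℝ proj₁ P +ℝ x r *ℝ proj₂ P ≅ height L *ℝ x r
      shape P h = ≅0⇒≅ (≅-trans (termwise (λ k → lem (seq (proj₁ P) k) (seq (proj₂ P) k) (seq (x r) k) (seq (y r) k) (seq (height L) k))) h)
        where
        lem : ∀ X Y x y h → ((- (y - h)) * X + x * Y) - h * x ≡ (x * Y - X * (y - h)) - h * x
        lem = solve-∀ ℚ-ring
      at-l = shape (v l) (at-l-null L)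
      at-r = shape (v r) (proj₂ (tip-on (half-of L)))
      -- x r′ · line L − x r · line L′ does not depend on the y-coordinate and
      -- vanishes at the abscissae of v l and of P, hence at that of v r′.
      at-r′ = shape (v r′) (null-cancel (Pos-* (r>0 L′) gap) (
        modulo (x r′ *ℝ (x r′ -ℝ x l)) on (modulo (-ℝ (x r *ℝ (x r′ -ℝ x l))) on′
        (modulo (-ℝ (x r′ *ℝ (x r′ -ℝ X))) (at-l-null L) (modulo (x r *ℝ (x r′ -ℝ X)) (at-l-null L′)
        (termwise (λ k → lem (seq (x l) k) (seq (y l) k) (seq (x r) k) (seq (y r) k) (seq (x r′) k) (seq (y r′) k)
           (seq (height L) k) (seq (height L′) k) (seq X k) (seq Y k))))))))
        where
        gap : Pos (X -ℝ x l)
        gap = Pos-resp (termwise (λ k → +-comm (- (seq (x l) k)) (seq X k))) (Pos-+ (l<0 L) (InCone.right c))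
        lem : ∀ xl yl x y x′ y′ h h′ X Y → (x′ * (X - xl)) * ((x * y′ - x′ * (y - h)) - h * x) ≡
          ((((0ℚ + (x′ * (x′ - xl)) * ((x * Y - X * (y - h)) - h * x))
            + (- (x * (x′ - xl))) * ((x′ * Y - X * (y′ - h′)) - h′ * x′))
            + (- (x′ * (x′ - X))) * ((x * yl - xl * (y - h)) - h * x))
            + (x * (x′ - X)) * ((x′ * yl - xl * (y′ - h′)) - h′ * x′))
        lem = solve-∀ ℚ-ring

    infix 4 _≲_
    _≲_ : ∀ {l r l′ r′} → Link l r → Link l′ r′ → Set
    L ≲ L′ = NonNeg (height L′ -ℝ height L)

    -- A segment through P extends to an edge through P by any third vertex.
    three-crossing : ∀ {l r l′ r′ l″ r″} (a : Link l r) (b : Link l′ r′) (c : Link l″ r″) →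
      l ≢ l′ → l ≢ l″ → l′ ≢ l″ → r ≢ r′ → r ≢ r″ → r′ ≢ r″ →
      ∀ P → OnHalf (half-of a) P → OnHalf (half-of b) P → UnderHalf (half-of c) P → ⊥
    three-crossing {l} {r} {l′} {r′} {l″} {r″} a b c ll′ ll″ l′l″ rr′ rr″ r′r″ P onP onP′ underP =
      free e∈ e′∈ (edge∈ c)
        (spans-disjoint span span′
          (∉₃ ll′ (avoids w′∉ (there (there (there (there (here refl)))))) (lr a b))
          (∉₃ (≢-sym (avoids w∉ (there (there (there (here refl)))))) (avoids w′∉ (here refl))
              (≢-sym (avoids w∉ (there (there (there (there (here refl))))))))
          (∉₃ (≢-sym (lr b a)) (avoids w′∉ (there (there (there (there (there (here refl))))))) rr′))
        (spans-disjoint span (spans c)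
          (∉₃ ll″ (l≢m a) (lr a c))
          (∉₃ (≢-sym (avoids w∉ (there (here refl)))) (≢-sym (avoids w∉ (here refl)))
              (≢-sym (avoids w∉ (there (there (here refl))))))
          (∉₃ (≢-sym (lr c a)) (r≢m a) rr″))
        (spans-disjoint span′ (spans c)
          (∉₃ l′l″ (l≢m b) (lr b c))
          (∉₃ (≢-sym (avoids w′∉ (there (there (here refl))))) (≢-sym (avoids w′∉ (there (here refl))))
              (≢-sym (avoids w′∉ (there (there (there (here refl)))))))
          (∉₃ (≢-sym (lr c b)) (r≢m b) r′r″))
        P (on-hull a (proj₁ (proj₁ span)) (proj₂ (proj₂ (proj₁ span))) onP)
          (on-hull b (proj₁ (proj₁ span′)) (proj₂ (proj₂ (proj₁ span′))) onP′)
          (under-hull c (proj₁ (proj₁ (spans c))) (proj₂ (proj₂ (proj₁ (spans c)))) (proj₁ (proj₂ (proj₁ (spans c)))) underP)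
      where
      avoids : ∀ {i w : Fin n} {is} → w ∉ is → i ∈ is → i ≢ w
      avoids w∉ i∈ refl = w∉ i∈
      lr : ∀ {l r l′ r′} → Link l r → Link l′ r′ → l ≢ r′
      lr L L′ refl = Pos⇒¬NonNeg- (r>0 L′) (Pos⇒NonNeg (l<0 L))
      l≢m : ∀ {l r} → Link l r → l ≢ m
      l≢m L refl = Pos⇒¬NonNeg- (l<0 L) (NonNeg-resp (≅-sym neg-involutive) (≅0⇒NonNeg xm))
      r≢m : ∀ {l r} → Link l r → r ≢ m
      r≢m L refl = Pos⇒¬NonNeg- (r>0 L) (≅0⇒NonNeg (neg-null xm))
      -- The third edge keeps `m` as its middle vertex. The first new apex avoids that edge and the
      -- ends of `b`; the second avoids the same edge, the ends of `a` and also the first apex, six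
      -- vertices in all.
      extension = heavy a (m ∷ l″ ∷ r″ ∷ l′ ∷ r′ ∷ []) (ℕP.n≤1+n 5)
      w = proj₁ extension
      w∉ : w ∉ m ∷ l″ ∷ r″ ∷ l′ ∷ r′ ∷ []
      w∉ = proj₁ (proj₂ extension)
      e∈ = proj₁ (proj₂ (proj₂ (proj₂ extension)))
      span = proj₂ (proj₂ (proj₂ (proj₂ extension)))
      extension′ = heavy b (w ∷ m ∷ l″ ∷ r″ ∷ l ∷ r ∷ []) ℕP.≤-refl
      w′ = proj₁ extension′
      w′∉ : w′ ∉ w ∷ m ∷ l″ ∷ r″ ∷ l ∷ r ∷ []
      w′∉ = proj₁ (proj₂ extension′)
      e′∈ = proj₁ (proj₂ (proj₂ (proj₂ extension′)))
      span′ = proj₂ (proj₂ (proj₂ (proj₂ extension′)))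

    -- early ≲ middle ≲ late, and the right vertex X of early and late is the
    -- closest of the three to the upward ray: X lies on one side of the line of
    -- middle, so early or late meets middle.
    core : ∀ {X Y Z l₁ l₂ l₃} (early : Link l₁ X) (late : Link l₂ X) (middle : Link l₃ Z) →
      X ≢ Y → X ≢ Z → Y ≢ Z → early ≲ middle → middle ≲ late →
      (∀ p q → ∃ λ l → l ≢ p × l ≢ q × ∃ λ (L : Link l Y) → middle ≲ L) →
      InCone (half-of middle) (tip (half-of early)) →
      (∀ {l} (L : Link l Y) → InCone (half-of L) (tip (half-of early))) → ⊥
    core {X} {Y} {Z} {l₁} {l₂} {l₃} early late middle XY XZ YZ e≲m m≲l lates closer closer′ =
      NonNeg-total (line (half-of middle) (tip (half-of early))) λ
        { (inj₁ above) → meet (half-of early) (half-of middle) closer (inj₁ (e≲m , above)) λ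
            { (P , onE , onM , cones) → pair early middle XZ onE onM XY (≢-sym YZ) e≲m (λ L m≲L → ≲-trans {L = L} e≲m m≲L) λ L → cones (half-of L) (closer′ L) }
        -- `late` and `early` both end in `X`, hence have the same tip, and the facts known about
        -- the tip of `early` apply as they stand.
        ; (inj₂ below) → meet (half-of late) (half-of middle) closer (inj₂ (m≲l , below)) λ
            { (P , onL , onM , cones) → pair middle late (≢-sym XZ) onM onL (≢-sym YZ) XY m≲l (λ L m≲L → m≲L) λ L → cones (half-of L) (closer′ L) } }
      where
      ≲-trans : ∀ {l} {L : Link l Y} → early ≲ middle → middle ≲ L → early ≲ L
      ≲-trans {l} {L} h k = NonNeg-resp (termwise (λ n → lem (seq (height early) n) (seq (height middle) n) (seq (height L) n))) (NonNeg-+ h k)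
        where
        lem : ∀ a b c → (b - a) + (c - b) ≡ c - a
        lem = solve-∀ ℚ-ring
      -- Only after the two crossing sides are known is the side ending in `Y` chosen, off both
      -- their left ends. `a` has to be the lowest of the three at the ray, as `meet-third` walks
      -- from its foot.
      pair : ∀ {l r l′ r′ P} (a : Link l r) (c : Link l′ r′) → r ≢ r′ → OnHalf (half-of a) P → OnHalf (half-of c) P →
        r ≢ Y → r′ ≢ Y → a ≲ c → (∀ {l} (L : Link l Y) → middle ≲ L → a ≲ L) →
        (∀ {l} (L : Link l Y) → InCone (half-of L) P) → ⊥
      pair {l} {r} {l′} {r′} {P} a c rr′ onA onC rY r′Y a≲c above cones with l ≟ l′
      ... | yes refl = same-left a c rr′ P onA onC
      ... | no l≢l′ with lates l l′
      ... | l″ , l″≢l , l″≢l′ , L , m≲L =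
        meet-third (half-of a) (half-of L) (half-of c) P onA onC (cones L) a≲c (above L m≲L) λ
          { (Q , inj₁ (onA , onC , underL)) → three-crossing a c L l≢l′ (≢-sym l″≢l) (≢-sym l″≢l′) rr′ rY r′Y Q onA onC underL
          ; (Q , inj₂ (onA , onL , underC)) → three-crossing a L c (≢-sym l″≢l) l≢l′ l″≢l′ rY rr′ (≢-sym r′Y) Q onA onL underC }

-- Affine changes of coordinates and the choice of a generic shear.

module Transformations where

  open import Defs hiding (_≈_; split)
  open RealArithmetic
  open Hulls
  open HalfPlane
  open Links
  open import Data.Nat.Base as ℕ using (ℕ; suc; zero)
  import Data.Nat.Properties as ℕP
  open import Data.Rational.Base using (0ℚ; 1ℚ; _+_; _*_; _-_; -_)
  open import Data.Rational.Properties using (positive⁻¹; *-comm)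
  open import Data.Fin.Base using (Fin; zero; suc; combine; toℕ)
  open import Data.Fin.Properties using (pigeonhole; combine-injective)
  open import Data.Product using (∃; _×_; _,_; proj₁; proj₂)
  open import Data.Sum using (inj₁; inj₂)
  open import Data.Empty using (⊥)
  open import Relation.Nullary using (¬_)
  open import Relation.Binary.PropositionalEquality
  open import Tactic.RingSolver using (solve-∀)

  -- Shears, translations and reflections in the axes are all of this form.
  module _ {n} (α β γ δ ε : ℝ) (αα : α *ℝ α ≅ 1ℝ) (δδ : δ *ℝ δ ≅ 1ℝ) (v : Fin n → Point) where

    transform : Fin n → Point
    transform i = (α *ℝ proj₁ (v i) +ℝ β *ℝ proj₂ (v i)) +ℝ γ , δ *ℝ proj₂ (v i) +ℝ ε

    -- A line through images pulls back to a line through the original points; its coefficients do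
    -- not both vanish, since `α` and `δ` square to 1.
    transform-generic : NoThreeOnALine v → NoThreeOnALine transform
    transform-generic generic i j k ij jk ik a b c nontrivial hi hj hk =
      generic i j k ij jk ik (a *ℝ α) (a *ℝ β +ℝ b *ℝ δ) (c -ℝ (a *ℝ γ +ℝ b *ℝ ε))
        (λ (aα , aβbδ) → let a≅0 = unscale αα aα in nontrivial (a≅0 , unscale δδ
          (≅-trans (termwise (λ k → e₁ (seq a k) (seq β k) (seq b k) (seq δ k)))
            (≅-trans (+-cong aβbδ (neg-null (≅-trans (comm a β) (*-null β a≅0)))) (termwise (λ _ → refl))))))
        (on hi) (on hj) (on hk)
      where
      comm : ∀ a b → a *ℝ b ≅ b *ℝ a
      comm a b = termwise (λ k → *-comm (seq a k) (seq b k))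
      unscale : ∀ {a α} → α *ℝ α ≅ 1ℝ → a *ℝ α ≅ 0ℝ → a ≅ 0ℝ
      unscale {a} {α} αα aα = modulo α aα (modulo (-ℝ a) (≅⇒≅0 αα) (termwise (λ k → lem (seq a k) (seq α k))))
        where
        lem : ∀ a α → a ≡ (0ℚ + α * (a * α)) + (- a) * (α * α - 1ℚ)
        lem = solve-∀ ℚ-ring
      e₁ : ∀ a β b δ → b * δ ≡ (a * β + b * δ) + (- (a * β))
      e₁ = solve-∀ ℚ-ring
      on : ∀ {i} → a *ℝ proj₁ (transform i) +ℝ b *ℝ proj₂ (transform i) ≅ c →
           (a *ℝ α) *ℝ proj₁ (v i) +ℝ (a *ℝ β +ℝ b *ℝ δ) *ℝ proj₂ (v i) ≅ c -ℝ (a *ℝ γ +ℝ b *ℝ ε)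
      on {i} h = modulo 1ℝ (≅⇒≅0 h) (termwise (λ k → lem (seq a k) (seq b k) (seq c k) (seq α k) (seq β k) (seq γ k) (seq δ k) (seq ε k)
          (seq (proj₁ (v i)) k) (seq (proj₂ (v i)) k)))
        where
        lem : ∀ a b c α β γ δ ε x y → (a * α) * x + (a * β + b * δ) * y ≡
          (c - (a * γ + b * ε)) + 1ℚ * ((a * ((α * x + β * y) + γ) + b * (δ * y + ε)) - c)
        lem = solve-∀ ℚ-ring

    -- Common points are pulled back by the inverse map, which needs no division because `α` and `δ`
    -- are their own inverses.
    transform-free : ∀ {E} → NoThreeCrossing v E → NoThreeCrossing transform E
    transform-free free a∈ b∈ c∈ ab ac bc P ha hb hc = free a∈ b∈ c∈ ab ac bc _ (back ha) (back hb) (back hc)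
      where
      back : ∀ {s P} → Hull transform s P → Hull v s _
      back {s} = hull-affine transform v s α (-ℝ (α *ℝ β *ℝ δ)) (α *ℝ β *ℝ δ *ℝ ε -ℝ α *ℝ γ) 0ℝ δ (-ℝ (δ *ℝ ε))
        (λ i → ≅-sym (modulo (proj₁ (v i)) (≅⇒≅0 αα) (modulo (-ℝ (α *ℝ β *ℝ proj₂ (v i))) (≅⇒≅0 δδ)
          (termwise (λ k → lemx (seq α k) (seq β k) (seq γ k) (seq δ k) (seq ε k) (seq (proj₁ (v i)) k) (seq (proj₂ (v i)) k))))))
        (λ i → ≅-sym (modulo (proj₂ (v i)) (≅⇒≅0 δδ)
          (termwise (λ k → lemy (seq α k) (seq β k) (seq γ k) (seq δ k) (seq ε k) (seq (proj₁ (v i)) k) (seq (proj₂ (v i)) k)))))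
        where
        lemx : ∀ α β γ δ ε x y → (α * ((α * x + β * y) + γ) + (- (α * β * δ)) * (δ * y + ε)) + (α * β * δ * ε - α * γ)
          ≡ (x + x * (α * α - 1ℚ)) + (- (α * β * y)) * (δ * δ - 1ℚ)
        lemx = solve-∀ ℚ-ring
        lemy : ∀ α β γ δ ε x y → (0ℚ * ((α * x + β * y) + γ) + δ * (δ * y + ε)) + (- (δ * ε)) ≡ y + y * (δ * δ - 1ℚ)
        lemy = solve-∀ ℚ-ring

  ¬¬-Fin : ∀ {n} {P : Fin n → Set} → (∀ i → ¬ ¬ P i) → ¬ ¬ (∀ i → P i)
  ¬¬-Fin {zero}  h k = k λ ()
  ¬¬-Fin {suc n} h k = h zero λ p → ¬¬-Fin (λ i → h (suc i)) λ q → k λ { zero → p ; (suc i) → q i }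

  nat : ℕ → ℝ
  nat zero    = 0ℝ
  nat (suc n) = nat n +ℝ 1ℝ

  1>0 : Pos 1ℝ
  1>0 = fromℚ-pos 1ℚ (positive⁻¹ 1ℚ)

  nat-mono-< : ∀ {m n} → m ℕ.< n → Pos (nat n -ℝ nat m)
  nat-mono-< {m} {suc n} (ℕ.s≤s m≤n) = Pos-resp (termwise (λ k → lem (seq (nat n) k) (seq (nat m) k)))
    (Pos-+ 1>0 (gap m≤n))
    where
    lem : ∀ a b → 1ℚ + (a - b) ≡ (a + 1ℚ) - b
    lem = solve-∀ ℚ-ring
    gap : ∀ {m n} → m ℕ.≤ n → NonNeg (nat n -ℝ nat m)
    gap {m} {n} m≤n with ℕP.m≤n⇒m<n∨m≡n m≤n
    ... | inj₁ m<n  = Pos⇒NonNeg (nat-mono-< m<n)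
    ... | inj₂ refl = ≅0⇒NonNeg (≅⇒≅0 ≅-refl)

  -- For each pair of points at most one slope makes the sheared abscissae agree.
  shear-distinct : ∀ {n} (v : Fin n → Point) → (∀ i j → i ≢ j → ¬ (proj₁ (v i) ≅ proj₁ (v j) × proj₂ (v i) ≅ proj₂ (v j))) →
    ¬ ¬ (∃ λ τ → ∀ i j → i ≢ j → ¬ (proj₁ (v i) +ℝ τ *ℝ proj₂ (v i) ≅ proj₁ (v j) +ℝ τ *ℝ proj₂ (v j)))
  shear-distinct {n} v distinct k = ¬¬-Fin bad λ b →
      -- Were the slopes 0, ..., n² all bad, two of them would be bad for the same pair of points.
      -- Subtracting the two equations makes the ordinates agree, then the abscissae, so the points
      -- coincide.
      let (t , t′ , t<t′ , same) = pigeonhole (ℕP.n<1+n (n ℕ.* n)) (λ t → combine (proj₁ (b t)) (proj₁ (proj₂ (b t)))) in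
      clash (b t) (b t′) (nat-mono-< t<t′) (combine-injective _ _ _ _ same)
    where
    Bad : ℝ → Fin n → Fin n → Set
    Bad τ i j = i ≢ j × proj₁ (v i) +ℝ τ *ℝ proj₂ (v i) ≅ proj₁ (v j) +ℝ τ *ℝ proj₂ (v j)
    bad : ∀ (t : Fin (suc (n ℕ.* n))) → ¬ ¬ (∃ λ i → ∃ λ j → Bad (nat (toℕ t)) i j)
    bad t h = k (nat (toℕ t) , λ i j i≢j e → h (i , j , i≢j , e))
    clash : ∀ {τ τ′} (b : ∃ λ i → ∃ λ j → Bad τ i j) (b′ : ∃ λ i → ∃ λ j → Bad τ′ i j) → Pos (τ′ -ℝ τ) →
            proj₁ b ≡ proj₁ b′ × proj₁ (proj₂ b) ≡ proj₁ (proj₂ b′) → ⊥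
    clash {τ} {τ′} (i , j , i≢j , e) (_ , _ , _ , e′) gap (refl , refl) = distinct i j i≢j (≅0⇒≅ x≅ , ≅0⇒≅ y≅)
      where
      xi xj yi yj : ℝ
      xi = proj₁ (v i)
      xj = proj₁ (v j)
      yi = proj₂ (v i)
      yj = proj₂ (v j)
      y≅ : yi -ℝ yj ≅ 0ℝ
      y≅ = null-cancel gap (modulo 1ℝ (≅⇒≅0 e′) (modulo (-ℝ 1ℝ) (≅⇒≅0 e)
        (termwise (λ k → lem (seq xi k) (seq xj k) (seq yi k) (seq yj k) (seq τ k) (seq τ′ k)))))
        where
        lem : ∀ a b c d τ τ′ → (τ′ - τ) * (c - d) ≡
          (0ℚ + 1ℚ * ((a + τ′ * c) - (b + τ′ * d))) + (- 1ℚ) * ((a + τ * c) - (b + τ * d))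
        lem = solve-∀ ℚ-ring
      x≅ : xi -ℝ xj ≅ 0ℝ
      x≅ = modulo 1ℝ (≅⇒≅0 e) (modulo (-ℝ τ) y≅ (termwise (λ k → lem (seq xi k) (seq xj k) (seq yi k) (seq yj k) (seq τ k))))
        where
        lem : ∀ a b c d τ → a - b ≡ (0ℚ + 1ℚ * ((a + τ * c) - (b + τ * d))) + (- τ) * (c - d)
        lem = solve-∀ ℚ-ring

-- Placing edges, discarding light outer pairs, and bounding each link.

module UpperBound where

  open import Defs hiding (_≈_; split)
  open RealArithmetic
  open Hulls
  open HalfPlane
  open Links
  open Transformations
  open Combinatorics hiding (split)
  open import Data.Nat.Base as ℕ using (ℕ; suc; zero)
  import Data.Nat.Properties as ℕP
  open import Data.Rational.Base using (0ℚ; 1ℚ; _+_; _*_; _-_; -_)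
  open import Data.Fin.Base using (Fin; zero; suc; combine; remQuot)
  open import Data.Fin.Properties using (combine-injective; combine-remQuot; suc-injective)
  import Data.Fin.Properties as FinP
  open import Data.Fin.Subset as Subset using (Subset; ∣_∣; inside; outside)
  import Data.Fin.Subset.Properties as SubsetP
  open import Data.Vec.Base using ([]; _∷_; here; there)
  open import Data.List.Base using (List; []; _∷_; length; map; filter)
  open import Data.List.Properties using (length-map)
  open import Data.List.Membership.Propositional using (_∈_; _∉_)
  open import Data.List.Membership.Propositional.Properties using (∈-filter⁻; ∈-map⁺)
  open import Data.List.Relation.Unary.Any using (here; there)
  open import Data.List.Relation.Unary.All as All using (All; []; _∷_)
  import Data.List.Relation.Unary.All.Properties as All
  open import Data.List.Relation.Unary.AllPairs as AllPairs using (AllPairs; []; _∷_)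
  import Data.List.Relation.Unary.AllPairs.Properties as AllPairs
  open import Data.List.Relation.Unary.Unique.Propositional using (Unique)
  open import Data.List.Relation.Binary.Permutation.Propositional using (_↭_; refl; prep; swap; trans; ↭-sym)
  open import Data.List.Relation.Binary.Permutation.Propositional.Properties using (All-resp-↭; ↭-length)
  open import Data.Product using (∃; _×_; _,_; proj₁; proj₂)
  open import Data.Sum using (_⊎_; inj₁; inj₂)
  open import Data.Empty using (⊥; ⊥-elim)
  open import Relation.Nullary using (¬_; Dec)
  open import Relation.Nullary.Decidable using (¬?)
  open import Relation.Binary.PropositionalEquality hiding (trans)
  import Relation.Binary.PropositionalEquality as ≡
  open import Tactic.RingSolver using (solve-∀)

  elements : ∀ {n} → Subset n → List (Fin n)
  elements []            = []
  elements (inside  ∷ s) = zero ∷ map suc (elements s)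
  elements (outside ∷ s) = map suc (elements s)

  length-elements : ∀ {n} (s : Subset n) → length (elements s) ≡ ∣ s ∣
  length-elements []            = ≡.refl
  length-elements (inside  ∷ s) = cong suc (≡.trans (length-map suc (elements s)) (length-elements s))
  length-elements (outside ∷ s) = ≡.trans (length-map suc (elements s)) (length-elements s)

  elements-sound : ∀ {n} (s : Subset n) → All (Subset._∈ s) (elements s)
  elements-sound []            = []
  elements-sound (inside  ∷ s) = here ∷ All.map⁺ (All.map there (elements-sound s))
  elements-sound (outside ∷ s) = All.map⁺ (All.map there (elements-sound s))

  elements-complete : ∀ {n} {s : Subset n} {i} → i Subset.∈ s → i ∈ elements s
  elements-complete {s = inside ∷ s}  here       = here ≡.refl
  elements-complete {s = inside ∷ s}  (there i∈) = there (∈-map⁺ suc (elements-complete i∈))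
  elements-complete {s = outside ∷ s} (there i∈) = ∈-map⁺ suc (elements-complete i∈)

  elements-distinct : ∀ {n} (s : Subset n) → AllPairs _≢_ (elements s)
  elements-distinct []            = []
  elements-distinct (inside  ∷ s) = All.map⁺ (All.tabulate (λ _ ())) ∷ AllPairs.map⁺ (AllPairs.map (λ ne e → ne (suc-injective e)) (elements-distinct s))
  elements-distinct (outside ∷ s) = AllPairs.map⁺ (AllPairs.map (λ ne e → ne (suc-injective e)) (elements-distinct s))

  three-elements : ∀ {n} (s : Subset n) → ∣ s ∣ ≡ 3 →
    ∃ λ i → ∃ λ j → ∃ λ k → i ≢ j × i ≢ k × j ≢ k × Spans s i j k
  three-elements s h with elements s | ≡.trans (length-elements s) h | elements-sound s | elements-complete {s = s} | elements-distinct s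
  ... | i ∷ j ∷ k ∷ [] | ≡.refl | i∈ ∷ j∈ ∷ k∈ ∷ [] | complete | (ij ∷ ik ∷ []) ∷ (jk ∷ []) ∷ _ =
    i , j , k , ij , ik , jk , (i∈ , j∈ , k∈) , λ v v∈ → listed (complete v∈)
    where
    listed : ∀ {v} → v ∈ i ∷ j ∷ k ∷ [] → v ≡ i ⊎ v ≡ j ⊎ v ≡ k
    listed (here e)                 = inj₁ e
    listed (there (here e))         = inj₂ (inj₁ e)
    listed (there (there (here e))) = inj₂ (inj₂ e)

  spans-swap : ∀ {n} {s : Subset n} {i j k} → Spans s i j k → Spans s j i k
  spans-swap ((i∈ , j∈ , k∈) , cov) = (j∈ , i∈ , k∈) , λ v v∈ → turn (cov v v∈)
    where
    turn : ∀ {A B C : Set} → A ⊎ B ⊎ C → B ⊎ A ⊎ C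
    turn (inj₁ a)        = inj₂ (inj₁ a)
    turn (inj₂ (inj₁ b)) = inj₁ b
    turn (inj₂ (inj₂ c)) = inj₂ (inj₂ c)

  spans-rotate : ∀ {n} {s : Subset n} {i j k} → Spans s i j k → Spans s j k i
  spans-rotate ((i∈ , j∈ , k∈) , cov) = (j∈ , k∈ , i∈) , λ v v∈ → turn (cov v v∈)
    where
    turn : ∀ {A B C : Set} → A ⊎ B ⊎ C → B ⊎ C ⊎ A
    turn (inj₁ a)        = inj₂ (inj₂ a)
    turn (inj₂ (inj₁ b)) = inj₁ b
    turn (inj₂ (inj₂ c)) = inj₂ (inj₁ c)

  spans-⊆ : ∀ {n} {s t : Subset n} {i j k} → Spans s i j k → Spans t i j k → s Subset.⊆ t
  spans-⊆ (_ , cov) ((i∈ , j∈ , k∈) , _) {v} v∈ with cov v v∈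
  ... | inj₁ ≡.refl        = i∈
  ... | inj₂ (inj₁ ≡.refl) = j∈
  ... | inj₂ (inj₂ ≡.refl) = k∈

  spans-unique : ∀ {n} {s t : Subset n} {i j k} → Spans s i j k → Spans t i j k → s ≡ t
  spans-unique {s = s} {t} S T = SubsetP.⊆-antisym {i = s} {j = t} (spans-⊆ S T) (spans-⊆ T S)

  ¬¬-All : ∀ {A : Set} {P : A → Set} {xs} → All (λ a → ¬ ¬ P a) xs → ¬ ¬ All P xs
  ¬¬-All []       k = k []
  ¬¬-All (p ∷ ps) k = p λ q → ¬¬-All ps λ qs → k (q ∷ qs)

  AllPairs-resp-↭ : ∀ {A : Set} {R : A → A → Set} → (∀ {a b} → R a b → R b a) → ∀ {xs ys} → xs ↭ ys → AllPairs R xs → AllPairs R ys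
  AllPairs-resp-↭ s refl         Rs = Rs
  AllPairs-resp-↭ s (prep x p)   (Rx ∷ Rs) = All-resp-↭ p Rx ∷ AllPairs-resp-↭ s p Rs
  AllPairs-resp-↭ s (swap x y p) ((Rxy ∷ Rx) ∷ Ry ∷ Rs) = (s Rxy ∷ All-resp-↭ p Ry) ∷ All-resp-↭ p Rx ∷ AllPairs-resp-↭ s p Rs
  AllPairs-resp-↭ s (trans p q)  Rs = AllPairs-resp-↭ s q (AllPairs-resp-↭ s p Rs)

  AllPairs-map-All : ∀ {A : Set} {P : A → Set} {R S : A → A → Set} → (∀ {a b} → P a → P b → R a b → S a b) →
    ∀ {xs} → All P xs → AllPairs R xs → AllPairs S xs
  AllPairs-map-All f []       []        = []
  AllPairs-map-All f (p ∷ ps) (Rx ∷ Rs) = All.zipWith (λ (q , r) → f p q r) (ps , Rx) ∷ AllPairs-map-All f ps Rs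

  -- Each forbidden value is taken by at most one member, so dropping it keeps the list longer than
  -- what remains to be avoided.
  avoiding : ∀ {A B : Set} (_≟_ : ∀ (b c : B) → Dec (b ≡ c)) (f : A → B) avoid xs → AllPairs (λ a b → f a ≢ f b) xs →
    length avoid ℕ.< length xs → ∃ λ a → a ∈ xs × f a ∉ avoid
  avoiding _≟_ f []       (x ∷ xs) distinct h = x , here ≡.refl , λ ()
  avoiding _≟_ f (b ∷ bs) xs distinct h =
    let (a , a∈ , a∉) = avoiding _≟_ f bs others (AllPairs.filter⁺ other? distinct) bound
        (a∈xs , a≢b) = ∈-filter⁻ other? {a} {xs} a∈
    in a , a∈xs , λ { (here e) → a≢b e ; (there e) → a∉ e }
    where
    same? = λ a → f a ≟ b
    other? = λ a → ¬? (f a ≟ b)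
    others = filter other? xs
    few : length (filter same? xs) ℕ.≤ 1
    few with filter same? xs in eq
    ... | []     = ℕ.z≤n
    ... | _ ∷ [] = ℕ.s≤s ℕ.z≤n
    ... | x ∷ y ∷ ys with subst (AllPairs _) eq (AllPairs.filter⁺ same? distinct)
    ... | (xy ∷ _) ∷ _ = ⊥-elim (xy (≡.trans (in-same (here ≡.refl)) (sym (in-same (there (here ≡.refl))))))
      where
      in-same : ∀ {z} → z ∈ x ∷ y ∷ ys → f z ≡ b
      in-same {z} z∈ = proj₂ (∈-filter⁻ same? {z} {xs} (subst (z ∈_) (sym eq) z∈))
    bound : length bs ℕ.< length others
    bound = ℕP.+-cancelʳ-≤ 1 (suc (length bs)) (length others) (ℕP.≤-trans (ℕP.≤-reflexive (ℕP.+-comm (suc (length bs)) 1))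
      (ℕP.≤-trans h (ℕP.≤-trans (ℕP.≤-reflexive (sym (length-partition same? xs))) (ℕP.+-monoʳ-≤ (length others) few))))

  sign : Fin 2 → ℝ
  sign zero    = 1ℝ
  sign (suc _) = -ℝ 1ℝ

  sign² : ∀ s → sign s *ℝ sign s ≅ 1ℝ
  sign² zero    = termwise (λ _ → ≡.refl)
  sign² (suc _) = termwise (λ _ → ≡.refl)

  module _ {n} (v : Fin n → Point) (E : List (Subset n)) where

    private
      x y : Fin n → ℝ
      x i = proj₁ (v i)
      y i = proj₂ (v i)

    -- The side lr passes above m if side is zero and below m otherwise.
    record Placed (e : Subset n) : Set where
      field
        l m r     : Fin n
        l<m       : Pos (x m -ℝ x l)
        m<r       : Pos (x r -ℝ x m)
        spans     : Spans e l m r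
        height    : ℝ
        height-eq : height *ℝ (x r -ℝ x l) ≅ (x r -ℝ x m) *ℝ (y l -ℝ y m) -ℝ (x l -ℝ x m) *ℝ (y r -ℝ y m)
        side      : Fin 2
        off-line  : Pos (sign side *ℝ height)

    module _ (distinct : ∀ i j → i ≢ j → ¬ (x i ≅ x j)) (generic : NoThreeOnALine v) where

      -- The height is a determinant divided by the width of the side. If it vanished, `m` would lie
      -- on the line through `l` and `r`; so it has a strict sign, which decides the side.
      place : ∀ {e l m r} → Spans e l m r → Pos (x m -ℝ x l) → Pos (x r -ℝ x m) → ¬ ¬ Placed e
      place {e} {l} {m} {r} spans l<m m<r k = Pos-total h h≇0 λ
        { (inj₁ above) → k (record { spans = spans ; l<m = l<m ; m<r = m<r ; height = h ; height-eq = h-eq ; side = zero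
            ; off-line = Pos-resp (termwise (λ k → e₁ (seq h k))) above })
        ; (inj₂ below) → k (record { spans = spans ; l<m = l<m ; m<r = m<r ; height = h ; height-eq = h-eq ; side = suc zero
            ; off-line = Pos-resp (termwise (λ k → e₂ (seq h k))) below }) }
        where
        e₁ : ∀ h → h ≡ 1ℚ * h
        e₁ = solve-∀ ℚ-ring
        e₂ : ∀ h → - h ≡ (- 1ℚ) * h
        e₂ = solve-∀ ℚ-ring
        e₃ : ∀ a b c → (b - a) + (c - b) ≡ c - a
        e₃ = solve-∀ ℚ-ring
        l<r : Pos (x r -ℝ x l)
        l<r = Pos-resp (termwise (λ k → e₃ (seq (x l) k) (seq (x m) k) (seq (x r) k))) (Pos-+ l<m (Pos⇒NonNeg m<r))
        w : ℝ
        w = proj₁ (inverse (x r -ℝ x l) l<r)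
        det h : ℝ
        det = (x r -ℝ x m) *ℝ (y l -ℝ y m) -ℝ (x l -ℝ x m) *ℝ (y r -ℝ y m)
        h = det *ℝ w
        h-eq : h *ℝ (x r -ℝ x l) ≅ det
        h-eq = modulo det (≅⇒≅0 (proj₂ (proj₂ (inverse (x r -ℝ x l) l<r)))) (termwise (λ k → lem (seq det k) (seq w k) (seq (x r -ℝ x l) k)))
          where
          lem : ∀ d w g → (d * w) * g ≡ d + d * (g * w - 1ℚ)
          lem = solve-∀ ℚ-ring
        ≢ : ∀ {i j} → Pos (x j -ℝ x i) → i ≢ j
        ≢ gap ≡.refl = Pos⇒≇0 gap (≅⇒≅0 ≅-refl)
        h≇0 : ¬ (h ≅ 0ℝ)
        h≇0 h≅0 = generic l m r (≢ l<m) (≢ m<r) (≢ l<r) a (x l -ℝ x r) (a *ℝ x l +ℝ (x l -ℝ x r) *ℝ y l)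
            (λ (_ , b≅0) → Pos⇒≇0 l<r (≅-trans (termwise (λ k → e₄ (seq (x l) k) (seq (x r) k))) (neg-null b≅0)))
            ≅-refl
            (modulo 1ℝ det≅0 (termwise (λ k → e₅ (seq (x l) k) (seq (x m) k) (seq (x r) k) (seq (y l) k) (seq (y m) k) (seq (y r) k))))
            (termwise (λ k → e₆ (seq (x l) k) (seq (x r) k) (seq (y l) k) (seq (y r) k)))
          where
          a : ℝ
          a = y r -ℝ y l
          det≅0 : det ≅ 0ℝ
          det≅0 = ≅-trans (≅-sym h-eq) (≅-trans (termwise (λ k → comm (seq h k) (seq (x r -ℝ x l) k))) (*-null (x r -ℝ x l) h≅0))
            where
            comm : ∀ a b → a * b ≡ b * a
            comm = solve-∀ ℚ-ring
          e₄ : ∀ a b → b - a ≡ - (a - b)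
          e₄ = solve-∀ ℚ-ring
          e₅ : ∀ a b c p q s → (s - p) * b + (a - c) * q ≡ ((s - p) * a + (a - c) * p) + 1ℚ * ((c - b) * (p - q) - (a - b) * (s - q))
          e₅ = solve-∀ ℚ-ring
          e₆ : ∀ a c p s → (s - p) * c + (a - c) * s ≡ (s - p) * a + (a - c) * p
          e₆ = solve-∀ ℚ-ring

      place-edge : ∀ e → ∣ e ∣ ≡ 3 → ¬ ¬ Placed e
      place-edge e h k = let (i , j , l , ij , il , jl , S) = three-elements e h in
        compare ij λ { (inj₁ i<j) → insert S i<j il jl k ; (inj₂ j<i) → insert (spans-swap S) j<i jl il k }
        where
        compare : ∀ {i j} → i ≢ j → ¬ ¬ (Pos (x j -ℝ x i) ⊎ Pos (x i -ℝ x j))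
        compare {i} {j} i≢j k = Pos-total (x j -ℝ x i) (λ e → distinct j i (≢-sym i≢j) (≅0⇒≅ e)) λ
          { (inj₁ p) → k (inj₁ p) ; (inj₂ p) → k (inj₂ (Pos-resp (termwise (λ k → lem (seq (x i) k) (seq (x j) k))) p)) }
          where
          lem : ∀ a b → - (b - a) ≡ a - b
          lem = solve-∀ ℚ-ring
        insert : ∀ {i j l} → Spans e i j l → Pos (x j -ℝ x i) → i ≢ l → j ≢ l → ¬ ¬ Placed e
        insert S i<j il jl k = compare jl λ
          { (inj₁ j<l) → place S i<j j<l k
          ; (inj₂ l<j) → compare il λ
            { (inj₁ i<l) → place (spans-rotate (spans-swap S)) i<l l<j k
            ; (inj₂ l<i) → place (spans-rotate (spans-rotate S)) l<i i<j k } }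

  module _ {n} (u : Fin n → Point) (E : List (Subset n)) (m : Fin n)
           (xm : proj₁ (u m) ≅ 0ℝ) (ym : proj₂ (u m) ≅ 0ℝ)
           (generic : NoThreeOnALine u) (free : NoThreeCrossing u E) where
    open LinkOf u E m xm ym generic free

    -- The end closest to the ray among the three is found by comparing angles, and plays the part
    -- of `X` in `core`. The order is stated through `h` because a link is built from a membership
    -- proof; `height≡` says that this proof does not affect its height.
    columns-absurd : ∀ {A : Set} (f g : A → Fin n) (h : A → ℝ) (ys : List A)
      (link : ∀ {a} → a ∈ ys → Link (g a) (f a)) → (∀ {a} (a∈ : a ∈ ys) → Link.height (link a∈) ≡ h a) →
      ¬ Columns (λ a b → NonNeg (h b -ℝ h a)) f g ys
    columns-absurd {A} f g h ys link height≡ C =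
      cone-total (H 0F) (H 1F) λ
        { (inj₁ 1<0) → cone-total (H 1F) (H 2F) λ
            { (inj₁ 2<1) → closest 2F 0F 1F (λ ()) (λ ()) (λ ()) (cone-trans (H 0F) (H 1F) (H 2F) 1<0 2<1) 2<1
            ; (inj₂ 1<2) → closest 1F 0F 2F (λ ()) (λ ()) (λ ()) 1<0 1<2 }
        ; (inj₂ 0<1) → cone-total (H 0F) (H 2F) λ
            { (inj₁ 2<0) → closest 2F 0F 1F (λ ()) (λ ()) (λ ()) 2<0 (cone-trans (H 1F) (H 0F) (H 2F) 0<1 2<0)
            ; (inj₂ 0<2) → closest 0F 1F 2F (λ ()) (λ ()) (λ ()) 0<1 0<2 } }
      where
      open Columns C
      0F 1F 2F : Fin 3
      0F = zero
      1F = suc zero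
      2F = suc (suc zero)
      M : ∀ i → Link (g (middle i)) (f (middle i))
      M i = link (middle∈ i)
      H : Fin 3 → Half
      H i = half-of (M i)
      ≲-intro : ∀ {a b} (a∈ : a ∈ ys) (b∈ : b ∈ ys) → NonNeg (h b -ℝ h a) → link a∈ ≲ link b∈
      ≲-intro a∈ b∈ = subst₂ (λ p q → NonNeg (q -ℝ p)) (sym (height≡ a∈)) (sym (height≡ b∈))
      below : ∀ {a k} → a ∈ ys → f a ≡ k → (∀ j → NonNeg (h (middle j) -ℝ h a)) → ∃ λ l → ∃ λ (L : Link l k) → ∀ j → L ≲ M j
      below a∈ ≡.refl a≤ = _ , link a∈ , λ j → ≲-intro a∈ (middle∈ j) (a≤ j)
      above : ∀ {a k p q} → a ∈ ys → f a ≡ k → g a ≢ p → g a ≢ q → (∀ j → NonNeg (h a -ℝ h (middle j))) →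
        ∃ λ l → l ≢ p × l ≢ q × ∃ λ (L : Link l k) → ∀ j → M j ≲ L
      above a∈ ≡.refl ≢p ≢q ≤a = _ , ≢p , ≢q , link a∈ , λ j → ≲-intro (middle∈ j) a∈ (≤a j)
      lates : ∀ i p q → ∃ λ l → l ≢ p × l ≢ q × ∃ λ (L : Link l (f (middle i))) → ∀ j → M j ≲ L
      lates i p q = let (a , a∈ , e , ≢p , ≢q , ≤a) = late i p q in above a∈ e ≢p ≢q ≤a
      -- Here `i` stands for X, `j` for Z and `k` for Y, in the notation of `core`.
      closest : ∀ i j k → i ≢ j → i ≢ k → j ≢ k → InCone (H j) (tip (H i)) → InCone (H k) (tip (H i)) → ⊥
      closest i j k ij ik jk cj ck =
        let (a , a∈ , e , a≤) = early i
            (l , L , L≲) = below a∈ e a≤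
            -- The late side ending in X may start anywhere: if it crosses the middle side,
            -- `same-left` separates their left ends. The values to avoid are therefore arbitrary.
            (l′ , _ , _ , L′ , ≲L′) = lates i (g (middle i)) (g (middle i))
        in core L L′ (M j) (distinct-middle i k ik) (distinct-middle i j ij) (distinct-middle k j (≢-sym jk))
             (L≲ j) (≲L′ j)
             (λ p q → let (l , ≢p , ≢q , L , ≲L) = lates k p q in l , ≢p , ≢q , L , ≲L j)
             -- Wedges depend only on the tip, so what is known for the middle side holds for every
             -- side ending in Y.
             cj (λ L → cone (InCone.right ck) (InCone.swept ck))

  module _ {n} (v : Fin n → Point) (E : List (Subset n))
           (distinct : ∀ i j → i ≢ j → ¬ (proj₁ (v i) ≅ proj₁ (v j))) (generic : NoThreeOnALine v)
           (free : NoThreeCrossing v E) where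

    private
      x y : Fin n → ℝ
      x i = proj₁ (v i)
      y i = proj₂ (v i)

    record Item : Set where
      field
        edge   : Subset n
        edge∈  : edge ∈ E
        placed : Placed v E edge
      open Placed placed public
    open Item

    outer : Item → Fin (n ℕ.* n)
    outer a = combine (l a) (r a)

    spot : Item → Fin (n ℕ.* 2)
    spot a = combine (m a) (side a)

    items : ∀ {xs} → (∀ {e} → e ∈ xs → e ∈ E) → All (Placed v E) xs → List Item
    items sub []       = []
    items sub (p ∷ ps) = record { edge∈ = sub (here ≡.refl) ; placed = p } ∷ items (λ e∈ → sub (there e∈)) ps

    length-items : ∀ {xs} (sub : ∀ {e} → e ∈ xs → e ∈ E) (ps : All (Placed v E) xs) → length (items sub ps) ≡ length xs
    length-items sub []       = ≡.refl
    length-items sub (p ∷ ps) = cong suc (length-items (λ e∈ → sub (there e∈)) ps)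

    items-distinct : ∀ {xs} (sub : ∀ {e} → e ∈ xs → e ∈ E) (ps : All (Placed v E) xs) → Unique xs →
                     AllPairs (λ a b → edge a ≢ edge b) (items sub ps)
    items-distinct sub []       []       = []
    items-distinct sub (p ∷ ps) (e≢ ∷ u) = go _ ps e≢ ∷ items-distinct _ ps u
      where
      go : ∀ {e xs} (sub : ∀ {e} → e ∈ xs → e ∈ E) (ps : All (Placed v E) xs) → All (e ≢_) xs → All (λ b → e ≢ edge b) (items sub ps)
      go sub []       []       = []
      go sub (p ∷ ps) (q ∷ qs) = q ∷ go _ ps qs

    same-edge : ∀ {a b} → l a ≡ l b → m a ≡ m b → r a ≡ r b → edge a ≡ edge b
    same-edge {a} {b} el em er = spans-unique (spans a) (subst₂ (λ i k → Spans (edge b) i (m a) k) (sym el) (sym er)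
      (subst (λ j → Spans (edge b) (l b) j (r b)) (sym em) (spans b)))

    module _ (as : List Item) (distinct-edges : AllPairs (λ a b → edge a ≢ edge b) as) where

      -- Edges on the same outer pair have different middle vertices, as an edge is determined by
      -- its three vertices; among seven of these, one escapes any six.
      is-heavy : ∀ a → 6 ℕ.< count outer (outer a) as → Heavy E (l a) (r a)
      is-heavy a many avoid short =
        let (b , b∈ , b∉) = avoiding FinP._≟_ m avoid bs apexes-distinct (ℕP.≤-<-trans short many)
            (el , er) = on-pair (∈-filter⁻ (λ b → outer b FinP.≟ outer a) {b} {as} b∈)
        in m b , b∉ , edge b , edge∈ b , subst₂ (λ i k → Spans (edge b) i (m b) k) el er (spans b)
        where
        bs = fibre outer (outer a) as
        on-pair : ∀ {b} → b ∈ as × outer b ≡ outer a → l b ≡ l a × r b ≡ r a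
        on-pair {b} (_ , e) = combine-injective (l b) (r b) (l a) (r a) e
        apexes-distinct : AllPairs (λ b c → m b ≢ m c) bs
        apexes-distinct = AllPairs-map-All
          (λ {b} {c} (lb , rb) (lc , rc) ne em → ne (same-edge {b} {c} (≡.trans lb (sym lc)) em (≡.trans rb (sym rc))))
          (All.tabulate (λ {b} b∈ → on-pair (∈-filter⁻ (λ b → outer b FinP.≟ outer a) {b} {as} b∈)))
          (AllPairs.filter⁺ (λ b → outer b FinP.≟ outer a) distinct-edges)

      -- The links of m above (side 0) and below (side 1), reflected so that they
      -- lie above, and with left and right exchanged when t is 1.
      module Reflected (m₀ : Fin n) (s t : Fin 2) where

        α γ δ ε : ℝ
        α = sign t
        γ = -ℝ (sign t *ℝ x m₀)
        δ = sign s
        ε = -ℝ (sign s *ℝ y m₀)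

        u : Fin n → Point
        u = transform α 0ℝ γ δ ε (sign² t) (sign² s) v

        x₀ : proj₁ (u m₀) ≅ 0ℝ
        x₀ = termwise (λ k → lem (seq α k) (seq (x m₀) k) (seq (y m₀) k))
          where
          lem : ∀ a x y → (a * x + 0ℚ * y) + (- (a * x)) ≡ 0ℚ
          lem = solve-∀ ℚ-ring

        y₀ : proj₂ (u m₀) ≅ 0ℝ
        y₀ = termwise (λ k → lem (seq δ k) (seq (y m₀) k))
          where
          lem : ∀ a x → a * x + (- (a * x)) ≡ 0ℚ
          lem = solve-∀ ℚ-ring

        generic-u : NoThreeOnALine u
        generic-u = transform-generic α 0ℝ γ δ ε (sign² t) (sign² s) v generic

        free-u : NoThreeCrossing u E
        free-u = transform-free α 0ℝ γ δ ε (sign² t) (sign² s) v free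

        open LinkOf u E m₀ x₀ y₀ generic-u free-u public

      module _ (m₀ : Fin n) (s : Fin 2) where

        OnSide : Item → Set
        OnSide a = 6 ℕ.< count outer (outer a) as × m a ≡ m₀ × side a ≡ s

        -- The height as seen after the reflection that brings side `s` above `m₀`, hence positive
        -- for items on that side.
        level : Item → ℝ
        level a = sign s *ℝ height a

        link-right : ∀ {a} → OnSide a → Reflected.Link m₀ s zero (l a) (r a)
        link-right {a} (many , ≡.refl , ≡.refl) = record
          { l<0 = Pos-resp (termwise (λ k → e₁ (seq (x (m a)) k) (seq (x (l a)) k) (seq (y (l a)) k))) (l<m a)
          ; r>0 = Pos-resp (termwise (λ k → e₂ (seq (x (m a)) k) (seq (x (r a)) k) (seq (y (r a)) k))) (m<r a)
          ; height = level a
          ; height>0 = off-line a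
          ; height-eq = modulo (sign s) (≅⇒≅0 (height-eq a)) (termwise (λ k → e₃ (seq (sign s) k) (seq (height a) k)
              (seq (x (l a)) k) (seq (x (m a)) k) (seq (x (r a)) k) (seq (y (l a)) k) (seq (y (m a)) k) (seq (y (r a)) k)))
          ; edge∈ = edge∈ a ; spans = spans a ; heavy = is-heavy a many }
          where
          e₁ : ∀ m l y → m - l ≡ - ((1ℚ * l + 0ℚ * y) + (- (1ℚ * m)))
          e₁ = solve-∀ ℚ-ring
          e₂ : ∀ m r y → r - m ≡ (1ℚ * r + 0ℚ * y) + (- (1ℚ * m))
          e₂ = solve-∀ ℚ-ring
          e₃ : ∀ s h l m r p q w →
            (s * h) * (((1ℚ * r + 0ℚ * w) + (- (1ℚ * m))) - ((1ℚ * l + 0ℚ * p) + (- (1ℚ * m)))) ≡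
            (((1ℚ * r + 0ℚ * w) + (- (1ℚ * m))) * (s * p + (- (s * q))) - ((1ℚ * l + 0ℚ * p) + (- (1ℚ * m))) * (s * w + (- (s * q))))
            + s * (h * (r - l) - ((r - m) * (p - q) - (l - m) * (w - q)))
          e₃ = solve-∀ ℚ-ring

        link-left : ∀ {a} → OnSide a → Reflected.Link m₀ s (suc zero) (r a) (l a)
        link-left {a} (many , ≡.refl , ≡.refl) = record
          { l<0 = Pos-resp (termwise (λ k → e₁ (seq (x (m a)) k) (seq (x (r a)) k) (seq (y (r a)) k))) (m<r a)
          ; r>0 = Pos-resp (termwise (λ k → e₂ (seq (x (m a)) k) (seq (x (l a)) k) (seq (y (l a)) k))) (l<m a)
          ; height = level a
          ; height>0 = off-line a
          ; height-eq = modulo (sign s) (≅⇒≅0 (height-eq a)) (termwise (λ k → e₃ (seq (sign s) k) (seq (height a) k)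
              (seq (x (l a)) k) (seq (x (m a)) k) (seq (x (r a)) k) (seq (y (l a)) k) (seq (y (m a)) k) (seq (y (r a)) k)))
          ; edge∈ = edge∈ a ; spans = spans-swap (spans-rotate (spans a))
          ; heavy = λ avoid short → let (w , w∉ , e , e∈ , S) = is-heavy a many avoid short in
              w , w∉ , e , e∈ , spans-swap (spans-rotate S) }
          where
          e₁ : ∀ m r y → r - m ≡ - (((- 1ℚ) * r + 0ℚ * y) + (- ((- 1ℚ) * m)))
          e₁ = solve-∀ ℚ-ring
          e₂ : ∀ m l y → m - l ≡ ((- 1ℚ) * l + 0ℚ * y) + (- ((- 1ℚ) * m))
          e₂ = solve-∀ ℚ-ring
          e₃ : ∀ s h l m r p q w →
            (s * h) * ((((- 1ℚ) * l + 0ℚ * p) + (- ((- 1ℚ) * m))) - (((- 1ℚ) * r + 0ℚ * w) + (- ((- 1ℚ) * m)))) ≡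
            ((((- 1ℚ) * l + 0ℚ * p) + (- ((- 1ℚ) * m))) * (s * w + (- (s * q))) - (((- 1ℚ) * r + 0ℚ * w) + (- ((- 1ℚ) * m))) * (s * p + (- (s * q))))
            + s * (h * (r - l) - ((r - m) * (p - q) - (l - m) * (w - q)))
          e₃ = solve-∀ ℚ-ring

        -- With `m₀` fixed, distinct edges have distinct outer pairs, so `columns-exist` applies to
        -- the items sorted by `level`; the length is its threshold.
        link-small : ∀ bs → All OnSide bs → AllPairs (λ a b → edge a ≢ edge b) bs → ¬ ((8 ℕ.* n ℕ.+ 1) ℕ.* 5 ℕ.≤ length bs)
        link-small bs on-side distinct-edges-bs big = sorting _⊑_ (λ {a} {b} {c} → ⊑-trans {a} {b} {c}) (λ a b → ⊑-total a b) bs λ { (ys , ys↭ , sorted) →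
          conclude ys (All-resp-↭ (↭-sym ys↭) on-side) sorted
            (AllPairs-resp-↭ (λ d (e , e′) → d (sym e , sym e′)) (↭-sym ys↭) differ)
            (ℕP.≤-trans big (ℕP.≤-reflexive (sym (↭-length ys↭)))) }
          where
          _⊑_ : Item → Item → Set
          a ⊑ b = NonNeg (level b -ℝ level a)
          ⊑-trans : ∀ {a b c} → a ⊑ b → b ⊑ c → a ⊑ c
          ⊑-trans {a} {b} {c} p q = NonNeg-resp (termwise (λ k → lem (seq (level a) k) (seq (level b) k) (seq (level c) k))) (NonNeg-+ p q)
            where
            lem : ∀ a b c → (b - a) + (c - b) ≡ c - a
            lem = solve-∀ ℚ-ring
          ⊑-total : ∀ a b → ¬ ¬ (a ⊑ b ⊎ b ⊑ a)
          ⊑-total a b k = NonNeg-total (level b -ℝ level a) λ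
            { (inj₁ p) → k (inj₁ p) ; (inj₂ p) → k (inj₂ (NonNeg-resp (termwise (λ k → lem (seq (level a) k) (seq (level b) k))) p)) }
            where
            lem : ∀ a b → - (b - a) ≡ a - b
            lem = solve-∀ ℚ-ring
          differ : AllPairs (Differ l r) bs
          differ = AllPairs-map-All (λ {a} {b} (_ , ma , _) (_ , mb , _) ne (el , er) → ne (same-edge {a} {b} el (≡.trans ma (sym mb)) er)) on-side distinct-edges-bs
          conclude : ∀ ys → All OnSide ys → AllPairs _⊑_ ys → AllPairs (Differ l r) ys → (8 ℕ.* n ℕ.+ 1) ℕ.* 5 ℕ.≤ length ys → ⊥
          conclude ys on sorted pairs big with columns-exist _⊑_ l r ys sorted pairs big
          ... | inj₁ C = columns-absurd u E m₀ x₀ y₀ generic-u free-u r l level ys (λ {a} a∈ → link-right {a} (All.lookup on a∈)) (λ {a} a∈ → height-right {a} (All.lookup on a∈)) C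
            where
            open Reflected m₀ s zero
            height-right : ∀ {a} (o : OnSide a) → Link.height (link-right {a} o) ≡ level a
            height-right {a} (_ , ≡.refl , ≡.refl) = ≡.refl
          -- Three left ends differ: in the mirror image about the vertical line through `m₀` they
          -- become right ends, and heights are unchanged.
          ... | inj₂ C = columns-absurd u E m₀ x₀ y₀ generic-u free-u l r level ys (λ {a} a∈ → link-left {a} (All.lookup on a∈)) (λ {a} a∈ → height-left {a} (All.lookup on a∈)) C
            where
            open Reflected m₀ s (suc zero)
            height-left : ∀ {a} (o : OnSide a) → Link.height (link-left {a} o) ≡ level a
            height-left {a} (_ , ≡.refl , ≡.refl) = ≡.refl

      -- At most six items are lost for each of the n² outer pairs. The others are distributed over
      -- 2n spots, a middle vertex with a side, each of which `link-small` bounds.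
      items-few : length as ℕ.≤ (n ℕ.* n) ℕ.* 6 ℕ.+ (n ℕ.* 2) ℕ.* ((8 ℕ.* n ℕ.+ 1) ℕ.* 5)
      items-few = ℕP.≤-trans (length-heavy outer 6 as) (ℕP.+-monoʳ-≤ ((n ℕ.* n) ℕ.* 6)
        (length≤fibres spot heavies ((8 ℕ.* n ℕ.+ 1) ℕ.* 5) λ j → ℕP.<⇒≤ (ℕP.≰⇒> (few j))))
        where
        heavies = filter (heavy? outer 6 as) as
        few : ∀ j → ¬ ((8 ℕ.* n ℕ.+ 1) ℕ.* 5 ℕ.≤ count spot j heavies)
        few j = link-small (proj₁ (remQuot {n} 2 j)) (proj₂ (remQuot {n} 2 j)) (fibre spot j heavies)
          (All.tabulate λ {a} a∈ → on-side a (∈-filter⁻ (λ a → spot a FinP.≟ j) {a} {heavies} a∈))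
          (AllPairs.filter⁺ (λ a → spot a FinP.≟ j) (AllPairs.filter⁺ (heavy? outer 6 as) distinct-edges))
          where
          on-side : ∀ a → a ∈ heavies × spot a ≡ j → OnSide (proj₁ (remQuot {n} 2 j)) (proj₂ (remQuot {n} 2 j)) a
          on-side a (a∈ , e) = proj₂ (∈-filter⁻ (heavy? outer 6 as) {a} {as} a∈) ,
            combine-injective (m a) (side a) _ _ (≡.trans e (sym (combine-remQuot {n} 2 j)))

    edges-few : Unique E → All (λ e → ∣ e ∣ ≡ 3) E →
      ¬ ¬ (length E ℕ.≤ (n ℕ.* n) ℕ.* 6 ℕ.+ (n ℕ.* 2) ℕ.* ((8 ℕ.* n ℕ.+ 1) ℕ.* 5))
    edges-few unique triples k = ¬¬-All (All.map (λ {e} h → place-edge v E distinct generic e h) triples) λ ps →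
      k (subst (ℕ._≤ (n ℕ.* n) ℕ.* 6 ℕ.+ (n ℕ.* 2) ℕ.* ((8 ℕ.* n ℕ.+ 1) ℕ.* 5)) (length-items (λ e∈ → e∈) ps)
        (items-few (items (λ e∈ → e∈) ps) (items-distinct (λ e∈ → e∈) ps unique)))

-- All triples through one vertex, on points of a parabola.

module LowerBound where

  open import Defs hiding (_≈_; split)
  open RealArithmetic
  open Transformations
  open import Data.Nat.Base as ℕ using (ℕ; suc; zero)
  import Data.Nat.Properties as ℕP
  open import Data.Nat.Tactic.RingSolver using () renaming (solve-∀ to solve-ℕ)
  open import Data.Rational.Base using (0ℚ; 1ℚ; _+_; _*_; _-_; -_)
  open import Data.Fin.Base using (Fin; zero; suc; toℕ)
  open import Data.Fin.Properties using (toℕ-injective)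
  open import Data.Fin.Subset as Subset using (Subset; ∣_∣; inside; outside)
  open import Data.Fin.Subset.Properties using (x∈p∩q⁺)
  open import Data.Vec.Base using ([]; _∷_; here)
  open import Data.Vec.Properties using (∷-injectiveʳ)
  open import Data.List.Base using (List; []; _∷_; length; map; _++_)
  open import Data.List.Properties using (length-map; length-++)
  open import Data.List.Membership.Propositional using (_∈_)
  open import Data.List.Membership.Propositional.Properties using (∈-map⁻)
  open import Data.List.Relation.Unary.All as All using (All; []; _∷_)
  import Data.List.Relation.Unary.All.Properties as All
  open import Data.List.Relation.Unary.AllPairs using ([]; _∷_)
  open import Data.List.Relation.Unary.Unique.Propositional using (Unique)
  import Data.List.Relation.Unary.Unique.Propositional.Properties as Unique
  open import Data.Product using (∃; _×_; _,_)
  open import Data.Empty using (⊥; ⊥-elim)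
  open import Relation.Binary.Definitions using (tri<; tri≈; tri>)
  open import Relation.Nullary using (¬_)
  open import Relation.Binary.PropositionalEquality
  open import Tactic.RingSolver using (solve-∀)

  choose : ℕ → ∀ n → List (Subset n)
  choose zero    zero    = [] ∷ []
  choose (suc k) zero    = []
  choose zero    (suc n) = map (outside ∷_) (choose zero n)
  choose (suc k) (suc n) = map (inside ∷_) (choose k n) ++ map (outside ∷_) (choose (suc k) n)

  choose-size : ∀ k n → All (λ s → ∣ s ∣ ≡ k) (choose k n)
  choose-size zero    zero    = refl ∷ []
  choose-size (suc k) zero    = []
  choose-size zero    (suc n) = All.map⁺ (choose-size zero n)
  choose-size (suc k) (suc n) = All.++⁺ (All.map⁺ (All.map (cong suc) (choose-size k n))) (All.map⁺ (choose-size (suc k) n))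

  choose-unique : ∀ k n → Unique (choose k n)
  choose-unique zero    zero    = [] ∷ []
  choose-unique (suc k) zero    = []
  choose-unique zero    (suc n) = Unique.map⁺ ∷-injectiveʳ (choose-unique zero n)
  choose-unique (suc k) (suc n) = Unique.++⁺ (Unique.map⁺ ∷-injectiveʳ (choose-unique k n))
    (Unique.map⁺ ∷-injectiveʳ (choose-unique (suc k) n)) λ (i∈ , o∈) → heads (∈-map⁻ _ i∈) (∈-map⁻ _ o∈)
    where
    heads : ∀ {s : Subset (suc n)} {xs ys : List (Subset n)} →
      (∃ λ t → t ∈ xs × s ≡ inside ∷ t) → (∃ λ t → t ∈ ys × s ≡ outside ∷ t) → ⊥
    heads (_ , _ , refl) (_ , _ , ())

  length-choose₀ : ∀ n → length (choose 0 n) ≡ 1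
  length-choose₀ zero    = refl
  length-choose₀ (suc n) = trans (length-map (outside ∷_) (choose 0 n)) (length-choose₀ n)

  length-choose-suc : ∀ k n → length (choose (suc k) (suc n)) ≡ length (choose k n) ℕ.+ length (choose (suc k) n)
  length-choose-suc k n = trans (length-++ (map (inside ∷_) (choose k n)))
    (cong₂ ℕ._+_ (length-map (inside ∷_) (choose k n)) (length-map (outside ∷_) (choose (suc k) n)))

  length-choose₁ : ∀ n → length (choose 1 n) ≡ n
  length-choose₁ zero    = refl
  length-choose₁ (suc n) = trans (length-choose-suc 0 n) (cong₂ ℕ._+_ (length-choose₀ n) (length-choose₁ n))

  -- The formula n(n - 1)/2, arranged so as to need neither subtraction nor division.
  length-choose₂ : ∀ n → 2 ℕ.* length (choose 2 n) ℕ.+ n ≡ n ℕ.* n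
  length-choose₂ zero    = refl
  length-choose₂ (suc n) = begin
    2 ℕ.* length (choose 2 (suc n)) ℕ.+ suc n             ≡⟨ cong (λ l → 2 ℕ.* l ℕ.+ suc n) (length-choose-suc 1 n) ⟩
    2 ℕ.* (length (choose 1 n) ℕ.+ L) ℕ.+ suc n           ≡⟨ cong (λ l → 2 ℕ.* (l ℕ.+ L) ℕ.+ suc n) (length-choose₁ n) ⟩
    2 ℕ.* (n ℕ.+ L) ℕ.+ suc n                             ≡⟨ lem n L ⟩
    (2 ℕ.* L ℕ.+ n) ℕ.+ (2 ℕ.* n ℕ.+ 1)                   ≡⟨ cong (ℕ._+ (2 ℕ.* n ℕ.+ 1)) (length-choose₂ n) ⟩
    n ℕ.* n ℕ.+ (2 ℕ.* n ℕ.+ 1)                           ≡⟨ lem₁ n ⟩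
    suc n ℕ.* suc n                                       ∎
    where
    open ≡-Reasoning
    L = length (choose 2 n)
    lem : ∀ n L → 2 ℕ.* (n ℕ.+ L) ℕ.+ suc n ≡ (2 ℕ.* L ℕ.+ n) ℕ.+ (2 ℕ.* n ℕ.+ 1)
    lem = solve-ℕ
    lem₁ : ∀ n → n ℕ.* n ℕ.+ (2 ℕ.* n ℕ.+ 1) ≡ suc n ℕ.* suc n
    lem₁ = solve-ℕ

  parabola : ∀ {n} → Fin n → Point
  parabola i = nat (toℕ i) , nat (toℕ i) *ℝ nat (toℕ i)

  -- The sign of the gap is read off the indices, so no `¬ ¬` arises.
  gap-cancel : ∀ {n} {i j : Fin n} {z} → i ≢ j → (nat (toℕ i) -ℝ nat (toℕ j)) *ℝ z ≅ 0ℝ → z ≅ 0ℝ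
  gap-cancel {i = i} {j} {z} i≢j h with ℕP.<-cmp (toℕ i) (toℕ j)
  ... | tri> _ _ j<i = null-cancel (nat-mono-< j<i) h
  ... | tri≈ _ e _   = ⊥-elim (i≢j (toℕ-injective e))
  ... | tri< i<j _ _ = null-cancel (nat-mono-< i<j)
          (≅-trans (termwise (λ k → lem (seq (nat (toℕ i)) k) (seq (nat (toℕ j)) k) (seq z k))) (neg-null h))
    where
    lem : ∀ a b z → (b - a) * z ≡ - ((a - b) * z)
    lem = solve-∀ ℚ-ring

  parabola-distinct : ∀ {n} (i j : Fin n) → i ≢ j → ¬ (parabola i Defs.≈ parabola j)
  parabola-distinct i j i≢j (x≃ , _) = Pos⇒≇0 1>0 (gap-cancel i≢j
    (≅-trans (termwise (λ k → lem (seq (nat (toℕ i)) k) (seq (nat (toℕ j)) k))) (≅⇒≅0 {nat (toℕ i)} {nat (toℕ j)} ⟨ x≃ ⟩)))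
    where
    lem : ∀ a b → (a - b) * 1ℚ ≡ a - b
    lem = solve-∀ ℚ-ring

  -- The second divided difference of a x + b x² at three abscissae is b.
  parabola-general : ∀ {n} → GeneralPosition (parabola {n})
  parabola-general i j k i≢j j≢k i≢k ((a , b , c , nontrivial) , hi , hj , hk) = nontrivial (≃-proof a≅0 , ≃-proof b≅0)
    where
    X Y Z : ℝ
    X = nat (toℕ i)
    Y = nat (toℕ j)
    Z = nat (toℕ k)
    on : ∀ x → Set
    on x = a *ℝ x +ℝ b *ℝ (x *ℝ x) ≅ c
    hi′ : on X
    hi′ = ⟨ hi ⟩
    hj′ : on Y
    hj′ = ⟨ hj ⟩
    hk′ : on Z
    hk′ = ⟨ hk ⟩
    b≅0 : b ≅ 0ℝ
    b≅0 = gap-cancel i≢j (gap-cancel i≢k (gap-cancel j≢k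
      (modulo (Y -ℝ Z) (≅⇒≅0 hi′) (modulo (-ℝ (X -ℝ Z)) (≅⇒≅0 hj′) (modulo (X -ℝ Y) (≅⇒≅0 hk′)
        (termwise (λ n → lem (seq X n) (seq Y n) (seq Z n) (seq a n) (seq b n) (seq c n))))))))
      where
      lem : ∀ x y z a b c → (y - z) * ((x - z) * ((x - y) * b)) ≡
        ((0ℚ + (y - z) * ((a * x + b * (x * x)) - c)) + (- (x - z)) * ((a * y + b * (y * y)) - c)) + (x - y) * ((a * z + b * (z * z)) - c)
      lem = solve-∀ ℚ-ring
    a≅0 : a ≅ 0ℝ
    a≅0 = gap-cancel i≢j (modulo 1ℝ (≅⇒≅0 hi′) (modulo (-ℝ 1ℝ) (≅⇒≅0 hj′) (modulo (-ℝ (X *ℝ X -ℝ Y *ℝ Y)) b≅0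
        (termwise (λ n → lem (seq X n) (seq Y n) (seq a n) (seq b n) (seq c n))))))
      where
      lem : ∀ x y a b c → (x - y) * a ≡
        ((0ℚ + 1ℚ * ((a * x + b * (x * x)) - c)) + (- 1ℚ) * ((a * y + b * (y * y)) - c)) + (- (x * x - y * y)) * b
      lem = solve-∀ ℚ-ring

  star : ∀ n → Hypergraph (suc n)
  star n = record
    { vertex   = parabola
    ; distinct = parabola-distinct
    ; general  = parabola-general
    ; edges    = map (inside ∷_) (choose 2 n)
    ; triples  = All.map⁺ (All.map (cong suc) (choose-size 2 n))
    ; unique   = Unique.map⁺ ∷-injectiveʳ (choose-unique 2 n)
    }

  star-free : ∀ n → ¬ StronglyCrossing 3 (star n)
  star-free n (e , e∈ , disjoint , _) = disjoint zero (suc zero) (λ ()) (zero , x∈p∩q⁺ (centre zero , centre (suc zero)))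
    where
    centre : ∀ s → zero Subset.∈ e s
    centre s with ∈-map⁻ (inside ∷_) (e∈ s)
    ... | t , _ , eq = subst (zero Subset.∈_) (sym eq) here

  -- Eight times the edge count is 4n² - 4n, which reaches (n + 1)² at n = 3; at n = 2 it is 8
  -- against 9. The term 4n is moved across to stay within the naturals.
  star-size : ∀ n → 3 ℕ.≤ n → suc n ℕ.* suc n ℕ.≤ 8 ℕ.* edgeCount (star n)
  star-size n 3≤n = ℕP.+-cancelʳ-≤ (4 ℕ.* n) (suc n ℕ.* suc n) (8 ℕ.* edgeCount (star n)) (begin
    suc n ℕ.* suc n ℕ.+ 4 ℕ.* n                     ≡⟨ lem n ⟩
    n ℕ.* n ℕ.+ (6 ℕ.* n ℕ.+ 1)                     ≤⟨ ℕP.+-monoʳ-≤ (n ℕ.* n) (ℕP.+-monoʳ-≤ (6 ℕ.* n) (ℕP.≤-trans (ℕ.s≤s ℕ.z≤n) 3≤n)) ⟩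
    n ℕ.* n ℕ.+ (6 ℕ.* n ℕ.+ n)                     ≤⟨ ℕP.+-monoʳ-≤ (n ℕ.* n) (ℕP.+-monoʳ-≤ (6 ℕ.* n) (ℕP.m≤n*m n 3)) ⟩
    n ℕ.* n ℕ.+ (6 ℕ.* n ℕ.+ 3 ℕ.* n)               ≡⟨ lem₁ n ⟩
    n ℕ.* n ℕ.+ 3 ℕ.* (3 ℕ.* n)                     ≤⟨ ℕP.+-monoʳ-≤ (n ℕ.* n) (ℕP.*-monoʳ-≤ 3 (ℕP.*-monoˡ-≤ n 3≤n)) ⟩
    n ℕ.* n ℕ.+ 3 ℕ.* (n ℕ.* n)                     ≡⟨ lem₂ n ⟩
    4 ℕ.* (n ℕ.* n)                                 ≡⟨ cong (4 ℕ.*_) (length-choose₂ n) ⟨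
    4 ℕ.* (2 ℕ.* length (choose 2 n) ℕ.+ n)         ≡⟨ lem₃ n (length (choose 2 n)) ⟩
    8 ℕ.* length (choose 2 n) ℕ.+ 4 ℕ.* n           ≡⟨ cong (λ l → 8 ℕ.* l ℕ.+ 4 ℕ.* n) (length-map (inside ∷_) (choose 2 n)) ⟨
    8 ℕ.* edgeCount (star n) ℕ.+ 4 ℕ.* n            ∎)
    where
    open ℕP.≤-Reasoning
    lem : ∀ n → suc n ℕ.* suc n ℕ.+ 4 ℕ.* n ≡ n ℕ.* n ℕ.+ (6 ℕ.* n ℕ.+ 1)
    lem = solve-ℕ
    lem₁ : ∀ n → n ℕ.* n ℕ.+ (6 ℕ.* n ℕ.+ 3 ℕ.* n) ≡ n ℕ.* n ℕ.+ 3 ℕ.* (3 ℕ.* n)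
    lem₁ = solve-ℕ
    lem₂ : ∀ n → n ℕ.* n ℕ.+ 3 ℕ.* (n ℕ.* n) ≡ 4 ℕ.* (n ℕ.* n)
    lem₂ = solve-ℕ
    lem₃ : ∀ n l → 4 ℕ.* (2 ℕ.* l ℕ.+ n) ≡ 8 ℕ.* l ℕ.+ 4 ℕ.* n
    lem₃ = solve-ℕ

-- The extremal number and its bounds with real constants.

open import Defs hiding (_≈_; split)
open RealArithmetic
open Hulls
open Links
open Transformations
open UpperBound
open LowerBound
open import Data.Nat.Base as ℕ using (ℕ; suc; zero; _≤_; _^_; s≤s; z≤n)
import Data.Nat.Properties as ℕP
open import Data.Nat.Tactic.RingSolver using () renaming (solve-∀ to solve-ℕ)
import Data.Integer.Base as ℤ
import Data.Integer.Properties as ℤP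
open import Data.Rational.Base as ℚ using (ℚ; 0ℚ; 1ℚ; _+_; _*_; fromℚᵘ; toℚᵘ)
import Data.Rational.Properties as ℚP
open import Data.Rational.Unnormalised.Base as ℚᵘ using (ℚᵘ; mkℚᵘ; *≤*)
import Data.Rational.Unnormalised.Properties as ℚᵘP
open import Data.Fin.Base using (Fin; zero; suc)
open import Data.Fin.Subset as Subset using (Subset)
open import Data.Fin.Subset.Properties using (x∈p∩q⁺; x∈p∩q⁻)
open import Data.List.Membership.Propositional using (_∈_)
open import Data.Product using (∃; _×_; _,_; proj₁; proj₂)
open import Data.Empty using (⊥; ⊥-elim)
open import Relation.Nullary using (¬_)
open import Relation.Nullary.Decidable using (decidable-stable)
open import Relation.Binary.PropositionalEquality
open import Tactic.RingSolver using (solve-∀)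

module _ {n} (H : Hypergraph n) (free : ¬ StronglyCrossing 3 H) where

  vertices-generic : NoThreeOnALine (vertex H)
  vertices-generic i j k ij jk ik a b c nontrivial hi hj hk = general H i j k ij jk ik
    ((a , b , c , λ (a≃0 , b≃0) → nontrivial (⟨ a≃0 ⟩ , ⟨ b≃0 ⟩)) , ≃-proof hi , ≃-proof hj , ≃-proof hk)

  no-three-crossing : NoThreeCrossing (vertex H) (edges H)
  no-three-crossing {a} {b} {c} a∈ b∈ c∈ ab ac bc P ha hb hc = free (e , e∈ , disjoint , P , hulls)
    where
    e : Fin 3 → Subset n
    e zero             = a
    e (suc zero)       = b
    e (suc (suc zero)) = c
    e∈ : ∀ s → e s ∈ edges H
    e∈ zero             = a∈
    e∈ (suc zero)       = b∈
    e∈ (suc (suc zero)) = c∈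
    hulls : ∀ s → InHull (vertex H) (e s) P
    hulls zero             = Hull⇒InHull ha
    hulls (suc zero)       = Hull⇒InHull hb
    hulls (suc (suc zero)) = Hull⇒InHull hc
    flip : ∀ {p q : Subset n} → Subset.Empty (p Subset.∩ q) → Subset.Empty (q Subset.∩ p)
    flip {p} {q} empty (x , x∈) = let (x∈q , x∈p) = x∈p∩q⁻ q p x∈ in empty (x , x∈p∩q⁺ (x∈p , x∈q))
    disjoint : ∀ s t → s ≢ t → Subset.Empty (e s Subset.∩ e t)
    disjoint zero             zero             s≢t = ⊥-elim (s≢t refl)
    disjoint zero             (suc zero)       s≢t = ab
    disjoint zero             (suc (suc zero)) s≢t = ac
    disjoint (suc zero)       zero             s≢t = flip {a} {b} ab
    disjoint (suc zero)       (suc zero)       s≢t = ⊥-elim (s≢t refl)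
    disjoint (suc zero)       (suc (suc zero)) s≢t = bc
    disjoint (suc (suc zero)) zero             s≢t = flip {a} {c} ac
    disjoint (suc (suc zero)) (suc zero)       s≢t = flip {b} {c} bc
    disjoint (suc (suc zero)) (suc (suc zero)) s≢t = ⊥-elim (s≢t refl)

  -- The goal is decidable, so the shear and the placement may be used although they exist only
  -- under `¬ ¬`. The constant is 6 for light pairs plus 80 + 10 from 2n(8n + 1)5, with n ≤ n².
  upper-bound : edgeCount H ≤ 96 ℕ.* n ^ 2
  upper-bound = decidable-stable (edgeCount H ℕP.≤? 96 ℕ.* n ^ 2) λ k →
    shear-distinct (vertex H) (λ i j i≢j (x≅ , y≅) → distinct H i j i≢j (≃-proof x≅ , ≃-proof y≅)) λ (τ , τ-distinct) →
    edges-few (transform 1ℝ τ 0ℝ 1ℝ 0ℝ one one (vertex H)) (edges H)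
      (λ i j i≢j e → τ-distinct i j i≢j (≅-trans (simplify τ i) (≅-trans e (≅-sym (simplify τ j)))))
      (transform-generic 1ℝ τ 0ℝ 1ℝ 0ℝ one one (vertex H) vertices-generic)
      (transform-free 1ℝ τ 0ℝ 1ℝ 0ℝ one one (vertex H) no-three-crossing)
      (unique H) (triples H) λ few → k (ℕP.≤-trans few arith)
    where
    one : 1ℝ *ℝ 1ℝ ≅ 1ℝ
    one = sign² zero
    simplify : ∀ τ i → proj₁ (vertex H i) +ℝ τ *ℝ proj₂ (vertex H i) ≅ (1ℝ *ℝ proj₁ (vertex H i) +ℝ τ *ℝ proj₂ (vertex H i)) +ℝ 0ℝ
    simplify τ i = termwise (λ k → lem (seq (proj₁ (vertex H i)) k) (seq τ k) (seq (proj₂ (vertex H i)) k))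
      where
      lem : ∀ x t y → x + t * y ≡ (1ℚ * x + t * y) + 0ℚ
      lem = solve-∀ ℚ-ring
    arith : (n ℕ.* n) ℕ.* 6 ℕ.+ (n ℕ.* 2) ℕ.* ((8 ℕ.* n ℕ.+ 1) ℕ.* 5) ≤ 96 ℕ.* n ^ 2
    arith = begin
      (n ℕ.* n) ℕ.* 6 ℕ.+ (n ℕ.* 2) ℕ.* ((8 ℕ.* n ℕ.+ 1) ℕ.* 5) ≡⟨ lem n ⟩
      86 ℕ.* (n ℕ.* n) ℕ.+ 10 ℕ.* n                           ≤⟨ ℕP.+-monoʳ-≤ (86 ℕ.* (n ℕ.* n)) (ℕP.*-monoʳ-≤ 10 (square n)) ⟩
      86 ℕ.* (n ℕ.* n) ℕ.+ 10 ℕ.* (n ℕ.* n)                   ≡⟨ lem₁ n ⟩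
      96 ℕ.* n ^ 2                                            ∎
      where
      open ℕP.≤-Reasoning
      lem : ∀ n → (n ℕ.* n) ℕ.* 6 ℕ.+ (n ℕ.* 2) ℕ.* ((8 ℕ.* n ℕ.+ 1) ℕ.* 5) ≡ 86 ℕ.* (n ℕ.* n) ℕ.+ 10 ℕ.* n
      lem = solve-ℕ
      lem₁ : ∀ n → 86 ℕ.* (n ℕ.* n) ℕ.+ 10 ℕ.* (n ℕ.* n) ≡ 96 ℕ.* (n ℕ.* (n ℕ.* 1))
      lem₁ = solve-ℕ
      square : ∀ n → n ≤ n ℕ.* n
      square zero    = z≤n
      square (suc n) = ℕP.m≤m*n (suc n) (suc n)

-- As long as a crossing-free hypergraph is not maximal, a larger one exists. Edge counts never
-- exceed `96 ℕ.* n ^ 2`, so the distance `d` to this bound serves as fuel for the climb.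
extremal-exists : ∀ {n} (H : Hypergraph n) → ¬ StronglyCrossing 3 H → ¬ ¬ (∃ λ m → IsEx 3 n m)
extremal-exists {n} H free k = climb (96 ℕ.* n ^ 2) H free (ℕP.m≤n+m _ (edgeCount H))
  where
  climb : ∀ d (H : Hypergraph n) → ¬ StronglyCrossing 3 H → 96 ℕ.* n ^ 2 ≤ edgeCount H ℕ.+ d → ⊥
  climb zero H free h = k (edgeCount H , (H , free , refl) , λ H′ free′ →
    ℕP.≤-trans (upper-bound H′ free′) (ℕP.≤-trans h (ℕP.≤-reflexive (ℕP.+-identityʳ (edgeCount H)))))
  climb (suc d) H free h = k (edgeCount H , (H , free , refl) , λ H′ free′ →
    decidable-stable (edgeCount H′ ℕP.≤? edgeCount H) λ larger → climb d H′ free′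
      (ℕP.≤-trans h (ℕP.≤-trans (ℕP.≤-reflexive (ℕP.+-suc (edgeCount H) d)) (ℕP.+-monoˡ-≤ d (ℕP.≰⇒> larger)))))

-- The denominator is `suc d`. Unnormalised fractions reduce inequalities to integers without
-- greatest common divisors.
fraction : ℕ → ℕ → ℚᵘ
fraction a d = mkℚᵘ (ℤ.+ a) d

fraction-≤ : ∀ a d m n → a ℕ.* m ≤ suc d ℕ.* n → fromℚᵘ (fraction a d) * fromℚᵘ (fraction m 0) ℚ.≤ fromℚᵘ (fraction n 0)
fraction-≤ a d m n h = ℚP.toℚᵘ-cancel-≤ (begin
  toℚᵘ (fromℚᵘ (fraction a d) * fromℚᵘ (fraction m 0))           ≃⟨ ℚP.toℚᵘ-homo-* (fromℚᵘ (fraction a d)) (fromℚᵘ (fraction m 0)) ⟩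
  toℚᵘ (fromℚᵘ (fraction a d)) ℚᵘ.* toℚᵘ (fromℚᵘ (fraction m 0)) ≃⟨ ℚᵘP.*-cong (ℚP.toℚᵘ-fromℚᵘ (fraction a d)) (ℚP.toℚᵘ-fromℚᵘ (fraction m 0)) ⟩
  fraction a d ℚᵘ.* fraction m 0                                 ≤⟨ *≤* integers ⟩
  fraction n 0                                                   ≃⟨ ℚP.toℚᵘ-fromℚᵘ (fraction n 0) ⟨
  toℚᵘ (fromℚᵘ (fraction n 0))                                   ∎)
  where
  open ℚᵘP.≤-Reasoning
  integers : (ℤ.+ a ℤ.* ℤ.+ m) ℤ.* ℤ.+ 1 ℤ.≤ ℤ.+ n ℤ.* ℤ.+ (suc d ℕ.* 1)
  integers = subst₂ ℤ._≤_ (trans (ℤP.pos-* a m) (sym (ℤP.*-identityʳ (ℤ.+ a ℤ.* ℤ.+ m))))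
    (trans (cong ℤ.+_ (trans (ℕP.*-comm (suc d) n) (cong (n ℕ.*_) (sym (ℕP.*-identityʳ (suc d)))))) (ℤP.pos-* n (suc d ℕ.* 1)))
    (ℤ.+≤+ h)

fraction-≥ : ∀ a m n → n ≤ a ℕ.* m → fromℚᵘ (fraction n 0) ℚ.≤ fromℚᵘ (fraction a 0) * fromℚᵘ (fraction m 0)
fraction-≥ a m n h = ℚP.toℚᵘ-cancel-≤ (begin
  toℚᵘ (fromℚᵘ (fraction n 0))                                   ≃⟨ ℚP.toℚᵘ-fromℚᵘ (fraction n 0) ⟩
  fraction n 0                                                   ≤⟨ *≤* integers ⟩
  fraction a 0 ℚᵘ.* fraction m 0                                 ≃⟨ ℚᵘP.*-cong (ℚP.toℚᵘ-fromℚᵘ (fraction a 0)) (ℚP.toℚᵘ-fromℚᵘ (fraction m 0)) ⟨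
  toℚᵘ (fromℚᵘ (fraction a 0)) ℚᵘ.* toℚᵘ (fromℚᵘ (fraction m 0)) ≃⟨ ℚP.toℚᵘ-homo-* (fromℚᵘ (fraction a 0)) (fromℚᵘ (fraction m 0)) ⟨
  toℚᵘ (fromℚᵘ (fraction a 0) * fromℚᵘ (fraction m 0))           ∎)
  where
  open ℚᵘP.≤-Reasoning
  integers : ℤ.+ n ℤ.* ℤ.+ 1 ℤ.≤ (ℤ.+ a ℤ.* ℤ.+ m) ℤ.* ℤ.+ 1
  integers = subst₂ ℤ._≤_ (sym (ℤP.*-identityʳ (ℤ.+ n)))
    (trans (ℤP.pos-* a m) (sym (ℤP.*-identityʳ (ℤ.+ a ℤ.* ℤ.+ m)))) (ℤ.+≤+ h)

const-≤ℝ : ∀ x y p q → (∀ k → seq x k ≡ p) → (∀ k → seq y k ≡ q) → p ℚ.≤ q → x ≤ℝ y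
const-≤ℝ x y p q x≡p y≡q p≤q ε ε>0 = 0 , λ k _ → subst₂ ℚ._≤_ (sym (x≡p k)) (cong (_+ ε) (sym (y≡q k)))
  (ℚP.≤-trans p≤q (subst (ℚ._≤ q + ε) (ℚP.+-identityʳ q) (ℚP.+-monoʳ-≤ q (ℚP.<⇒≤ ε>0))))

theorem1p2 : ∃ λ (c : ℝ) → ∃ λ (C : ℝ) → ∃ λ (n₀ : ℕ) →
    0ℝ <ℝ c × 0ℝ <ℝ C ×
    (∀ n → n₀ ≤ n →
    (¬ ¬ (∃ λ m → IsEx 3 n m))
    × (∀ m → IsEx 3 n m →
    c *ℝ fromℕ (n ^ 2) ≤ℝ fromℕ m
    × fromℕ m ≤ℝ C *ℝ fromℕ (n ^ 2)))
-- The threshold is 4 since the star on `suc n` vertices is large enough from n = 3 on.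
theorem1p2 = fromℚ c , fromℚ C , 4 ,
  <-proof (fromℚ-pos c (ℚP.positive⁻¹ c)) , <-proof (fromℚ-pos C (ℚP.positive⁻¹ C)) , bounds
  where
  c C : ℚ
  -- This is 1/8, the constant of `star-size`.
  c = fromℚᵘ (fraction 1 7)
  C = fromℚᵘ (fraction 96 0)
  bounds : ∀ n → 4 ≤ n → (¬ ¬ (∃ λ m → IsEx 3 n m)) ×
    (∀ m → IsEx 3 n m → fromℚ c *ℝ fromℕ (n ^ 2) ≤ℝ fromℕ m × fromℕ m ≤ℝ fromℚ C *ℝ fromℕ (n ^ 2))
  bounds (suc n) (s≤s 3≤n) = extremal-exists (star n) (star-free n) , λ m ((H , free , count) , maximal) →
    const-≤ℝ (fromℚ c *ℝ fromℕ (suc n ^ 2)) (fromℕ m) _ _ (λ _ → refl) (λ _ → refl)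
      (fraction-≤ 1 7 (suc n ^ 2) m (lower m (maximal (star n) (star-free n)))) ,
    const-≤ℝ (fromℕ m) (fromℚ C *ℝ fromℕ (suc n ^ 2)) _ _ (λ _ → refl) (λ _ → refl)
      (fraction-≥ 96 (suc n ^ 2) m (subst (_≤ 96 ℕ.* suc n ^ 2) count (upper-bound H free)))
    where
    lower : ∀ m → edgeCount (star n) ≤ m → 1 ℕ.* suc n ^ 2 ≤ 8 ℕ.* m
    lower m h = ℕP.≤-trans (ℕP.≤-reflexive (lem n)) (ℕP.≤-trans (star-size n 3≤n) (ℕP.*-monoʳ-≤ 8 h))
      where
      lem : ∀ n → 1 ℕ.* (suc n ℕ.* (suc n ℕ.* 1)) ≡ suc n ℕ.* suc n
      lem = solve-ℕ
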